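{- Let $p\ge 7$ be a prime with $p\equiv 1\pmod 3$, and suppose that \[ \Lambda_p(C_{\mathrm{mix}}U_p^\ell)\equiv 0\pmod{p^4},\qquad \ell=1,2,3. \] Then for every $m\ge 1$, \[ \Lambda_p(C_{\mathrm{mix}}H_{\mathrm{mix}}^{pm})\equiv C_{\mathrm{mix}}H_{\mathrm{mix}}^m\pmod{p^4}, \] and consequently $A_{mp}^{\mathrm{mix}}\equiv A_m^{\mathrm{mix}}\pmod{p^4}$ for all $m\ge1$.
   Context: $A_n^{\mathrm{mix}}:=108^n[z^n]\,{}_2F_1(\tfrac16,\tfrac13;1;z)^3$. Let $\chi_3$ be the nontrivial Dirichlet character mod $3$. Put $u(q):=q\prod_{n\ge1}(1-q^{3n})^{12}/(1-q^n)^{12}$, $t(q):=u/(1+27u)^2$, $H_{\mathrm{mix}}:=q/t$, $C_{\mathrm{mix}}(q):=1+\sum_{n\ge1}\bigl(3\sum_{d\mid n}\chi_3(d)d^4-27\sum_{d\mid n}\chi_3(n/d)d^4\bigr)q^n$. The Cartier operator is $\Lambda_p(\sum a_nq^n)=\sum a_{pn}q^n$, and $U_p(q):=\log\bigl(t(q)^p/t(q^p)\bigr)\in pq\mathbf{Z}_{(p)}[[q]]$. Congruences mod $p^4$ between power series are coefficientwise in $\mathbf{Z}_{(p)}$. -}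

module Defs where

open import Data.Nat as ℕ using (ℕ; zero; suc; _∸_; _≡ᵇ_; _%_)
open import Data.Nat.Divisibility as ℕD using ()
open import Data.Integer as ℤ using (ℤ; +_)
open import Data.Rational as ℚ using (ℚ; 0ℚ; 1ℚ; _+_; _*_; _-_; -_; _/_; ↥_; ↧ₙ_)
open import Data.Bool using (if_then_else_)
open import Data.Product using (_×_)
open import Relation.Nullary using (¬_)

-- x ∈ p^k Z_(p): in lowest terms x = a/b with p ∤ b and p^k ∣ a.
DivPow : ℕ → ℕ → ℚ → Set
DivPow p k x = (p ℕ.^ k) ℕD.∣ ℤ.∣ ↥ x ∣ × ¬ (p ℕD.∣ ↧ₙ x)

CongQ : ℕ → ℕ → ℚ → ℚ → Set
CongQ p k x y = DivPow p k (x - y)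

fromℕ : ℕ → ℚ
fromℕ n = + n / 1

sumTo : ℕ → (ℕ → ℚ) → ℚ
sumTo zero f = f 0
sumTo (suc n) f = sumTo n f + f (suc n)

sumFrom1 : ℕ → (ℕ → ℚ) → ℚ
sumFrom1 zero f = 0ℚ
sumFrom1 (suc n) f = sumFrom1 n f + f (suc n)

PS : Set
PS = ℕ → ℚ

CongPS : ℕ → ℕ → PS → PS → Set
CongPS p k f g = ∀ n → CongQ p k (f n) (g n)

const : ℚ → PS
const c zero = c
const c (suc n) = 0ℚ

oneS : PS
oneS = const 1ℚ

qpow : ℕ → PS
qpow j n = if j ≡ᵇ n then 1ℚ else 0ℚ

_⊕_ : PS → PS → PS
(f ⊕ g) n = f n + g n

_⊖_ : PS → PS → PS
(f ⊖ g) n = f n - g n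

scale : ℚ → PS → PS
scale c f n = c * f n

_⊛_ : PS → PS → PS
(f ⊛ g) n = sumTo n (λ i → f i * g (n ∸ i))

infixl 7 _⊛_
infixl 6 _⊕_ _⊖_

pow : PS → ℕ → PS
pow f zero = oneS
pow f (suc k) = f ⊛ pow f k

-- Inverse of a series with constant term 1:  1/f = Σ_k (1 - f)^k,
-- the n-th coefficient only involves k ≤ n since (1 - f) has no constant term.
inv1 : PS → PS
inv1 f n = sumTo n (λ k → pow (oneS ⊖ f) k n)

-- log of a series with constant term 1: log f = Σ_{k≥1} (-1)^{k+1} (f-1)^k / k,
-- the n-th coefficient only involves k ≤ n since (f - 1) has no constant term.
logS : PS → PS
logS f n = sumTo n term
  where
  term : ℕ → ℚ
  term zero = 0ℚ
  term (suc j) = (if j % 2 ≡ᵇ 0 then 1ℚ else - 1ℚ) * ((+ 1 / suc j) * pow (f ⊖ oneS) (suc j) n)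

subPow : ℕ → PS → PS
subPow p f n = sumTo n (λ k → if (k ℕ.* p) ≡ᵇ n then f k else 0ℚ)

-- division by q (for a series with zero constant term)
divq : PS → PS
divq f n = f (suc n)

Λ : ℕ → PS → PS
Λ p f n = f (p ℕ.* n)

shiftq : PS → PS
shiftq f zero = 0ℚ
shiftq f (suc n) = f n

etaProd : ℕ → PS
etaProd zero = oneS
etaProd (suc j) = etaProd j ⊛ (pow (oneS ⊖ qpow (3 ℕ.* suc j)) 12 ⊛ pow (inv1 (oneS ⊖ qpow (suc j))) 12)

-- E(q) = Π_{n≥1} (1 - q^{3n})^12 / (1 - q^n)^12; the factors with index > n
-- are ≡ 1 mod q^{n+1}, so the n-th coefficient is that of the n-th partial product.
etaQuot : PS
etaQuot n = etaProd n n

uS : PS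
uS = shiftq etaQuot

tS : PS
tS = uS ⊛ inv1 (pow (oneS ⊕ scale (+ 27 / 1) uS) 2)

-- t(q) / q  (constant term 1)
tOverQ : PS
tOverQ = divq tS

Hmix : PS
Hmix = inv1 tOverQ

-- U_p = log( t(q)^p / t(q^p) ) = log( (t/q)(q)^p / (t/q)(q^p) )
Up : ℕ → PS
Up p = logS (pow tOverQ p ⊛ inv1 (subPow p tOverQ))

χ₃ : ℕ → ℚ
χ₃ d = if d % 3 ≡ᵇ 0 then 0ℚ else (if d % 3 ≡ᵇ 1 then 1ℚ else - 1ℚ)

-- C_mix: coefficient of q^n (n ≥ 1) is
--   3 Σ_{d∣n} χ₃(d) d^4 - 27 Σ_{d∣n} χ₃(n/d) d^4,
-- written as a sum over factorisations n = d * e.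
Cmix : PS
Cmix zero = 1ℚ
Cmix (suc n) = sumFrom1 (suc n) (λ d → sumFrom1 (suc n) (λ e →
  if (d ℕ.* e) ≡ᵇ suc n
  then ((+ 3 / 1) * χ₃ d - (+ 27 / 1) * χ₃ e) * fromℕ (d ℕ.^ 4)
  else 0ℚ))

poch : ℚ → ℕ → ℚ
poch x zero = 1ℚ
poch x (suc k) = poch x k * (x + fromℕ k)

invFact : ℕ → ℚ
invFact zero = 1ℚ
invFact (suc k) = invFact k * (+ 1 / suc k)

F21 : PS
F21 k = poch (+ 1 / 6) k * poch (+ 1 / 3) k * (invFact k * invFact k)

Amix : ℕ → ℚ
Amix n = fromℕ (108 ℕ.^ n) * pow F21 3 n

{-# OPTIONS --safe #-}
module Submission where

-- Write t^p = t(q^p) (1 + x) up to powers of q, with x = pV and V integral by Frobenius.  Modulo p^4 the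
-- logarithm U is x − x²/2 + x³/3, so the hypotheses for ℓ = 3, 2, 1 say successively that Λ_p annihilates
-- C x³, C x² and C x; as H^p = H(q^p) / (1 + x), only Λ_p(C) ≡ C survives in Λ_p(C H^{pm}), and this holds
-- because divisors d divisible by p contribute multiples of p^4 while χ₃(p) = 1.
--
-- The second congruence is the coefficient of q^m of the first, since A_n = [q^n] C H^n.  This is the residue
-- theorem for C = F(t) θt/t, where θ = q d/dq and F(t) = ₂F₁(1/6, 1/3; 1; 108 t)³.  With a the theta series of
-- the hexagonal lattice and β + γ = a³ its cubic theta functions, F(t) = a³ and C = a² (β − γ): Lambert series
-- for E₂(q), E₂(q³), a, β, γ satisfy a closed system of differential equations in which a solves the
-- hypergeometric equation in t.  Each equation is a convolution identity for sums over a x + b y = n, and all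
-- of them come from the single substitution (a, b, x, y) ↦ (a + b, b, x, y − x).

open import Defs
open import Algebra.Bundles using (CommutativeRing)
import Algebra.Properties.CommutativeSemiring.Binomial as Binomial
import Algebra.Properties.Semiring.Exp as SemiringExp
import Algebra.Properties.Semiring.Mult as SemiringMult
import Algebra.Properties.Semiring.Sum as SemiringSum
import Algebra.Solver.Ring as RingSolver
open import Algebra.Solver.Ring.AlmostCommutativeRing
  using (AlmostCommutativeRing; fromCommutativeRing; _-Raw-AlmostCommutative⟶_)
open import Algebra.Structures using (IsCommutativeRing)
open import Data.Bool as Bool using (Bool; true; false; if_then_else_)
open import Data.Empty using (⊥-elim)
open import Data.Fin as Fin using (Fin; toℕ; inject₁)
import Data.Fin.Properties as FinP
open import Data.Integer as ℤ using (ℤ; +_; -[1+_])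
import Data.Integer.Divisibility.Signed as ℤD
import Data.Integer.Properties as ℤP
open import Data.Maybe using (Maybe; just; nothing; is-just; to-witness-T)
open import Data.Nat as ℕ using (ℕ; zero; suc; _∸_; _≤_; _<_; z≤n; s≤s; _≡ᵇ_; _%_; _!)
open import Data.Nat.Combinatorics using (_C_; nCk≡n!/k![n-k]!; k![n∸k]!∣n!; nCn≡1)
open import Data.Nat.Coprimality as Coprime using (coprime-divisor)
open import Data.Nat.Divisibility
  using (_∣_; divides; _∣?_; ∣-trans; m∣m*n; *-monoʳ-∣; *-cancelˡ-∣; ∣⇒≤; ∣m+n∣m⇒∣n; ∣m∣n⇒∣m+n; n∣m*n; ∣-refl; _∣0)
open import Data.Nat.DivMod using ([m+n]%n≡m%n; m/n*n≡m; m≡m%n+[m/n]*n)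
open import Data.Nat.Induction using (<-rec)
open import Data.Nat.Primality using (Prime; euclidsLemma; prime⇒nonTrivial)
import Data.Nat.Properties as ℕP
import Data.Nat.Solver as ℕSolver
open import Data.Product using (_×_; _,_; proj₁)
open import Data.Rational as ℚ using (ℚ; 0ℚ; 1ℚ; _+_; _-_; -_; _/_) renaming (_*_ to _·_)
import Data.Rational.Properties as ℚP
import Data.Rational.Unnormalised as ℚᵘ
import Data.Rational.Unnormalised.Properties as ℚᵘP
open import Data.Sum using (_⊎_; inj₁; inj₂)
open import Data.Vec using ([]; _∷_)
open import Function using (_∘_)
open import Level using (0ℓ)
open import Relation.Binary.PropositionalEquality
  using (_≡_; _≢_; refl; sym; trans; cong; cong₂; subst; module ≡-Reasoning)
open import Relation.Nullary using (¬_; yes; no)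

-- The relations among a, β, γ and E₂ are usually read off from the finite dimension of spaces of
-- modular forms of level 3. Here every object is a formal power series in q with rational
-- coefficients, so a relation between Lambert series is an identity for coefficients. Where a
-- series given in another way has to be recognised (the eta quotient u, the hypergeometric series
-- composed with t), uniqueness of solutions of linear differential equations takes the place of
-- dimension counts.
--
-- The number 108 is 4 · 27. With x = γ/a³ one has 27 u = x/(1 - x), hence 108 t = 4 x (1 - x), and
-- the quadratic transformation sends ₂F₁(1/6, 1/3; 1; 108 t) to ₂F₁(1/3, 2/3; 1; x), the series
-- that equals a in Ramanujan's cubic theory. The proof checks the differential equation directly in
-- the variable t.
--
-- In the last part the obstacle is that the hypotheses concern powers of log(1 + x), while C H^(pm)
-- contains (1 + x)^(-m). Since x⁴ is divisible by p⁴, both are governed by x, x² and x³ alone, and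
-- 2 and 3 are invertible modulo p.

module ℕS = ℕSolver.+-*-Solver

-- Opacity keeps the normalisation of fractions out of unification.
opaque
  ι : ℤ → ℚ
  ι z = z / 1

  ι-def : ∀ z → ι z ≡ z / 1
  ι-def z = refl

  ι-toℚᵘ : ∀ z → ℚ.toℚᵘ (ι z) ℚᵘ.≃ ℚᵘ.mkℚᵘ z 0
  ι-toℚᵘ z = ℚP.toℚᵘ-fromℚᵘ (ℚᵘ.mkℚᵘ z 0)

  recip : ℕ → ℚ
  recip n = + 1 / suc n

  recip-def : ∀ n → recip n ≡ + 1 / suc n
  recip-def n = refl

  recip-toℚᵘ : ∀ n → ℚ.toℚᵘ (recip n) ℚᵘ.≃ ℚᵘ.mkℚᵘ (+ 1) n
  recip-toℚᵘ n = ℚP.toℚᵘ-fromℚᵘ (ℚᵘ.mkℚᵘ (+ 1) n)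

  ι-0 : ι ℤ.0ℤ ≡ 0ℚ
  ι-0 = refl

  ι-1 : ι ℤ.1ℤ ≡ 1ℚ
  ι-1 = refl

nat : ℕ → ℚ
nat n = ι (+ n)

fromℕ-def : ∀ n → fromℕ n ≡ nat n
fromℕ-def n = sym (ι-def (+ n))

ι-+ : ∀ x y → ι (x ℤ.+ y) ≡ ι x + ι y
ι-+ x y = ℚP.toℚᵘ-injective (ℚᵘP.≃-trans (ι-toℚᵘ (x ℤ.+ y)) (ℚᵘP.≃-trans
  (ℚᵘ.*≡* (cong (ℤ._* ℤ.1ℤ) (cong₂ ℤ._+_ (sym (ℤP.*-identityʳ x)) (sym (ℤP.*-identityʳ y)))))
  (ℚᵘP.≃-sym (ℚᵘP.≃-trans (ℚP.toℚᵘ-homo-+ (ι x) (ι y)) (ℚᵘP.+-cong (ι-toℚᵘ x) (ι-toℚᵘ y))))))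

ι-* : ∀ x y → ι (x ℤ.* y) ≡ ι x · ι y
ι-* x y = ℚP.toℚᵘ-injective (ℚᵘP.≃-trans (ι-toℚᵘ (x ℤ.* y)) (ℚᵘP.≃-trans
  (ℚᵘ.*≡* refl)
  (ℚᵘP.≃-sym (ℚᵘP.≃-trans (ℚP.toℚᵘ-homo-* (ι x) (ι y)) (ℚᵘP.*-cong (ι-toℚᵘ x) (ι-toℚᵘ y))))))

ι-neg : ∀ x → ι (ℤ.- x) ≡ - ι x
ι-neg x = ℚP.toℚᵘ-injective (ℚᵘP.≃-trans (ι-toℚᵘ (ℤ.- x))
  (ℚᵘP.≃-sym (ℚᵘP.≃-trans (ℚP.toℚᵘ-homo‿- (ι x)) (ℚᵘP.-‿cong (ι-toℚᵘ x)))))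

ι-injective : ∀ {x y} → ι x ≡ ι y → x ≡ y
ι-injective {x} {y} e = trans (sym (ℤP.*-identityʳ x)) (trans
  (ℚᵘP.drop-*≡* (ℚᵘP.≃-trans (ℚᵘP.≃-sym (ι-toℚᵘ x))
     (ℚᵘP.≃-trans (ℚᵘP.≃-reflexive (cong ℚ.toℚᵘ e)) (ι-toℚᵘ y)))) (ℤP.*-identityʳ y))

ι-homomorphism : CommutativeRing.rawRing ℤP.+-*-commutativeRing -Raw-AlmostCommutative⟶ fromCommutativeRing ℚP.+-*-commutativeRing
ι-homomorphism = record
  { ⟦_⟧ = ι ; +-homo = ι-+ ; *-homo = ι-* ; -‿homo = ι-neg ; 0-homo = ι-0 ; 1-homo = ι-1 }

ι-≟ : ∀ x y → Maybe (ι x ≡ ι y)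
ι-≟ x y with x ℤ.≟ y
... | yes refl = just refl
... | no _ = nothing

module ℚR = RingSolver (CommutativeRing.rawRing ℤP.+-*-commutativeRing) (fromCommutativeRing ℚP.+-*-commutativeRing) ι-homomorphism ι-≟

nat-+ : ∀ m n → nat (m ℕ.+ n) ≡ nat m + nat n
nat-+ m n = ι-+ (+ m) (+ n)

nat-* : ∀ m n → nat (m ℕ.* n) ≡ nat m · nat n
nat-* m n = trans (cong ι (ℤP.pos-* m n)) (ι-* (+ m) (+ n))

recip-inverse : ∀ n → nat (suc n) · recip n ≡ 1ℚ
recip-inverse n = ℚP.toℚᵘ-injective (ℚᵘP.≃-trans (ℚP.toℚᵘ-homo-* (nat (suc n)) (recip n))
  (ℚᵘP.≃-trans (ℚᵘP.*-cong (ι-toℚᵘ (+ suc n)) (recip-toℚᵘ n))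
   (ℚᵘ.*≡* (trans (ℤP.*-identityʳ _) (trans (ℤP.*-identityʳ (+ suc n))
      (trans (cong (λ k → + suc k) (sym (ℕP.+-identityʳ n))) (sym (ℤP.*-identityˡ _))))))))

nat-suc-cancel : ∀ n {x y} → nat (suc n) · x ≡ nat (suc n) · y → x ≡ y
nat-suc-cancel n {x} {y} e = trans (sym (rec x)) (trans (cong (recip n ·_) e) (rec y))
  where
  rec : ∀ z → recip n · (nat (suc n) · z) ≡ z
  rec z = trans (sym (ℚP.*-assoc (recip n) (nat (suc n)) z))
    (trans (cong (_· z) (trans (ℚP.*-comm (recip n) _) (recip-inverse n))) (ℚP.*-identityˡ z))

-- Finite sums

sumTo-cong : ∀ n {f g : ℕ → ℚ} → (∀ i → i ≤ n → f i ≡ g i) → sumTo n f ≡ sumTo n g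
sumTo-cong zero e = e 0 z≤n
sumTo-cong (suc n) e = cong₂ _+_ (sumTo-cong n (λ i i≤n → e i (ℕP.m≤n⇒m≤1+n i≤n))) (e (suc n) ℕP.≤-refl)

sumTo-+ : ∀ n f g → sumTo n (λ i → f i + g i) ≡ sumTo n f + sumTo n g
sumTo-+ zero f g = refl
sumTo-+ (suc n) f g rewrite sumTo-+ n f g =
  ℚR.solve 4 (λ a b c d → (a :+ b) :+ (c :+ d) := (a :+ c) :+ (b :+ d)) refl (sumTo n f) (sumTo n g) (f (suc n)) (g (suc n))
  where open ℚR

sumTo-·ˡ : ∀ n c f → sumTo n (λ i → c · f i) ≡ c · sumTo n f
sumTo-·ˡ zero c f = refl
sumTo-·ˡ (suc n) c f rewrite sumTo-·ˡ n c f = sym (ℚP.*-distribˡ-+ c _ _)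

sumTo-0 : ∀ n {f} → (∀ i → i ≤ n → f i ≡ 0ℚ) → sumTo n f ≡ 0ℚ
sumTo-0 n e = trans (sumTo-cong n e) (go n)
  where
  go : ∀ n → sumTo n (λ _ → 0ℚ) ≡ 0ℚ
  go zero = refl
  go (suc n) rewrite go n = refl

sumTo-first : ∀ n f → sumTo (suc n) f ≡ f 0 + sumTo n (f ∘ suc)
sumTo-first zero f = refl
sumTo-first (suc n) f rewrite sumTo-first n f = ℚP.+-assoc (f 0) _ _

-- The ring of power series

infix 4 _≈_
record _≈_ (f g : PS) : Set where
  constructor mk≈
  field at : ∀ n → f n ≡ g n
open _≈_ public

≈-refl : ∀ {f} → f ≈ f
≈-refl .at n = refl

≈-sym : ∀ {f g} → f ≈ g → g ≈ f
≈-sym e .at n = sym (at e n)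

≈-trans : ∀ {f g h} → f ≈ g → g ≈ h → f ≈ h
≈-trans d e .at n = trans (at d n) (at e n)

tail : PS → PS
tail f n = f (suc n)

⊝_ : PS → PS
(⊝ f) n = - f n

infix 8 ⊝_

zeroS : PS
zeroS = const 0ℚ

zeroS-at : ∀ n → zeroS n ≡ 0ℚ
zeroS-at zero = refl
zeroS-at (suc n) = refl

⊛-suc : ∀ f g n → (f ⊛ g) (suc n) ≡ f 0 · g (suc n) + (tail f ⊛ g) n
⊛-suc f g n = sumTo-first n (λ i → f i · g (suc n ∸ i))

⊛-cong : ∀ {f f′ g g′} → f ≈ f′ → g ≈ g′ → f ⊛ g ≈ f′ ⊛ g′
⊛-cong d e .at n = sumTo-cong n (λ i _ → cong₂ _·_ (at d i) (at e (n ∸ i)))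

⊛-zeroˡ : ∀ f → zeroS ⊛ f ≈ zeroS
⊛-zeroˡ f .at n = trans (sumTo-0 n (λ i _ → trans (cong (_· f (n ∸ i)) (zeroS-at i)) (ℚP.*-zeroˡ (f (n ∸ i))))) (sym (zeroS-at n))

⊛-distribʳ : ∀ h f g → (f ⊕ g) ⊛ h ≈ (f ⊛ h) ⊕ (g ⊛ h)
⊛-distribʳ h f g .at n = trans (sumTo-cong n (λ i _ → ℚP.*-distribʳ-+ (h (n ∸ i)) (f i) (g i))) (sumTo-+ n _ _)

const-⊛ : ∀ c f n → (const c ⊛ f) n ≡ c · f n
const-⊛ c f zero = refl
const-⊛ c f (suc n) = trans (⊛-suc (const c) f n)
  (trans (cong (λ z → c · f (suc n) + z) (trans (⊛-cong {tail (const c)} {zeroS} {f} (mk≈ λ n → sym (zeroS-at n)) ≈-refl .at n)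
    (trans (at (⊛-zeroˡ f) n) (zeroS-at n)))) (ℚP.+-identityʳ _))

-- Peeling one coefficient off each factor leaves the product of the two tails, two indices lower,
-- where the induction hypothesis applies; hence a recursion in steps of two.
⊛-comm : ∀ f g → f ⊛ g ≈ g ⊛ f
⊛-comm f g .at n = comm n f g
  where
  open ℚR
  comm : ∀ n f g → (f ⊛ g) n ≡ (g ⊛ f) n
  comm zero f g = ℚP.*-comm (f 0) (g 0)
  comm (suc zero) f g = solve 4 (λ a b c d → a :* d :+ b :* c := c :* b :+ d :* a) refl (f 0) (f 1) (g 0) (g 1)
  comm (suc (suc n)) f g =
    trans (⊛-suc f g (suc n))
    (trans (cong (λ z → f 0 · g (2 ℕ.+ n) + z) (trans (comm (suc n) (tail f) g) (trans (⊛-suc g (tail f) n)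
              (cong (λ z → g 0 · f (2 ℕ.+ n) + z) (comm n (tail g) (tail f))))))
    (trans (solve 3 (λ a b c → a :+ (b :+ c) := b :+ (a :+ c)) refl (f 0 · g (2 ℕ.+ n)) (g 0 · f (2 ℕ.+ n)) _)
    (sym (trans (⊛-suc g f (suc n))
      (cong (λ z → g 0 · f (2 ℕ.+ n) + z) (trans (comm (suc n) (tail g) f) (⊛-suc f (tail g) n)))))))

⊛-assoc : ∀ f g h → (f ⊛ g) ⊛ h ≈ f ⊛ (g ⊛ h)
⊛-assoc f g h .at n = assoc n f
  where
  open ≡-Reasoning
  assoc : ∀ n f → ((f ⊛ g) ⊛ h) n ≡ (f ⊛ (g ⊛ h)) n
  assoc zero f = ℚP.*-assoc (f 0) (g 0) (h 0)
  assoc (suc n) f = begin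
    ((f ⊛ g) ⊛ h) (suc n)
      ≡⟨ ⊛-suc (f ⊛ g) h n ⟩
    f 0 · g 0 · h (suc n) + (tail (f ⊛ g) ⊛ h) n
      ≡⟨ cong (λ z → f 0 · g 0 · h (suc n) + z) (at (⊛-cong {tail (f ⊛ g)} {(const (f 0) ⊛ tail g) ⊕ (tail f ⊛ g)} {h}
           (mk≈ λ m → trans (⊛-suc f g m) (cong (_+ (tail f ⊛ g) m) (sym (const-⊛ (f 0) (tail g) m)))) ≈-refl) n) ⟩
    f 0 · g 0 · h (suc n) + (((const (f 0) ⊛ tail g) ⊕ (tail f ⊛ g)) ⊛ h) n
      ≡⟨ cong (λ z → f 0 · g 0 · h (suc n) + z) (at (⊛-distribʳ h (const (f 0) ⊛ tail g) (tail f ⊛ g)) n) ⟩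
    f 0 · g 0 · h (suc n) + (((const (f 0) ⊛ tail g) ⊛ h) n + ((tail f ⊛ g) ⊛ h) n)
      ≡⟨ cong (λ z → f 0 · g 0 · h (suc n) + z) (cong₂ _+_ (trans
            (sumTo-cong n (λ i _ → trans (cong (_· h (n ∸ i)) (const-⊛ (f 0) (tail g) i)) (ℚP.*-assoc (f 0) _ _)))
            (sumTo-·ˡ n (f 0) (λ i → tail g i · h (n ∸ i)))) (assoc n (tail f))) ⟩
    f 0 · g 0 · h (suc n) + (f 0 · (tail g ⊛ h) n + (tail f ⊛ (g ⊛ h)) n)
      ≡⟨ ℚR.solve 5 (λ a b c d e → a :* b :* c :+ (a :* d :+ e) := a :* (b :* c :+ d) :+ e) refl (f 0) (g 0) (h (suc n)) _ _ ⟩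
    f 0 · (g 0 · h (suc n) + (tail g ⊛ h) n) + (tail f ⊛ (g ⊛ h)) n
      ≡⟨ cong (λ z → f 0 · z + (tail f ⊛ (g ⊛ h)) n) (sym (⊛-suc g h n)) ⟩
    f 0 · (g ⊛ h) (suc n) + (tail f ⊛ (g ⊛ h)) n
      ≡⟨ sym (⊛-suc f (g ⊛ h) n) ⟩
    (f ⊛ (g ⊛ h)) (suc n) ∎
    where open ℚR using (_:*_; _:+_; _:=_)

⊛-identityˡ : ∀ f → oneS ⊛ f ≈ f
⊛-identityˡ f .at n = trans (const-⊛ 1ℚ f n) (ℚP.*-identityˡ (f n))

PS-isCommutativeRing : IsCommutativeRing _≈_ _⊕_ _⊛_ ⊝_ zeroS oneS
PS-isCommutativeRing = record
  { isRing = record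
    { +-isAbelianGroup = record
      { isGroup = record
        { isMonoid = record
          { isSemigroup = record
            { isMagma = record
              { isEquivalence = record { refl = ≈-refl ; sym = ≈-sym ; trans = ≈-trans }
              ; ∙-cong = λ d e → mk≈ λ n → cong₂ _+_ (at d n) (at e n) }
            ; assoc = λ f g h → mk≈ λ n → ℚP.+-assoc (f n) (g n) (h n) }
          ; identity = (λ f → mk≈ λ n → trans (cong (_+ f n) (zeroS-at n)) (ℚP.+-identityˡ (f n)))
                     , (λ f → mk≈ λ n → trans (cong (λ z → f n + z) (zeroS-at n)) (ℚP.+-identityʳ (f n))) }
        ; inverse = (λ f → mk≈ λ n → trans (ℚP.+-inverseˡ (f n)) (sym (zeroS-at n)))
                  , (λ f → mk≈ λ n → trans (ℚP.+-inverseʳ (f n)) (sym (zeroS-at n)))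
        ; ⁻¹-cong = λ e → mk≈ λ n → cong -_ (at e n) }
      ; comm = λ f g → mk≈ λ n → ℚP.+-comm (f n) (g n) }
    ; *-cong = ⊛-cong
    ; *-assoc = ⊛-assoc
    ; *-identity = ⊛-identityˡ , (λ f → ≈-trans (⊛-comm f oneS) (⊛-identityˡ f))
    ; distrib = (λ f g h → ≈-trans (⊛-comm f (g ⊕ h)) (≈-trans (⊛-distribʳ f g h)
                   (mk≈ λ n → cong₂ _+_ (at (⊛-comm g f) n) (at (⊛-comm h f) n))))
              , ⊛-distribʳ }
  ; *-comm = ⊛-comm }

-- Opaque copies of the ring operations: the originals unfold pointwise during unification.
infixl 7 _*ₛ_
infixl 6 _+ₛ_ _-ₛ_
infix 8 -ₛ_
opaque
  _+ₛ_ _*ₛ_ : PS → PS → PS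
  _+ₛ_ = _⊕_
  _*ₛ_ = _⊛_

  -ₛ_ : PS → PS
  -ₛ_ = ⊝_

  K : ℤ → PS
  K z = const (ι z)

  +ₛ-def : ∀ f g → f +ₛ g ≡ f ⊕ g
  +ₛ-def f g = refl

  *ₛ-def : ∀ f g → f *ₛ g ≡ f ⊛ g
  *ₛ-def f g = refl

  K-def : ∀ z → K z ≡ const (ι z)
  K-def z = refl

  PS-isCommutativeRingₛ : IsCommutativeRing _≈_ _+ₛ_ _*ₛ_ -ₛ_ zeroS oneS
  PS-isCommutativeRingₛ = PS-isCommutativeRing

_-ₛ_ : PS → PS → PS
f -ₛ g = f +ₛ -ₛ g

opaque
  unfolding _+ₛ_
  -ₛ-def : ∀ f g → f -ₛ g ≡ f ⊖ g
  -ₛ-def f g = refl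

PS-commutativeRing : CommutativeRing 0ℓ 0ℓ
PS-commutativeRing = record { isCommutativeRing = PS-isCommutativeRingₛ }

module PSR = CommutativeRing PS-commutativeRing

PS-almostCommutativeRing : AlmostCommutativeRing 0ℓ 0ℓ
PS-almostCommutativeRing = fromCommutativeRing PS-commutativeRing

opaque
  unfolding _*ₛ_
  K-+ : ∀ x y → K (x ℤ.+ y) ≈ K x +ₛ K y
  K-+ x y = mk≈ λ { zero → ι-+ x y ; (suc n) → refl }

  K-* : ∀ x y → K (x ℤ.* y) ≈ K x *ₛ K y
  K-* x y = mk≈ λ { zero → ι-* x y ; (suc n) → sym (trans (const-⊛ (ι x) (K y) (suc n)) (ℚP.*-zeroʳ (ι x))) }

  K-neg : ∀ x → K (ℤ.- x) ≈ -ₛ K x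
  K-neg x = mk≈ λ { zero → ι-neg x ; (suc n) → refl }

  K-0 : K ℤ.0ℤ ≈ zeroS
  K-0 = mk≈ λ { zero → ι-0 ; (suc n) → refl }

  K-1 : K ℤ.1ℤ ≈ oneS
  K-1 = mk≈ λ { zero → ι-1 ; (suc n) → refl }

K-homomorphism : CommutativeRing.rawRing ℤP.+-*-commutativeRing -Raw-AlmostCommutative⟶ PS-almostCommutativeRing
K-homomorphism = record
  { ⟦_⟧ = K ; +-homo = K-+ ; *-homo = K-* ; -‿homo = K-neg ; 0-homo = K-0 ; 1-homo = K-1 }

K-≟ : ∀ x y → Maybe (K x ≈ K y)
K-≟ x y with x ℤ.≟ y
... | yes refl = just ≈-refl
... | no _ = nothing

module SR = RingSolver (CommutativeRing.rawRing ℤP.+-*-commutativeRing) PS-almostCommutativeRing K-homomorphism K-≟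

infixr 8 _^ₛ_
_^ₛ_ : PS → ℕ → PS
f ^ₛ zero = oneS
f ^ₛ suc n = f *ₛ f ^ₛ n

open SR using (solve; _:+_; _:*_; _:-_; :-_; _:=_; con)
open ℚR using () renaming (solve to solveℚ; _:+_ to _⟨+⟩_; _:*_ to _⟨·⟩_; _:-_ to _⟨-⟩_; :-_ to ⟨-⟩_; _:=_ to _⟨=⟩_; con to conℚ)
import Relation.Binary.Reasoning.Setoid as SetoidReasoning
module ≈-Reasoning = SetoidReasoning PSR.setoid

infix 9 #_
#_ : ∀ {n} → ℕ → SR.Polynomial n
# n = con (+ n)

≡⇒≈ : ∀ {f g} → f ≡ g → f ≈ g
≡⇒≈ refl = ≈-refl

+ₛ-cong : ∀ {f f′ g g′} → f ≈ f′ → g ≈ g′ → f +ₛ g ≈ f′ +ₛ g′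
+ₛ-cong = PSR.+-cong

+ₛ-congˡ : ∀ {f g g′} → g ≈ g′ → f +ₛ g ≈ f +ₛ g′
+ₛ-congˡ = +ₛ-cong ≈-refl

+ₛ-congʳ : ∀ {f f′ g} → f ≈ f′ → f +ₛ g ≈ f′ +ₛ g
+ₛ-congʳ e = +ₛ-cong e ≈-refl

-ₛ-cong : ∀ {f f′ g g′} → f ≈ f′ → g ≈ g′ → f -ₛ g ≈ f′ -ₛ g′
-ₛ-cong d e = +ₛ-cong d (PSR.-‿cong e)

*ₛ-cong : ∀ {f f′ g g′} → f ≈ f′ → g ≈ g′ → f *ₛ g ≈ f′ *ₛ g′
*ₛ-cong = PSR.*-cong

*ₛ-congˡ : ∀ {f g g′} → g ≈ g′ → f *ₛ g ≈ f *ₛ g′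
*ₛ-congˡ = *ₛ-cong ≈-refl

*ₛ-congʳ : ∀ {f f′ g} → f ≈ f′ → f *ₛ g ≈ f′ *ₛ g
*ₛ-congʳ d = *ₛ-cong d ≈-refl

opaque
  unfolding _*ₛ_

  +ₛ-at : ∀ f g n → (f +ₛ g) n ≡ f n + g n
  +ₛ-at f g n = refl

  -ₛ-at : ∀ f g n → (f -ₛ g) n ≡ f n - g n
  -ₛ-at f g n = refl

  *ₛ-at : ∀ f g n → (f *ₛ g) n ≡ sumTo n (λ i → f i · g (n ∸ i))
  *ₛ-at f g n = refl

  *ₛ-at-suc : ∀ f g n → (f *ₛ g) (suc n) ≡ f 0 · g (suc n) + (tail f *ₛ g) n
  *ₛ-at-suc = ⊛-suc

  const-*ₛ : ∀ c f n → (const c *ₛ f) n ≡ c · f n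
  const-*ₛ = const-⊛

  K-*ₛ : ∀ c f n → (K c *ₛ f) n ≡ ι c · f n
  K-*ₛ c = const-⊛ (ι c)

  K-at-0 : ∀ c → K c 0 ≡ ι c
  K-at-0 c = refl

  const-+ : ∀ c d → const c +ₛ const d ≈ const (c + d)
  const-+ c d = mk≈ λ { zero → refl ; (suc n) → refl }

scale-*ₛ : ∀ c f → scale c f ≈ const c *ₛ f
scale-*ₛ c f .at n = sym (const-*ₛ c f n)

*ₛ-zeroˡ : ∀ f → zeroS *ₛ f ≈ zeroS
*ₛ-zeroˡ = PSR.zeroˡ

^ₛ-cong : ∀ {f g} n → f ≈ g → f ^ₛ n ≈ g ^ₛ n
^ₛ-cong zero e = ≈-refl
^ₛ-cong (suc n) e = *ₛ-cong e (^ₛ-cong n e)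

pow-^ₛ : ∀ f n → pow f n ≈ f ^ₛ n
pow-^ₛ f zero = ≈-refl
pow-^ₛ f (suc n) = ≈-trans (⊛-cong {f} {f} ≈-refl (pow-^ₛ f n)) (≡⇒≈ (sym (*ₛ-def f (f ^ₛ n))))

^ₛ-+ : ∀ f m n → f ^ₛ (m ℕ.+ n) ≈ f ^ₛ m *ₛ f ^ₛ n
^ₛ-+ f zero n = ≈-sym (PSR.*-identityˡ (f ^ₛ n))
^ₛ-+ f (suc m) n = ≈-trans (*ₛ-congˡ (^ₛ-+ f m n)) (≈-sym (PSR.*-assoc f (f ^ₛ m) (f ^ₛ n)))

^ₛ-distrib-*ₛ : ∀ f g n → (f *ₛ g) ^ₛ n ≈ f ^ₛ n *ₛ g ^ₛ n
^ₛ-distrib-*ₛ f g zero = ≈-sym (PSR.*-identityˡ oneS)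
^ₛ-distrib-*ₛ f g (suc n) = ≈-trans (*ₛ-congˡ (^ₛ-distrib-*ₛ f g n))
  (solve 4 (λ a b c d → (a :* b) :* (c :* d) := (a :* c) :* (b :* d)) ≈-refl f g (f ^ₛ n) (g ^ₛ n))

one-^ₛ : ∀ n → oneS ^ₛ n ≈ oneS
one-^ₛ zero = ≈-refl
one-^ₛ (suc n) = ≈-trans (PSR.*-identityˡ _) (one-^ₛ n)

^ₛ-* : ∀ f m n → f ^ₛ (m ℕ.* n) ≈ (f ^ₛ m) ^ₛ n
^ₛ-* f zero n = ≈-sym (one-^ₛ n)
^ₛ-* f (suc m) n = ≈-trans (^ₛ-+ f n (m ℕ.* n)) (≈-trans (*ₛ-congˡ (^ₛ-* f m n)) (≈-sym (^ₛ-distrib-*ₛ f (f ^ₛ m) n)))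

-- Congruences modulo q^n and inverse series

infix 4 _≈[_]_
-- Congruence modulo q^n. Inverses, eta products and compositions are defined coefficient by
-- coefficient through truncations, and are compared at each precision n.
_≈[_]_ : PS → ℕ → PS → Set
f ≈[ n ] g = ∀ i → i < n → f i ≡ g i

≈⇒≈[] : ∀ {f g} n → f ≈ g → f ≈[ n ] g
≈⇒≈[] n e i _ = at e i

≈[]⇒≈ : ∀ {f g} → (∀ n → f ≈[ n ] g) → f ≈ g
≈[]⇒≈ e .at n = e (suc n) n ℕP.≤-refl

*ₛ-cong[] : ∀ n {f f′ g g′} → f ≈[ n ] f′ → g ≈[ n ] g′ → f *ₛ g ≈[ n ] f′ *ₛ g′
*ₛ-cong[] n {f} {f′} {g} {g′} d e i i<n = trans (*ₛ-at f g i) (trans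
  (sumTo-cong i (λ j j≤i → cong₂ _·_ (d j (ℕP.≤-<-trans j≤i i<n)) (e (i ∸ j) (ℕP.≤-<-trans (ℕP.m∸n≤m i j) i<n))))
  (sym (*ₛ-at f′ g′ i)))

*ₛ-at-0 : ∀ f g → (f *ₛ g) 0 ≡ f 0 · g 0
*ₛ-at-0 f g = *ₛ-at f g 0

*ₛ-at-0-zero : ∀ f g → f 0 ≡ 0ℚ → (f *ₛ g) 0 ≡ 0ℚ
*ₛ-at-0-zero f g f0 = trans (*ₛ-at-0 f g) (trans (cong (_· g 0) f0) (ℚP.*-zeroˡ (g 0)))

*ₛ-at-suc-zero : ∀ f g n → f 0 ≡ 0ℚ → (f *ₛ g) (suc n) ≡ (tail f *ₛ g) n
*ₛ-at-suc-zero f g n f0 = trans (*ₛ-at-suc f g n) (trans (cong (λ z → z · g (suc n) + (tail f *ₛ g) n) f0)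
  (trans (cong (_+ (tail f *ₛ g) n) (ℚP.*-zeroˡ (g (suc n)))) (ℚP.+-identityˡ _)))

-- Since f has no constant term, the first unknown coefficient of g enters one degree later. This
-- gain of one order drives every induction on precision for recursions of the shape c + t · (...).
*ₛ-gain : ∀ n {f g g′} → f 0 ≡ 0ℚ → g ≈[ n ] g′ → f *ₛ g ≈[ suc n ] f *ₛ g′
*ₛ-gain n {f} {g} {g′} f0 e zero _ = trans (*ₛ-at-0-zero f g f0) (sym (*ₛ-at-0-zero f g′ f0))
*ₛ-gain n {f} {g} {g′} f0 e (suc i) (s≤s i<n) = trans (*ₛ-at-suc-zero f g i f0)
  (trans (*ₛ-cong[] n {tail f} {tail f} {g} {g′} (λ _ _ → refl) e i i<n) (sym (*ₛ-at-suc-zero f g′ i f0)))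

^ₛ-vanish : ∀ f k n → f 0 ≡ 0ℚ → n < k → (f ^ₛ k) n ≡ 0ℚ
^ₛ-vanish f (suc k) zero f0 _ = *ₛ-at-0-zero f (f ^ₛ k) f0
^ₛ-vanish f (suc k) (suc n) f0 (s≤s n<k) = trans (*ₛ-at-suc-zero f (f ^ₛ k) n f0)
  (trans (*ₛ-cong[] (suc n) {tail f} {tail f} {f ^ₛ k} {zeroS} (λ _ _ → refl)
     (λ i i≤n → trans (^ₛ-vanish f k i f0 (ℕP.<-≤-trans i≤n n<k)) (sym (zeroS-at i))) n ℕP.≤-refl)
   (trans (at (PSR.zeroʳ (tail f)) n) (zeroS-at n)))

geometric : PS → ℕ → PS
geometric g zero = oneS
geometric g (suc n) = geometric g n +ₛ g ^ₛ suc n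

geometric-at : ∀ g n i → geometric g n i ≡ sumTo n (λ k → (g ^ₛ k) i)
geometric-at g zero i = refl
geometric-at g (suc n) i = trans (+ₛ-at (geometric g n) (g ^ₛ suc n) i) (cong (_+ (g ^ₛ suc n) i) (geometric-at g n i))

geometric-telescope : ∀ f n → f *ₛ geometric (oneS -ₛ f) n ≈ oneS -ₛ (oneS -ₛ f) ^ₛ suc n
geometric-telescope f zero = ≈-trans (solve 2 (λ e f → f :* e := e :* e :- (e :* e :- f :* e)) ≈-refl oneS f)
  (-ₛ-cong (PSR.*-identityˡ oneS) (≈-trans (-ₛ-cong (PSR.*-identityˡ oneS) (PSR.*-identityʳ f)) (≈-sym (PSR.*-identityʳ (oneS -ₛ f)))))
geometric-telescope f (suc n) = ≈-trans (PSR.distribˡ f (geometric (oneS -ₛ f) n) ((oneS -ₛ f) ^ₛ suc n))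
  (≈-trans (+ₛ-congʳ (geometric-telescope f n))
   (≈-trans (+ₛ-congʳ (-ₛ-cong ≈-refl (≈-sym (PSR.*-identityˡ _))))
   (≈-trans (solve 3 (λ e f p → (e :- e :* p) :+ f :* p := e :- (e :- f) :* p) ≈-refl oneS f ((oneS -ₛ f) ^ₛ suc n))
    ≈-refl)))

sumTo-extend : ∀ m k f → (∀ i → m < i → f i ≡ 0ℚ) → sumTo (k ℕ.+ m) f ≡ sumTo m f
sumTo-extend m zero f e = refl
sumTo-extend m (suc k) f e = trans (cong₂ _+_ (sumTo-extend m k f e) (e (suc (k ℕ.+ m)) (s≤s (ℕP.m≤n+m m k)))) (ℚP.+-identityʳ _)

one-ₛ-at-0 : ∀ f → f 0 ≡ 1ℚ → (oneS -ₛ f) 0 ≡ 0ℚ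
one-ₛ-at-0 f f0 = trans (-ₛ-at oneS f 0) (trans (cong (λ z → 1ℚ - z) f0) (ℚP.+-inverseʳ 1ℚ))

inv1-at : ∀ f n → inv1 f n ≡ sumTo n (λ k → ((oneS -ₛ f) ^ₛ k) n)
inv1-at f n = sumTo-cong n (λ k _ → at (≈-trans (pow-^ₛ (oneS ⊖ f) k) (^ₛ-cong k (≡⇒≈ (sym (-ₛ-def oneS f))))) n)

-- (1 - f)^k starts at q^k or later, so the moving cutoff of `inv1` may be replaced by the fixed
-- cutoff n for all coefficients up to n. To a fixed partial sum the telescoping identity applies.
inv1-geometric : ∀ f n → f 0 ≡ 1ℚ → inv1 f ≈[ suc n ] geometric (oneS -ₛ f) n
inv1-geometric f n f0 i (s≤s i≤n) with ℕP.m≤n⇒∃[o]m+o≡n i≤n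
... | k , refl = trans (inv1-at f i) (trans (sym (sumTo-extend i k (λ j → ((oneS -ₛ f) ^ₛ j) i)
                      (λ j i<j → ^ₛ-vanish (oneS -ₛ f) j i (one-ₛ-at-0 f f0) i<j)))
                   (trans (cong (λ m → sumTo m (λ j → ((oneS -ₛ f) ^ₛ j) i)) (ℕP.+-comm k i)) (sym (geometric-at (oneS -ₛ f) (i ℕ.+ k) i))))

*ₛ-inv1 : ∀ f → f 0 ≡ 1ℚ → f *ₛ inv1 f ≈ oneS
*ₛ-inv1 f f0 .at n = trans (*ₛ-cong[] (suc n) {f} {f} (λ _ _ → refl) (inv1-geometric f n f0) n ℕP.≤-refl)
  (trans (at (geometric-telescope f n) n) (trans (-ₛ-at oneS ((oneS -ₛ f) ^ₛ suc n) n)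
   (trans (cong (λ z → oneS n - z) (^ₛ-vanish (oneS -ₛ f) (suc n) n (one-ₛ-at-0 f f0) ℕP.≤-refl))
     (ℚP.+-identityʳ (oneS n)))))

inv1-*ₛ : ∀ f → f 0 ≡ 1ℚ → inv1 f *ₛ f ≈ oneS
inv1-*ₛ f f0 = ≈-trans (PSR.*-comm (inv1 f) f) (*ₛ-inv1 f f0)

*ₛ-cancelˡ : ∀ f {g h} → f 0 ≡ 1ℚ → f *ₛ g ≈ f *ₛ h → g ≈ h
*ₛ-cancelˡ f {g} {h} f0 e = ≈-trans (≈-sym (recover g)) (≈-trans (*ₛ-congˡ e) (recover h))
  where
  recover : ∀ x → inv1 f *ₛ (f *ₛ x) ≈ x
  recover x = ≈-trans (≈-sym (PSR.*-assoc (inv1 f) f x)) (≈-trans (*ₛ-congʳ (inv1-*ₛ f f0)) (PSR.*-identityˡ x))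

*ₛ-at-0-one : ∀ f g → f 0 ≡ 1ℚ → g 0 ≡ 1ℚ → (f *ₛ g) 0 ≡ 1ℚ
*ₛ-at-0-one f g f0 g0 = trans (*ₛ-at-0 f g) (trans (cong₂ _·_ f0 g0) refl)

^ₛ-at-0-one : ∀ f n → f 0 ≡ 1ℚ → (f ^ₛ n) 0 ≡ 1ℚ
^ₛ-at-0-one f zero f0 = refl
^ₛ-at-0-one f (suc n) f0 = *ₛ-at-0-one f (f ^ₛ n) f0 (^ₛ-at-0-one f n f0)

-- The derivation q d/dq

opaque
  unfolding _*ₛ_

  θ : PS → PS
  θ f n = nat n · f n

  θ-at : ∀ f n → θ f n ≡ nat n · f n
  θ-at f n = refl

  θ-cong : ∀ {f g} → f ≈ g → θ f ≈ θ g
  θ-cong e .at n = cong (λ z → nat n · z) (at e n)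

  θ-const : ∀ c → θ (const c) ≈ zeroS
  θ-const c .at zero = trans (cong (_· c) ι-0) (ℚP.*-zeroˡ c)
  θ-const c .at (suc n) = ℚP.*-zeroʳ (nat (suc n))

  θ-+ₛ : ∀ f g → θ (f +ₛ g) ≈ θ f +ₛ θ g
  θ-+ₛ f g .at n = ℚP.*-distribˡ-+ (nat n) (f n) (g n)

  θ-neg : ∀ f → θ (-ₛ f) ≈ -ₛ θ f
  θ-neg f .at n = sym (ℚP.neg-distribʳ-* (nat n) (f n))

  θ-*ₛ : ∀ f g → θ (f *ₛ g) ≈ θ f *ₛ g +ₛ f *ₛ θ g
  θ-*ₛ f g .at n = trans (sym (sumTo-·ˡ n (nat n) (λ i → f i · g (n ∸ i)))) (trans (sumTo-cong n term)
      (sumTo-+ n (λ i → nat i · f i · g (n ∸ i)) (λ i → f i · (nat (n ∸ i) · g (n ∸ i)))))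
    where
    term : ∀ i → i ≤ n → nat n · (f i · g (n ∸ i)) ≡ nat i · f i · g (n ∸ i) + f i · (nat (n ∸ i) · g (n ∸ i))
    term i i≤n = trans (cong (_· (f i · g (n ∸ i))) (trans (cong nat (sym (ℕP.m+[n∸m]≡n i≤n))) (nat-+ i (n ∸ i))))
      (solveℚ 4 (λ a b c d → (a ⟨+⟩ b) ⟨·⟩ (c ⟨·⟩ d) ⟨=⟩ a ⟨·⟩ c ⟨·⟩ d ⟨+⟩ c ⟨·⟩ (b ⟨·⟩ d)) refl (nat i) (nat (n ∸ i)) (f i) (g (n ∸ i)))

θ--ₛ : ∀ f g → θ (f -ₛ g) ≈ θ f -ₛ θ g
θ--ₛ f g = ≈-trans (θ-+ₛ f (-ₛ g)) (+ₛ-congˡ (θ-neg g))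

θ-const*ₛ : ∀ c f → θ (const c *ₛ f) ≈ const c *ₛ θ f
θ-const*ₛ c f = ≈-trans (θ-*ₛ (const c) f) (≈-trans (+ₛ-congʳ (≈-trans (*ₛ-congʳ (θ-const c)) (*ₛ-zeroˡ f)))
  (PSR.+-identityˡ (const c *ₛ θ f)))

θ-K : ∀ z f → θ (K z *ₛ f) ≈ K z *ₛ θ f
θ-K z f = ≈-trans (θ-cong (*ₛ-congʳ (≡⇒≈ (K-def z)))) (≈-trans (θ-const*ₛ (ι z) f) (*ₛ-congʳ (≡⇒≈ (sym (K-def z)))))

θ-one : θ oneS ≈ zeroS
θ-one = θ-const 1ℚ

θ-^ₛ : ∀ f n → θ (f ^ₛ suc n) ≈ K (+ suc n) *ₛ (f ^ₛ n *ₛ θ f)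
θ-^ₛ f zero = ≈-trans (θ-*ₛ f oneS) (≈-trans (+ₛ-congˡ (≈-trans (*ₛ-congˡ θ-one) (PSR.zeroʳ f)))
  (≈-trans (PSR.+-identityʳ _) (≈-trans (PSR.*-comm (θ f) oneS) (≈-trans (≈-sym (PSR.*-identityˡ _)) (*ₛ-congʳ (≈-sym K-1))))))
θ-^ₛ f (suc n) = ≈-trans (θ-*ₛ f (f ^ₛ suc n)) (≈-trans (+ₛ-congˡ (*ₛ-congˡ (θ-^ₛ f n)))
  (≈-trans (solve 4 (λ f d p k → d :* (f :* p) :+ f :* (k :* (p :* d)) := (# 1 :+ k) :* ((f :* p) :* d)) ≈-refl f (θ f) (f ^ₛ n) (K (+ suc n)))
   (*ₛ-congʳ (≈-sym (K-+ ℤ.1ℤ (+ suc n))))))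

-- Double sums over positive integers

sumFrom1-cong : ∀ n {f g : ℕ → ℚ} → (∀ i → 1 ≤ i → i ≤ n → f i ≡ g i) → sumFrom1 n f ≡ sumFrom1 n g
sumFrom1-cong zero e = refl
sumFrom1-cong (suc n) e = cong₂ _+_ (sumFrom1-cong n (λ i 1≤i i≤n → e i 1≤i (ℕP.m≤n⇒m≤1+n i≤n))) (e (suc n) (s≤s z≤n) ℕP.≤-refl)

sumFrom1-+ : ∀ n f g → sumFrom1 n (λ i → f i + g i) ≡ sumFrom1 n f + sumFrom1 n g
sumFrom1-+ zero f g = refl
sumFrom1-+ (suc n) f g rewrite sumFrom1-+ n f g =
  solveℚ 4 (λ a b c d → (a ⟨+⟩ b) ⟨+⟩ (c ⟨+⟩ d) ⟨=⟩ (a ⟨+⟩ c) ⟨+⟩ (b ⟨+⟩ d)) refl (sumFrom1 n f) (sumFrom1 n g) (f (suc n)) (g (suc n))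

sumFrom1-·ˡ : ∀ n c f → sumFrom1 n (λ i → c · f i) ≡ c · sumFrom1 n f
sumFrom1-·ˡ zero c f = sym (ℚP.*-zeroʳ c)
sumFrom1-·ˡ (suc n) c f rewrite sumFrom1-·ˡ n c f = sym (ℚP.*-distribˡ-+ c (sumFrom1 n f) (f (suc n)))

sumFrom1-0 : ∀ n {f} → (∀ i → 1 ≤ i → i ≤ n → f i ≡ 0ℚ) → sumFrom1 n f ≡ 0ℚ
sumFrom1-0 n e = trans (sumFrom1-cong n e) (go n)
  where
  go : ∀ n → sumFrom1 n (λ _ → 0ℚ) ≡ 0ℚ
  go zero = refl
  go (suc n) rewrite go n = refl

sumFrom1-swap : ∀ m n (f : ℕ → ℕ → ℚ) → sumFrom1 m (λ i → sumFrom1 n (λ j → f i j)) ≡ sumFrom1 n (λ j → sumFrom1 m (λ i → f i j))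
sumFrom1-swap zero n f = sym (sumFrom1-0 n (λ _ _ _ → refl))
sumFrom1-swap (suc m) n f rewrite sumFrom1-swap m n f = sym (sumFrom1-+ n (λ j → sumFrom1 m (λ i → f i j)) (f (suc m)))

sumFrom1-split : ∀ m n f → sumFrom1 (n ℕ.+ m) f ≡ sumFrom1 m f + sumFrom1 n (λ i → f (i ℕ.+ m))
sumFrom1-split m zero f = sym (ℚP.+-identityʳ _)
sumFrom1-split m (suc n) f rewrite sumFrom1-split m n f = ℚP.+-assoc (sumFrom1 m f) _ _

sumFrom1-extend : ∀ {m n} f → m ≤ n → (∀ i → m < i → f i ≡ 0ℚ) → sumFrom1 n f ≡ sumFrom1 m f
sumFrom1-extend {m} f m≤n e with ℕP.m≤n⇒∃[o]m+o≡n m≤n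
... | k , refl = trans (cong (λ l → sumFrom1 l f) (ℕP.+-comm m k)) (trans (sumFrom1-split m k f)
  (trans (cong (λ z → sumFrom1 m f + z) (sumFrom1-0 k (λ i 1≤i _ → e (i ℕ.+ m) (ℕP.m<n+m m 1≤i)))) (ℚP.+-identityʳ _)))

sum² : ℕ → (ℕ → ℕ → ℚ) → ℚ
sum² n f = sumFrom1 n (λ a → sumFrom1 n (λ b → f a b))

sum²-cong : ∀ n {f g : ℕ → ℕ → ℚ} → (∀ a b → 1 ≤ a → 1 ≤ b → f a b ≡ g a b) → sum² n f ≡ sum² n g
sum²-cong n e = sumFrom1-cong n (λ a 1≤a _ → sumFrom1-cong n (λ b 1≤b _ → e a b 1≤a 1≤b))

sum²-+ : ∀ n f g → sum² n (λ a b → f a b + g a b) ≡ sum² n f + sum² n g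
sum²-+ n f g = trans (sumFrom1-cong n (λ a _ _ → sumFrom1-+ n (f a) (g a))) (sumFrom1-+ n _ _)

sum²-·ˡ : ∀ n c f → sum² n (λ a b → c · f a b) ≡ c · sum² n f
sum²-·ˡ n c f = trans (sumFrom1-cong n (λ a _ _ → sumFrom1-·ˡ n c (f a))) (sumFrom1-·ˡ n c _)

sum²-·ʳ : ∀ n c f → sum² n (λ a b → f a b · c) ≡ sum² n f · c
sum²-·ʳ n c f = trans (sum²-cong n (λ a b _ _ → ℚP.*-comm (f a b) c)) (trans (sum²-·ˡ n c f) (ℚP.*-comm c _))

sum²-swap : ∀ n f → sum² n f ≡ sum² n (λ a b → f b a)
sum²-swap n f = sumFrom1-swap n n f

sum²-0 : ∀ n {f} → (∀ a b → 1 ≤ a → 1 ≤ b → f a b ≡ 0ℚ) → sum² n f ≡ 0ℚ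
sum²-0 n e = sumFrom1-0 n (λ a 1≤a _ → sumFrom1-0 n (λ b 1≤b _ → e a b 1≤a 1≤b))

sum²-extend : ∀ {m n} f → m ≤ n → (∀ a b → 1 ≤ a → 1 ≤ b → m < a ⊎ m < b → f a b ≡ 0ℚ) → sum² n f ≡ sum² m f
sum²-extend {m} {n} f m≤n e = trans
  (sumFrom1-cong n (λ a 1≤a _ → sumFrom1-extend (f a) m≤n (λ b m<b → e a b 1≤a (ℕP.≤-trans (s≤s z≤n) m<b) (inj₂ m<b))))
  (sumFrom1-extend (λ a → sumFrom1 m (f a)) m≤n
    (λ a m<a → sumFrom1-0 m (λ b 1≤b _ → e a b (ℕP.≤-trans (s≤s z≤n) m<a) 1≤b (inj₁ m<a))))

ind : Bool → ℚ
ind b = if b then 1ℚ else 0ℚ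

δ : ℕ → ℕ → ℚ
δ m n = ind (m ≡ᵇ n)

lt : ℕ → ℕ → ℚ
lt m n = ind (m ℕ.<ᵇ n)

δ-refl : ∀ n → δ n n ≡ 1ℚ
δ-refl zero = refl
δ-refl (suc n) = δ-refl n

δ-≢ : ∀ m n → m ≢ n → δ m n ≡ 0ℚ
δ-≢ zero zero m≢n = ⊥-elim (m≢n refl)
δ-≢ zero (suc n) _ = refl
δ-≢ (suc m) zero _ = refl
δ-≢ (suc m) (suc n) m≢n = δ-≢ m n (m≢n ∘ cong suc)

δ-> : ∀ m n → n < m → δ m n ≡ 0ℚ
δ-> m n n<m = δ-≢ m n (λ { refl → ℕP.<-irrefl refl n<m })

δ-· : ∀ m n {x y} → (m ≡ n → x ≡ y) → δ m n · x ≡ δ m n · y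
δ-· m n {x} {y} e with m ℕP.≟ n
... | yes m≡n = cong (λ z → δ m n · z) (e m≡n)
... | no m≢n = trans (cong (_· x) (δ-≢ m n m≢n)) (trans (ℚP.*-zeroˡ x) (sym (trans (cong (_· y) (δ-≢ m n m≢n)) (ℚP.*-zeroˡ y))))

lt-< : ∀ m n → m < n → lt m n ≡ 1ℚ
lt-< zero (suc n) _ = refl
lt-< (suc m) (suc n) (s≤s m<n) = lt-< m n m<n

lt-≥ : ∀ m n → n ≤ m → lt m n ≡ 0ℚ
lt-≥ m zero _ = refl
lt-≥ (suc m) (suc n) (s≤s n≤m) = lt-≥ m n n≤m

trichotomy : ∀ a b → lt b a + lt a b + δ a b ≡ 1ℚ
trichotomy zero zero = refl
trichotomy zero (suc b) = refl
trichotomy (suc a) zero = refl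
trichotomy (suc a) (suc b) = trichotomy a b

zero-· : ∀ {x} y → x ≡ 0ℚ → x · y ≡ 0ℚ
zero-· y e = trans (cong (_· y) e) (ℚP.*-zeroˡ y)

one-· : ∀ {x} y → x ≡ 1ℚ → x · y ≡ y
one-· y e = trans (cong (_· y) e) (ℚP.*-identityˡ y)

sumFrom1-δ : ∀ n a (g : ℕ → ℚ) → 1 ≤ a → a ≤ n → sumFrom1 n (λ b → δ a b · g b) ≡ g a
sumFrom1-δ zero a g 1≤a a≤0 = ⊥-elim (ℕP.<-irrefl refl (ℕP.≤-trans 1≤a a≤0))
sumFrom1-δ (suc n) a g 1≤a a≤1+n with a ℕP.≟ suc n
... | yes refl = trans (cong₂ _+_ (sumFrom1-0 n (λ i _ i≤n → zero-· (g i) (δ-> (suc n) i (s≤s i≤n)))) (one-· (g a) (δ-refl a)))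
                   (ℚP.+-identityˡ (g a))
... | no a≢1+n = trans (cong₂ _+_ (sumFrom1-δ n a g 1≤a (ℕP.≤-pred (ℕP.≤∧≢⇒< a≤1+n a≢1+n))) (zero-· (g (suc n)) (δ-≢ a (suc n) a≢1+n)))
                   (ℚP.+-identityʳ (g a))

-- Beyond n the summand vanishes, so after the shift by b the range can stay 1, ..., n. A single
-- bound for all variables spares the fourfold sums any bookkeeping of ranges.
sumFrom1-after : ∀ n b (g : ℕ → ℚ) → (∀ a → n < a → g a ≡ 0ℚ) → sumFrom1 n (λ a → lt b a · g a) ≡ sumFrom1 n (λ a → g (a ℕ.+ b))
sumFrom1-after n b g e = begin
  sumFrom1 n F ≡⟨ sym (sumFrom1-extend F (ℕP.m≤m+n n b) (λ i n<i → trans (cong (λ z → lt b i · z) (e i n<i)) (ℚP.*-zeroʳ (lt b i)))) ⟩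
  sumFrom1 (n ℕ.+ b) F ≡⟨ sumFrom1-split b n F ⟩
  sumFrom1 b F + sumFrom1 n (λ a → F (a ℕ.+ b))
    ≡⟨ cong₂ _+_ (sumFrom1-0 b (λ i _ i≤b → zero-· (g i) (lt-≥ b i i≤b)))
        (sumFrom1-cong n (λ a 1≤a _ → one-· (g (a ℕ.+ b)) (lt-< b (a ℕ.+ b) (ℕP.m<n+m b 1≤a)))) ⟩
  0ℚ + sumFrom1 n (λ a → g (a ℕ.+ b)) ≡⟨ ℚP.+-identityˡ _ ⟩
  sumFrom1 n (λ a → g (a ℕ.+ b)) ∎
  where
  open ≡-Reasoning
  F : ℕ → ℚ
  F a = lt b a · g a

sumFrom1-before : ∀ n d f → d ≤ n → sumFrom1 n (λ a → lt a d · f a) ≡ sumFrom1 (ℕ.pred d) f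
sumFrom1-before n zero f _ = sumFrom1-0 n (λ a _ _ → zero-· (f a) (lt-≥ a zero z≤n))
sumFrom1-before n (suc d) f d<n = trans
  (sumFrom1-extend (λ a → lt a (suc d) · f a) (ℕP.<⇒≤ d<n) (λ a d<a → zero-· (f a) (lt-≥ a (suc d) d<a)))
  (sumFrom1-cong d (λ a _ a≤d → one-· (f a) (lt-< a (suc d) (s≤s a≤d))))

-- In the cases a > b and a < b the difference is again a positive integer and becomes the new
-- variable. Vanishing outside the box lets it run over the full range.
sum²-trichotomy : ∀ n h → (∀ a b → 1 ≤ a → 1 ≤ b → n < a ⊎ n < b → h a b ≡ 0ℚ) →
  sum² n h ≡ sum² n (λ a b → h (a ℕ.+ b) b) + sum² n (λ a b → h a (a ℕ.+ b)) + sumFrom1 n (λ a → h a a)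
sum²-trichotomy n h e = begin
  sum² n h
    ≡⟨ sum²-cong n (λ a b _ _ → sym (one-· (h a b) (trichotomy a b))) ⟩
  sum² n (λ a b → (lt b a + lt a b + δ a b) · h a b)
    ≡⟨ sum²-cong n (λ a b _ _ → trans (ℚP.*-distribʳ-+ (h a b) (lt b a + lt a b) (δ a b))
         (cong (_+ δ a b · h a b) (ℚP.*-distribʳ-+ (h a b) (lt b a) (lt a b)))) ⟩
  sum² n (λ a b → lt b a · h a b + lt a b · h a b + δ a b · h a b)
    ≡⟨ trans (sum²-+ n _ _) (cong (_+ sum² n (λ a b → δ a b · h a b)) (sum²-+ n _ _)) ⟩
  sum² n (λ a b → lt b a · h a b) + sum² n (λ a b → lt a b · h a b) + sum² n (λ a b → δ a b · h a b)
    ≡⟨ cong₂ _+_ (cong₂ _+_ above below) (sumFrom1-cong n (λ a 1≤a a≤n → sumFrom1-δ n a (h a) 1≤a a≤n)) ⟩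
  sum² n (λ a b → h (a ℕ.+ b) b) + sum² n (λ a b → h a (a ℕ.+ b)) + sumFrom1 n (λ a → h a a) ∎
  where
  open ≡-Reasoning
  positive : ∀ {a} → n < a → 1 ≤ a
  positive n<a = ℕP.≤-trans (s≤s z≤n) n<a
  above : sum² n (λ a b → lt b a · h a b) ≡ sum² n (λ a b → h (a ℕ.+ b) b)
  above = trans (sum²-swap n (λ a b → lt b a · h a b)) (trans
    (sumFrom1-cong n (λ b 1≤b _ → sumFrom1-after n b (λ a → h a b) (λ a n<a → e a b (positive n<a) 1≤b (inj₁ n<a))))
    (sum²-swap n (λ b a → h (a ℕ.+ b) b)))
  below : sum² n (λ a b → lt a b · h a b) ≡ sum² n (λ a b → h a (a ℕ.+ b))
  below = sumFrom1-cong n (λ a 1≤a _ → trans (sumFrom1-after n a (h a) (λ b n<b → e a b 1≤a (positive n<b) (inj₂ n<b)))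
    (sumFrom1-cong n (λ b _ _ → cong (h a) (ℕP.+-comm b a))))

-- Grouping by d = a + b; the inner range ends at d - 1 because b = d - a has to stay positive.
sum²-antidiagonal : ∀ n k → (∀ a b → 1 ≤ a → n < a ℕ.+ b → k a b ≡ 0ℚ) →
  sum² n k ≡ sumFrom1 n (λ d → sumFrom1 (ℕ.pred d) (λ a → k a (d ∸ a)))
sum²-antidiagonal n k e = begin
  sum² n k
    ≡⟨ sum²-cong n (λ a b _ _ → cong (k a) (sym (ℕP.m+n∸n≡m b a))) ⟩
  sum² n (λ a b → k a ((b ℕ.+ a) ∸ a))
    ≡⟨ sumFrom1-cong n (λ a 1≤a _ → sym (sumFrom1-after n a (λ d → k a (d ∸ a))
         (λ d n<d → e a (d ∸ a) 1≤a (ℕP.<-≤-trans n<d (ℕP.m≤n+m∸n d a))))) ⟩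
  sum² n (λ a d → lt a d · k a (d ∸ a))
    ≡⟨ sum²-swap n (λ a d → lt a d · k a (d ∸ a)) ⟩
  sumFrom1 n (λ d → sumFrom1 n (λ a → lt a d · k a (d ∸ a)))
    ≡⟨ sumFrom1-cong n (λ d _ d≤n → sumFrom1-before n d (λ a → k a (d ∸ a)) d≤n) ⟩
  sumFrom1 n (λ d → sumFrom1 (ℕ.pred d) (λ a → k a (d ∸ a))) ∎
  where open ≡-Reasoning

-- Lambert series

opaque
  -- The sum of f(d, e) q^(d e) over d, e ≥ 1. With the cofactor e as an argument, χ₃(d) and χ₃(n/d)
  -- are treated alike, θ becomes multiplication by d e, and exchanging divisor and cofactor is a
  -- swap of two sums.
  Lam : (ℕ → ℕ → ℚ) → PS
  Lam f n = sum² n (λ d e → δ (d ℕ.* e) n · f d e)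

  Lam-at : ∀ f n → Lam f n ≡ sum² n (λ d e → δ (d ℕ.* e) n · f d e)
  Lam-at f n = refl

m≤m*n′ : ∀ m {n} → 1 ≤ n → m ≤ m ℕ.* n
m≤m*n′ m {n} 1≤n = subst (_≤ m ℕ.* n) (ℕP.*-identityʳ m) (ℕP.*-monoʳ-≤ m 1≤n)

m≤n*m′ : ∀ m {n} → 1 ≤ n → m ≤ n ℕ.* m
m≤n*m′ m {n} 1≤n = subst (m ≤_) (ℕP.*-comm m n) (m≤m*n′ m 1≤n)

δ-product-vanish : ∀ {m n d e} x → 1 ≤ d → 1 ≤ e → m ≤ n → n < d ⊎ n < e → δ (d ℕ.* e) m · x ≡ 0ℚ
δ-product-vanish {d = d} {e} x 1≤d 1≤e m≤n (inj₁ n<d) = zero-· x (δ-> (d ℕ.* e) _ (ℕP.≤-<-trans m≤n (ℕP.<-≤-trans n<d (m≤m*n′ d 1≤e))))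
δ-product-vanish {d = d} {e} x 1≤d 1≤e m≤n (inj₂ n<e) = zero-· x (δ-> (d ℕ.* e) _ (ℕP.≤-<-trans m≤n (ℕP.<-≤-trans n<e (m≤n*m′ e 1≤d))))

Lam-bound : ∀ f {m n} → m ≤ n → Lam f m ≡ sum² n (λ d e → δ (d ℕ.* e) m · f d e)
Lam-bound f {m} {n} m≤n = trans (Lam-at f m) (sym (sum²-extend (λ d e → δ (d ℕ.* e) m · f d e) m≤n
  (λ d e 1≤d 1≤e out → δ-product-vanish (f d e) 1≤d 1≤e ℕP.≤-refl out)))

Lam-at-0 : ∀ f → Lam f 0 ≡ 0ℚ
Lam-at-0 f = Lam-at f 0

Lam-cong′ : ∀ {f g} n → (∀ d e → 1 ≤ d → 1 ≤ e → d ℕ.* e ≡ n → f d e ≡ g d e) → Lam f n ≡ Lam g n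
Lam-cong′ {f} {g} n e = trans (Lam-at f n) (trans (sum²-cong n (λ a b 1≤a 1≤b → δ-· (a ℕ.* b) n (e a b 1≤a 1≤b))) (sym (Lam-at g n)))

Lam-cong : ∀ {f g} → (∀ d e → 1 ≤ d → 1 ≤ e → f d e ≡ g d e) → Lam f ≈ Lam g
Lam-cong e .at n = Lam-cong′ n (λ d f 1≤d 1≤f _ → e d f 1≤d 1≤f)

Lam-+ : ∀ f g → Lam (λ d e → f d e + g d e) ≈ Lam f +ₛ Lam g
Lam-+ f g .at n = trans (Lam-at _ n) (trans (sum²-cong n (λ a b _ _ → ℚP.*-distribˡ-+ (δ (a ℕ.* b) n) (f a b) (g a b)))
  (trans (sum²-+ n (λ a b → δ (a ℕ.* b) n · f a b) (λ a b → δ (a ℕ.* b) n · g a b))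
    (sym (trans (+ₛ-at (Lam f) (Lam g) n) (cong₂ _+_ (Lam-at f n) (Lam-at g n))))))

Lam-· : ∀ c f n → Lam (λ d e → c · f d e) n ≡ c · Lam f n
Lam-· c f n = trans (Lam-at _ n) (trans (sum²-cong n (λ a b _ _ →
    solveℚ 3 (λ x c f → x ⟨·⟩ (c ⟨·⟩ f) ⟨=⟩ c ⟨·⟩ (x ⟨·⟩ f)) refl (δ (a ℕ.* b) n) c (f a b)))
  (trans (sum²-·ˡ n c (λ a b → δ (a ℕ.* b) n · f a b)) (cong (λ z → c · z) (sym (Lam-at f n)))))

Lam-K : ∀ z f → Lam (λ d e → ι z · f d e) ≈ K z *ₛ Lam f
Lam-K z f .at n = trans (Lam-· (ι z) f n) (sym (K-*ₛ z (Lam f) n))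

Lam-flip : ∀ f → Lam f ≈ Lam (λ d e → f e d)
Lam-flip f .at n = trans (Lam-at f n) (trans (sum²-swap n (λ d e → δ (d ℕ.* e) n · f d e))
  (trans (sum²-cong n (λ a b _ _ → cong (λ m → δ m n · f b a) (ℕP.*-comm b a))) (sym (Lam-at _ n))))

θ-Lam : ∀ f → θ (Lam f) ≈ Lam (λ d e → nat d · nat e · f d e)
θ-Lam f .at n = trans (θ-at (Lam f) n) (trans (sym (Lam-· (nat n) f n))
  (Lam-cong′ n (λ d e _ _ de≡n → cong (_· f d e) (trans (cong nat (sym de≡n)) (nat-* d e)))))

sumTo-sumFrom1-swap : ∀ m n (f : ℕ → ℕ → ℚ) → sumTo m (λ i → sumFrom1 n (λ j → f i j)) ≡ sumFrom1 n (λ j → sumTo m (λ i → f i j))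
sumTo-sumFrom1-swap m zero f = sumTo-0 m (λ _ _ → refl)
sumTo-sumFrom1-swap m (suc n) f = trans (sumTo-+ m (λ i → sumFrom1 n (f i)) (λ i → f i (suc n)))
  (cong (_+ sumTo m (λ i → f i (suc n))) (sumTo-sumFrom1-swap m n f))

sumTo-δ : ∀ n m (h : ℕ → ℚ) → m ≤ n → sumTo n (λ i → δ m i · h i) ≡ h m
sumTo-δ zero zero h _ = ℚP.*-identityˡ (h 0)
sumTo-δ (suc n) m h m≤1+n with m ℕP.≟ suc n
... | yes refl = trans (cong₂ _+_ (sumTo-0 n (λ i i≤n → zero-· (h i) (δ-> (suc n) i (s≤s i≤n)))) (one-· (h m) (δ-refl m))) (ℚP.+-identityˡ _)
... | no m≢1+n = trans (cong₂ _+_ (sumTo-δ n m h (ℕP.≤-pred (ℕP.≤∧≢⇒< m≤1+n m≢1+n))) (zero-· (h (suc n)) (δ-≢ m (suc n) m≢1+n))) (ℚP.+-identityʳ _)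

-- Products of Lambert series as sums over a x + b y = n

δ-∸ : ∀ k m n → m ≤ n → δ k (n ∸ m) ≡ δ (m ℕ.+ k) n
δ-∸ k zero n _ = refl
δ-∸ k (suc m) (suc n) (s≤s m≤n) = δ-∸ k m n m≤n

quad : (ℕ → ℕ → ℕ → ℕ → ℚ) → ℕ → ℚ
quad V n = sum² n (λ a b → sum² n (λ x y → δ (a ℕ.* x ℕ.+ b ℕ.* y) n · V a b x y))

quad-cong : ∀ {V W} n → (∀ a b x y → 1 ≤ a → 1 ≤ b → 1 ≤ x → 1 ≤ y → V a b x y ≡ W a b x y) → quad V n ≡ quad W n
quad-cong n e = sum²-cong n (λ a b 1≤a 1≤b → sum²-cong n (λ x y 1≤x 1≤y →
  cong (λ z → δ (a ℕ.* x ℕ.+ b ℕ.* y) n · z) (e a b x y 1≤a 1≤b 1≤x 1≤y)))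

quad-+ : ∀ V W n → quad (λ a b x y → V a b x y + W a b x y) n ≡ quad V n + quad W n
quad-+ V W n = trans (sum²-cong n (λ a b _ _ → trans
    (sum²-cong n (λ x y _ _ → ℚP.*-distribˡ-+ (δ (a ℕ.* x ℕ.+ b ℕ.* y) n) (V a b x y) (W a b x y)))
    (sum²-+ n (λ x y → δ (a ℕ.* x ℕ.+ b ℕ.* y) n · V a b x y) (λ x y → δ (a ℕ.* x ℕ.+ b ℕ.* y) n · W a b x y))))
  (sum²-+ n (λ a b → sum² n (λ x y → δ (a ℕ.* x ℕ.+ b ℕ.* y) n · V a b x y)) (λ a b → sum² n (λ x y → δ (a ℕ.* x ℕ.+ b ℕ.* y) n · W a b x y)))

-- The index of the Cauchy product is forced to equal a x, so the sum over it collapses to one term;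
-- if a x > n there is none, and the constraint a x + b y = n fails as well.
Lam-*ₛ : ∀ f g n → (Lam f *ₛ Lam g) n ≡ quad (λ a b x y → f a x · g b y) n
Lam-*ₛ f g n = begin
  (Lam f *ₛ Lam g) n
    ≡⟨ *ₛ-at (Lam f) (Lam g) n ⟩
  sumTo n (λ i → Lam f i · Lam g (n ∸ i))
    ≡⟨ sumTo-cong n (λ i i≤n → trans (cong (_· Lam g (n ∸ i)) (Lam-bound f i≤n))
         (trans (sym (sum²-·ʳ n (Lam g (n ∸ i)) (λ a x → δ (a ℕ.* x) i · f a x)))
           (sum²-cong n (λ a x _ _ → ℚP.*-assoc (δ (a ℕ.* x) i) (f a x) (Lam g (n ∸ i)))))) ⟩
  sumTo n (λ i → sum² n (λ a x → δ (a ℕ.* x) i · (f a x · Lam g (n ∸ i))))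
    ≡⟨ trans (sumTo-sumFrom1-swap n n (λ i a → sumFrom1 n (λ x → δ (a ℕ.* x) i · (f a x · Lam g (n ∸ i)))))
         (sumFrom1-cong n (λ a _ _ → sumTo-sumFrom1-swap n n (λ i x → δ (a ℕ.* x) i · (f a x · Lam g (n ∸ i))))) ⟩
  sum² n (λ a x → sumTo n (λ i → δ (a ℕ.* x) i · (f a x · Lam g (n ∸ i))))
    ≡⟨ sum²-cong n (λ a x _ _ → term a x) ⟩
  sum² n (λ a x → sum² n (λ b y → δ (a ℕ.* x ℕ.+ b ℕ.* y) n · (f a x · g b y)))
    ≡⟨ sumFrom1-cong n (λ a _ _ → sumFrom1-swap n n (λ x b → sumFrom1 n (λ y → δ (a ℕ.* x ℕ.+ b ℕ.* y) n · (f a x · g b y)))) ⟩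
  quad (λ a b x y → f a x · g b y) n ∎
  where
  open ≡-Reasoning
  term : ∀ a x → sumTo n (λ i → δ (a ℕ.* x) i · (f a x · Lam g (n ∸ i)))
               ≡ sum² n (λ b y → δ (a ℕ.* x ℕ.+ b ℕ.* y) n · (f a x · g b y))
  term a x with a ℕ.* x ℕP.≤? n
  ... | yes ax≤n = trans (sumTo-δ n (a ℕ.* x) (λ i → f a x · Lam g (n ∸ i)) ax≤n)
    (trans (cong (λ z → f a x · z) (Lam-bound g (ℕP.m∸n≤m n (a ℕ.* x))))
    (trans (sym (sum²-·ˡ n (f a x) (λ b y → δ (b ℕ.* y) (n ∸ a ℕ.* x) · g b y)))
    (sum²-cong n (λ b y _ _ → trans (cong (λ z → f a x · (z · g b y)) (δ-∸ (b ℕ.* y) (a ℕ.* x) n ax≤n))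
      (solveℚ 3 (λ x c f → x ⟨·⟩ (c ⟨·⟩ f) ⟨=⟩ c ⟨·⟩ (x ⟨·⟩ f)) refl (f a x) (δ (a ℕ.* x ℕ.+ b ℕ.* y) n) (g b y))))))
  ... | no ax≰n = trans (sumTo-0 n (λ i i≤n → zero-· _ (δ-> (a ℕ.* x) i (ℕP.≤-<-trans i≤n (ℕP.≰⇒> ax≰n)))))
    (sym (sum²-0 n (λ b y _ _ → zero-· _ (δ-> (a ℕ.* x ℕ.+ b ℕ.* y) n (ℕP.<-≤-trans (ℕP.≰⇒> ax≰n) (ℕP.m≤m+n _ _))))))

quad-flip : ∀ V n → quad V n ≡ quad (λ a b x y → V b a y x) n
quad-flip V n = trans (sum²-swap n (λ a b → sum² n (λ x y → δ (a ℕ.* x ℕ.+ b ℕ.* y) n · V a b x y)))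
  (sum²-cong n (λ a b _ _ → trans (sum²-swap n (λ x y → δ (b ℕ.* x ℕ.+ a ℕ.* y) n · V b a x y))
    (sum²-cong n (λ x y _ _ → cong (λ m → δ m n · V b a y x) (ℕP.+-comm (b ℕ.* y) (a ℕ.* x))))))

-- The substitution (a, b, x, y) ↦ (a + b, b, x, y − x) preserves a x + b y and carries y > x to a > b,
-- so the two trichotomies of the solutions of a x + b y = n differ only in their diagonals.
module _ (V V′ : ℕ → ℕ → ℕ → ℕ → ℚ)
         (V-above : ∀ a b x y → V′ (a ℕ.+ b) b x y ≡ V a b x (x ℕ.+ y))
         (V-below : ∀ a b x y → V′ a (a ℕ.+ b) x y ≡ V a b (x ℕ.+ y) y) where

  -- What the diagonals leave behind: x = y turns the constraint into (a + b) x = n with d = a + b,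
  -- and a = b turns it into a (x + y) = n with e = x + y. Both are sums over factorisations of n,
  -- that is, Lambert coefficients.
  antidiagonalˡ antidiagonalʳ : ℕ → ℕ → ℚ
  antidiagonalˡ d x = sumFrom1 (ℕ.pred d) (λ a → V a (d ∸ a) x x)
  antidiagonalʳ a e = sumFrom1 (ℕ.pred e) (λ x → V′ a a x (e ∸ x))

  private
    module _ (n : ℕ) where
      open ≡-Reasoning

      upper lower : ℚ
      upper = sum² n (λ a b → sum² n (λ x y → δ ((a ℕ.+ b) ℕ.* x ℕ.+ b ℕ.* y) n · V a b x (x ℕ.+ y)))
      lower = sum² n (λ a b → sum² n (λ x y → δ (a ℕ.* x ℕ.+ (a ℕ.+ b) ℕ.* y) n · V a b (x ℕ.+ y) y))

      term-vanishˡ : ∀ {a b x y} z → 1 ≤ x → 1 ≤ y → n < a ⊎ n < b → δ (a ℕ.* x ℕ.+ b ℕ.* y) n · z ≡ 0ℚ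
      term-vanishˡ {a} {b} {x} {y} z 1≤x 1≤y (inj₁ n<a) = zero-· z (δ-> _ n (ℕP.<-≤-trans n<a (ℕP.≤-trans (m≤m*n′ a 1≤x) (ℕP.m≤m+n (a ℕ.* x) (b ℕ.* y)))))
      term-vanishˡ {a} {b} {x} {y} z 1≤x 1≤y (inj₂ n<b) = zero-· z (δ-> _ n (ℕP.<-≤-trans n<b (ℕP.≤-trans (m≤m*n′ b 1≤y) (ℕP.m≤n+m (b ℕ.* y) (a ℕ.* x)))))

      term-vanishʳ : ∀ {a b x y} z → 1 ≤ a → 1 ≤ b → n < x ⊎ n < y → δ (a ℕ.* x ℕ.+ b ℕ.* y) n · z ≡ 0ℚ
      term-vanishʳ {a} {b} {x} {y} z 1≤a 1≤b (inj₁ n<x) = zero-· z (δ-> _ n (ℕP.<-≤-trans n<x (ℕP.≤-trans (m≤n*m′ x 1≤a) (ℕP.m≤m+n (a ℕ.* x) (b ℕ.* y)))))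
      term-vanishʳ {a} {b} {x} {y} z 1≤a 1≤b (inj₂ n<y) = zero-· z (δ-> _ n (ℕP.<-≤-trans n<y (ℕP.≤-trans (m≤n*m′ y 1≤b) (ℕP.m≤n+m (b ℕ.* y) (a ℕ.* x)))))

      diagonalˡ : sum² n (λ a b → sumFrom1 n (λ x → δ (a ℕ.* x ℕ.+ b ℕ.* x) n · V a b x x)) ≡ Lam antidiagonalˡ n
      diagonalˡ = begin
        sum² n (λ a b → sumFrom1 n (λ x → δ (a ℕ.* x ℕ.+ b ℕ.* x) n · V a b x x))
          ≡⟨ sum²-antidiagonal n (λ a b → sumFrom1 n (λ x → δ (a ℕ.* x ℕ.+ b ℕ.* x) n · V a b x x))
               (λ a b _ n<a+b → sumFrom1-0 n (λ x 1≤x _ → zero-· (V a b x x) (δ-> _ n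
                 (ℕP.<-≤-trans n<a+b (subst (a ℕ.+ b ≤_) (ℕP.*-distribʳ-+ x a b) (m≤m*n′ (a ℕ.+ b) 1≤x)))))) ⟩
        sumFrom1 n (λ d → sumFrom1 (ℕ.pred d) (λ a → sumFrom1 n (λ x → δ (a ℕ.* x ℕ.+ (d ∸ a) ℕ.* x) n · V a (d ∸ a) x x)))
          ≡⟨ sumFrom1-cong n (λ { (suc d) _ _ → trans
               (sumFrom1-swap d n (λ a x → δ (a ℕ.* x ℕ.+ (suc d ∸ a) ℕ.* x) n · V a (suc d ∸ a) x x))
               (sumFrom1-cong n (λ x _ _ → trans
                 (sumFrom1-cong d (λ a _ a≤d → cong (λ m → δ m n · V a (suc d ∸ a) x x)
                   (trans (sym (ℕP.*-distribʳ-+ x a (suc d ∸ a))) (cong (ℕ._* x) (ℕP.m+[n∸m]≡n (ℕP.m≤n⇒m≤1+n a≤d))))))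
                 (sumFrom1-·ˡ d (δ (suc d ℕ.* x) n) (λ a → V a (suc d ∸ a) x x)))) }) ⟩
        sum² n (λ d x → δ (d ℕ.* x) n · antidiagonalˡ d x)
          ≡⟨ sym (Lam-at antidiagonalˡ n) ⟩
        Lam antidiagonalˡ n ∎

      diagonalʳ : sumFrom1 n (λ a → sum² n (λ x y → δ (a ℕ.* x ℕ.+ a ℕ.* y) n · V′ a a x y)) ≡ Lam antidiagonalʳ n
      diagonalʳ = begin
        sumFrom1 n (λ a → sum² n (λ x y → δ (a ℕ.* x ℕ.+ a ℕ.* y) n · V′ a a x y))
          ≡⟨ sumFrom1-cong n (λ a 1≤a _ → sum²-antidiagonal n (λ x y → δ (a ℕ.* x ℕ.+ a ℕ.* y) n · V′ a a x y)
               (λ x y _ n<x+y → zero-· (V′ a a x y) (δ-> _ n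
                 (ℕP.<-≤-trans n<x+y (subst (x ℕ.+ y ≤_) (ℕP.*-distribˡ-+ a x y) (m≤n*m′ (x ℕ.+ y) 1≤a)))))) ⟩
        sum² n (λ a e → sumFrom1 (ℕ.pred e) (λ x → δ (a ℕ.* x ℕ.+ a ℕ.* (e ∸ x)) n · V′ a a x (e ∸ x)))
          ≡⟨ sum²-cong n (λ { a (suc e) _ _ → trans
               (sumFrom1-cong e (λ x _ x≤e → cong (λ m → δ m n · V′ a a x (suc e ∸ x))
                   (trans (sym (ℕP.*-distribˡ-+ a x (suc e ∸ x))) (cong (a ℕ.*_) (ℕP.m+[n∸m]≡n (ℕP.m≤n⇒m≤1+n x≤e))))))
               (sumFrom1-·ˡ e (δ (a ℕ.* suc e) n) (λ x → V′ a a x (suc e ∸ x))) }) ⟩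
        sum² n (λ a e → δ (a ℕ.* e) n · antidiagonalʳ a e)
          ≡⟨ sym (Lam-at antidiagonalʳ n) ⟩
        Lam antidiagonalʳ n ∎

      -- The case x > y leaves the form a x + (a + b) y and the case x < y leaves (a + b) x + b y.
      -- `split-ab` meets the same two sums in the opposite order, which is why they cancel.
      split-xy : quad V n ≡ lower + upper + Lam antidiagonalˡ n
      split-xy = begin
        quad V n
          ≡⟨ sum²-cong n (λ a b 1≤a 1≤b → sum²-trichotomy n (λ x y → δ (a ℕ.* x ℕ.+ b ℕ.* y) n · V a b x y)
               (λ x y _ _ out → term-vanishʳ {a} {b} {x} {y} (V a b x y) 1≤a 1≤b out)) ⟩
        sum² n (λ a b → sum² n (λ x y → δ (a ℕ.* (x ℕ.+ y) ℕ.+ b ℕ.* y) n · V a b (x ℕ.+ y) y)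
                       + sum² n (λ x y → δ (a ℕ.* x ℕ.+ b ℕ.* (x ℕ.+ y)) n · V a b x (x ℕ.+ y))
                       + sumFrom1 n (λ x → δ (a ℕ.* x ℕ.+ b ℕ.* x) n · V a b x x))
          ≡⟨ trans (sum²-+ n _ (λ a b → sumFrom1 n (λ x → δ (a ℕ.* x ℕ.+ b ℕ.* x) n · V a b x x)))
               (cong (_+ sum² n (λ a b → sumFrom1 n (λ x → δ (a ℕ.* x ℕ.+ b ℕ.* x) n · V a b x x)))
                 (sum²-+ n (λ a b → sum² n (λ x y → δ (a ℕ.* (x ℕ.+ y) ℕ.+ b ℕ.* y) n · V a b (x ℕ.+ y) y))
                           (λ a b → sum² n (λ x y → δ (a ℕ.* x ℕ.+ b ℕ.* (x ℕ.+ y)) n · V a b x (x ℕ.+ y))))) ⟩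
        sum² n (λ a b → sum² n (λ x y → δ (a ℕ.* (x ℕ.+ y) ℕ.+ b ℕ.* y) n · V a b (x ℕ.+ y) y))
          + sum² n (λ a b → sum² n (λ x y → δ (a ℕ.* x ℕ.+ b ℕ.* (x ℕ.+ y)) n · V a b x (x ℕ.+ y)))
          + sum² n (λ a b → sumFrom1 n (λ x → δ (a ℕ.* x ℕ.+ b ℕ.* x) n · V a b x x))
          ≡⟨ cong₂ _+_ (cong₂ _+_
               (sum²-cong n (λ a b _ _ → sum²-cong n (λ x y _ _ → cong (λ m → δ m n · V a b (x ℕ.+ y) y)
                 (ℕS.solve 4 (λ a b x y → a ℕS.:* (x ℕS.:+ y) ℕS.:+ b ℕS.:* y ℕS.:= a ℕS.:* x ℕS.:+ (a ℕS.:+ b) ℕS.:* y) refl a b x y))))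
               (sum²-cong n (λ a b _ _ → sum²-cong n (λ x y _ _ → cong (λ m → δ m n · V a b x (x ℕ.+ y))
                 (ℕS.solve 4 (λ a b x y → a ℕS.:* x ℕS.:+ b ℕS.:* (x ℕS.:+ y) ℕS.:= (a ℕS.:+ b) ℕS.:* x ℕS.:+ b ℕS.:* y) refl a b x y)))))
               diagonalˡ ⟩
        lower + upper + Lam antidiagonalˡ n ∎

      split-ab : quad V′ n ≡ upper + lower + Lam antidiagonalʳ n
      split-ab = begin
        quad V′ n
          ≡⟨ sum²-trichotomy n (λ a b → sum² n (λ x y → δ (a ℕ.* x ℕ.+ b ℕ.* y) n · V′ a b x y))
               (λ a b _ _ out → sum²-0 n (λ x y 1≤x 1≤y → term-vanishˡ {a} {b} {x} {y} (V′ a b x y) 1≤x 1≤y out)) ⟩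
        sum² n (λ a b → sum² n (λ x y → δ ((a ℕ.+ b) ℕ.* x ℕ.+ b ℕ.* y) n · V′ (a ℕ.+ b) b x y))
          + sum² n (λ a b → sum² n (λ x y → δ (a ℕ.* x ℕ.+ (a ℕ.+ b) ℕ.* y) n · V′ a (a ℕ.+ b) x y))
          + sumFrom1 n (λ a → sum² n (λ x y → δ (a ℕ.* x ℕ.+ a ℕ.* y) n · V′ a a x y))
          ≡⟨ cong₂ _+_ (cong₂ _+_
               (sum²-cong n (λ a b _ _ → sum²-cong n (λ x y _ _ → cong (λ z → δ ((a ℕ.+ b) ℕ.* x ℕ.+ b ℕ.* y) n · z) (V-above a b x y))))
               (sum²-cong n (λ a b _ _ → sum²-cong n (λ x y _ _ → cong (λ z → δ (a ℕ.* x ℕ.+ (a ℕ.+ b) ℕ.* y) n · z) (V-below a b x y)))))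
               diagonalʳ ⟩
        upper + lower + Lam antidiagonalʳ n ∎

  quad-difference : ∀ n → quad V n + Lam antidiagonalʳ n ≡ quad V′ n + Lam antidiagonalˡ n
  quad-difference n = trans (cong (_+ Lam antidiagonalʳ n) (split-xy n)) (trans
    (solveℚ 4 (λ a b c d → (a ⟨+⟩ b ⟨+⟩ c) ⟨+⟩ d ⟨=⟩ (b ⟨+⟩ a ⟨+⟩ d) ⟨+⟩ c) refl (lower n) (upper n) (Lam antidiagonalˡ n) (Lam antidiagonalʳ n))
    (cong (_+ Lam antidiagonalˡ n) (sym (split-ab n))))

  -- When V - V′ is the symmetrised product of f and g, the difference of the two fourfold sums is
  -- twice the product of the Lambert series. A product is thereby expressed through single Lambert
  -- series.
  Lam-convolution : ∀ f g → (∀ a b x y → 1 ≤ a → 1 ≤ b → 1 ≤ x → 1 ≤ y → V a b x y ≡ V′ a b x y + (f a x · g b y + f b y · g a x)) →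
    Lam antidiagonalˡ ≈ Lam antidiagonalʳ +ₛ (Lam f *ₛ Lam g +ₛ Lam f *ₛ Lam g)
  Lam-convolution f g e .at n = begin
    Lam antidiagonalˡ n
      ≡⟨ solveℚ 2 (λ v l → l ⟨=⟩ (v ⟨+⟩ l) ⟨-⟩ v) refl (quad V′ n) (Lam antidiagonalˡ n) ⟩
    (quad V′ n + Lam antidiagonalˡ n) - quad V′ n
      ≡⟨ cong (_- quad V′ n) (sym (quad-difference n)) ⟩
    (quad V n + Lam antidiagonalʳ n) - quad V′ n
      ≡⟨ cong (λ z → (z + Lam antidiagonalʳ n) - quad V′ n) products ⟩
    (quad V′ n + (fg + fg) + Lam antidiagonalʳ n) - quad V′ n
      ≡⟨ solveℚ 3 (λ v p r → (v ⟨+⟩ p ⟨+⟩ r) ⟨-⟩ v ⟨=⟩ r ⟨+⟩ p) refl (quad V′ n) (fg + fg) (Lam antidiagonalʳ n) ⟩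
    Lam antidiagonalʳ n + (fg + fg)
      ≡⟨ sym (trans (+ₛ-at _ _ n) (cong (λ z → Lam antidiagonalʳ n + z) (+ₛ-at _ _ n))) ⟩
    (Lam antidiagonalʳ +ₛ (Lam f *ₛ Lam g +ₛ Lam f *ₛ Lam g)) n ∎
    where
    open ≡-Reasoning
    fg : ℚ
    fg = (Lam f *ₛ Lam g) n
    products : quad V n ≡ quad V′ n + (fg + fg)
    products = begin
      quad V n ≡⟨ quad-cong n e ⟩
      quad (λ a b x y → V′ a b x y + (f a x · g b y + f b y · g a x)) n ≡⟨ quad-+ V′ (λ a b x y → f a x · g b y + f b y · g a x) n ⟩
      quad V′ n + quad (λ a b x y → f a x · g b y + f b y · g a x) n
        ≡⟨ cong (λ z → quad V′ n + z) (trans (quad-+ (λ a b x y → f a x · g b y) (λ a b x y → f b y · g a x) n)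
             (cong₂ _+_ (sym (Lam-*ₛ f g n)) (trans (sym (quad-flip (λ a b x y → f a x · g b y) n)) (sym (Lam-*ₛ f g n))))) ⟩
      quad V′ n + (fg + fg) ∎

  -- M clears the denominators that arise when V is summed in closed form along antidiagonals; T is
  -- what remains once both antidiagonal sums are known.
  Lam-convolution-closed : ∀ M f g T → (∀ a b x y → V a b x y ≡ V′ a b x y + (f a x · g b y + f b y · g a x)) →
    (∀ d e → 1 ≤ d → 1 ≤ e → ι M · antidiagonalˡ d e ≡ T d e + ι M · antidiagonalʳ d e) →
    K M *ₛ (Lam f *ₛ Lam g +ₛ Lam f *ₛ Lam g) ≈ Lam T
  Lam-convolution-closed M f g T products pointwise = begin
    K M *ₛ (Lam f *ₛ Lam g +ₛ Lam f *ₛ Lam g)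
      ≈⟨ solve 3 (λ m r p → m :* p := m :* (r :+ p) :- m :* r) ≈-refl (K M) (Lam antidiagonalʳ) (Lam f *ₛ Lam g +ₛ Lam f *ₛ Lam g) ⟩
    K M *ₛ (Lam antidiagonalʳ +ₛ (Lam f *ₛ Lam g +ₛ Lam f *ₛ Lam g)) -ₛ K M *ₛ Lam antidiagonalʳ
      ≈⟨ -ₛ-cong (*ₛ-congˡ (≈-sym (Lam-convolution f g (λ a b x y _ _ _ _ → products a b x y)))) ≈-refl ⟩
    K M *ₛ Lam antidiagonalˡ -ₛ K M *ₛ Lam antidiagonalʳ
      ≈⟨ -ₛ-cong (≈-trans (≈-sym (Lam-K M antidiagonalˡ)) (≈-trans (Lam-cong pointwise) (≈-trans (Lam-+ _ _) (+ₛ-congˡ (Lam-K M antidiagonalʳ))))) ≈-refl ⟩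
    Lam T +ₛ K M *ₛ Lam antidiagonalʳ -ₛ K M *ₛ Lam antidiagonalʳ
      ≈⟨ solve 2 (λ t r → (t :+ r) :- r := t) ≈-refl (Lam T) (K M *ₛ Lam antidiagonalʳ) ⟩
    Lam T ∎
    where open ≈-Reasoning

-- Quasi-polynomials modulo 3

data Z3 : Set where
  r0 r1 r2 : Z3

succ₃ : Z3 → Z3
succ₃ r0 = r1
succ₃ r1 = r2
succ₃ r2 = r0

infixl 6 _⊞_
_⊞_ : Z3 → Z3 → Z3
r0 ⊞ s = s
r1 ⊞ s = succ₃ s
r2 ⊞ s = succ₃ (succ₃ s)

res : ℕ → Z3
res zero = r0
res (suc n) = succ₃ (res n)

succ₃-⊞ : ∀ r s → succ₃ r ⊞ s ≡ succ₃ (r ⊞ s)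
succ₃-⊞ r0 s = refl
succ₃-⊞ r1 s = refl
succ₃-⊞ r2 r0 = refl
succ₃-⊞ r2 r1 = refl
succ₃-⊞ r2 r2 = refl

succ₃³ : ∀ r → succ₃ (succ₃ (succ₃ r)) ≡ r
succ₃³ r0 = refl
succ₃³ r1 = refl
succ₃³ r2 = refl

res-+ : ∀ m n → res (m ℕ.+ n) ≡ res m ⊞ res n
res-+ zero n = refl
res-+ (suc m) n = trans (cong succ₃ (res-+ m n)) (sym (succ₃-⊞ (res m) (res n)))

sumFrom1-telescope : ∀ m (c : ℚ) (G S : ℕ → ℚ) → S 0 ≡ 0ℚ → (∀ k → k < m → S (suc k) ≡ S k + c · G (suc k)) →
  c · sumFrom1 m G ≡ S m
sumFrom1-telescope zero c G S base step = trans (ℚP.*-zeroʳ c) (sym base)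
sumFrom1-telescope (suc m) c G S base step = trans (ℚP.*-distribˡ-+ c (sumFrom1 m G) (G (suc m)))
  (trans (cong (_+ c · G (suc m)) (sumFrom1-telescope m c G S base (λ k k<m → step k (ℕP.m≤n⇒m≤1+n k<m)))) (sym (step m ℕP.≤-refl)))

sumFrom1-const : ∀ m (c : ℚ) → sumFrom1 m (λ _ → c) ≡ nat m · c
sumFrom1-const zero c = sym (trans (cong (_· c) ι-0) (ℚP.*-zeroˡ c))
sumFrom1-const (suc m) c = trans (cong (_+ c) (sumFrom1-const m c))
  (trans (solveℚ 2 (λ m c → m ⟨·⟩ c ⟨+⟩ c ⟨=⟩ (conℚ (+ 1) ⟨+⟩ m) ⟨·⟩ c) refl (nat m) c) (cong (_· c) (sym (nat-+ 1 m))))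

neg : ℕ → ℤ
neg n = ℤ.- + n

tab₃ : ℤ → ℤ → ℤ → Z3 → ℤ
tab₃ a b c r0 = a
tab₃ a b c r1 = b
tab₃ a b c r2 = c

tab₉ : ℤ → ℤ → ℤ → ℤ → ℤ → ℤ → ℤ → ℤ → ℤ → Z3 → Z3 → ℤ
tab₉ a b c d e f g h i r0 = tab₃ a b c
tab₉ a b c d e f g h i r1 = tab₃ d e f
tab₉ a b c d e f g h i r2 = tab₃ g h i

-- `c₃ᶻ` is the Ramanujan sum modulo 3, the trace of the r-th power of a primitive cube root of
-- unity; `n₃ᶻ` and `d₃ᶻ` are the indicators of 3 ∤ n and 3 ∣ n.
χ₃ᶻ c₃ᶻ n₃ᶻ d₃ᶻ : Z3 → ℤ
χ₃ᶻ = tab₃ (+ 0) (+ 1) (neg 1)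
c₃ᶻ = tab₃ (+ 2) (neg 1) (neg 1)
n₃ᶻ = tab₃ (+ 0) (+ 1) (+ 1)
d₃ᶻ = tab₃ (+ 1) (+ 0) (+ 0)

infixl 6 _+:_ _-:_
infixl 7 _*:_
infix 8 ♯_
-- Polynomials are reified so that an identity whose coefficients depend on residues can be stated
-- once. For fixed residues it is a polynomial identity with integer coefficients, decided by
-- comparing normal forms.
data Form : Set where
  ♯_ : ℤ → Form
  X₀ X₁ : Form
  _+:_ _-:_ _*:_ : Form → Form → Form

ev : Form → ℚ → ℚ → ℚ
ev (♯ z) a b = ι z
ev X₀ a b = a
ev X₁ a b = b
ev (p +: q) a b = ev p a b + ev q a b
ev (p -: q) a b = ev p a b - ev q a b
ev (p *: q) a b = ev p a b · ev q a b

sub : Form → Form → Form → Form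
sub (♯ z) x y = ♯ z
sub X₀ x y = x
sub X₁ x y = y
sub (p +: q) x y = sub p x y +: sub q x y
sub (p -: q) x y = sub p x y -: sub q x y
sub (p *: q) x y = sub p x y *: sub q x y

ev-sub : ∀ p x y a b → ev (sub p x y) a b ≡ ev p (ev x a b) (ev y a b)
ev-sub (♯ z) x y a b = refl
ev-sub X₀ x y a b = refl
ev-sub X₁ x y a b = refl
ev-sub (p +: q) x y a b = cong₂ _+_ (ev-sub p x y a b) (ev-sub q x y a b)
ev-sub (p -: q) x y a b = cong₂ _-_ (ev-sub p x y a b) (ev-sub q x y a b)
ev-sub (p *: q) x y a b = cong₂ _·_ (ev-sub p x y a b) (ev-sub q x y a b)

toPolynomial : Form → ℚR.Polynomial 2
toPolynomial (♯ z) = conℚ z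
toPolynomial X₀ = ℚR.var Fin.zero
toPolynomial X₁ = ℚR.var (Fin.suc Fin.zero)
toPolynomial (p +: q) = toPolynomial p ⟨+⟩ toPolynomial q
toPolynomial (p -: q) = toPolynomial p ⟨-⟩ toPolynomial q
toPolynomial (p *: q) = toPolynomial p ⟨·⟩ toPolynomial q

ev-toPolynomial : ∀ p a b → ev p a b ≡ ℚR.⟦ toPolynomial p ⟧ (a ∷ b ∷ [])
ev-toPolynomial (♯ z) a b = refl
ev-toPolynomial X₀ a b = refl
ev-toPolynomial X₁ a b = refl
ev-toPolynomial (p +: q) a b = cong₂ _+_ (ev-toPolynomial p a b) (ev-toPolynomial q a b)
ev-toPolynomial (p -: q) a b = cong₂ _-_ (ev-toPolynomial p a b) (ev-toPolynomial q a b)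
ev-toPolynomial (p *: q) a b = cong₂ _·_ (ev-toPolynomial p a b) (ev-toPolynomial q a b)

decide : (p q : Form) → Maybe (∀ a b → ev p a b ≡ ev q a b)
decide p q with ℚR.normalise (toPolynomial p) ℚR.≟N ℚR.normalise (toPolynomial q)
... | just e = just λ a b → trans (ev-toPolynomial p a b) (trans (sym (ℚR.correct (toPolynomial p) _))
                 (trans (ℚR.⟦ e ⟧N-cong _) (trans (ℚR.correct (toPolynomial q) _) (sym (ev-toPolynomial q a b)))))
... | nothing = nothing

all₃ : {P : Z3 → Set} → (∀ r → Maybe (P r)) → Maybe (∀ r → P r)
all₃ m with m r0 | m r1 | m r2
... | just a | just b | just c = just λ { r0 → a ; r1 → b ; r2 → c }
... | _ | _ | _ = nothing

decide₃ : (p q : Z3 → Form) → Maybe (∀ r a b → ev (p r) a b ≡ ev (q r) a b)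
decide₃ p q = all₃ (λ r → decide (p r) (q r))

check₃ : (p q : Z3 → Form) {_ : Bool.T (is-just (decide₃ p q))} → ∀ r a b → ev (p r) a b ≡ ev (q r) a b
check₃ p q {ok} = to-witness-T (decide₃ p q) ok

-- For concrete p and q the certificate is found by evaluation, so a Law can be left implicit.
record Law (p q : Z3 → Z3 → Form) : Set where
  field
    {certificate} : Bool.T (is-just (all₃ (λ r → decide₃ (p r) (q r))))
  law : ∀ r s a b → ev (p r s) a b ≡ ev (q r s) a b
  law = to-witness-T (all₃ (λ r → decide₃ (p r) (q r))) certificate
open Law

split-products : ∀ v f g f′ g′ a b →
  ev v a b ≡ ev (v -: (sub f X₀ X₀ *: sub g′ X₁ X₁ +: sub f′ X₁ X₁ *: sub g X₀ X₀)) a b + (ev f a a · ev g′ b b + ev f′ b b · ev g a a)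
split-products v f g f′ g′ a b rewrite ev-sub f X₀ X₀ a b | ev-sub g′ X₁ X₁ a b | ev-sub f′ X₁ X₁ a b | ev-sub g X₀ X₀ a b =
  solveℚ 2 (λ z w → z ⟨=⟩ (z ⟨-⟩ w) ⟨+⟩ w) refl (ev v a b) (ev f a a · ev g′ b b + ev f′ b b · ev g a a)

-- R sums v over the antidiagonals, and T is the resulting Lambert coefficient.
module OuterResidue (M : ℤ) (f g : Z3 → Form) (v R : Z3 → Z3 → Form) (T : Z3 → Form) where
  -- Defined by subtraction, so that V - V′ is the symmetrised product by construction; all content
  -- then lies in the functional equations `above` and `below`.
  v′ : Z3 → Z3 → Form
  v′ r s = v r s -: (sub (f r) X₀ X₀ *: sub (g s) X₁ X₁ +: sub (f s) X₁ X₁ *: sub (g r) X₀ X₀)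

  module _
    {above : Law (λ r s → sub (v′ (r ⊞ s) s) (X₀ +: X₁) X₁) v}
    {below : Law (λ r s → sub (v′ r (r ⊞ s)) X₀ (X₀ +: X₁)) v}
    {R-zero : Law (λ r s → sub (R r0 s) (♯ + 0) X₁) (λ r s → ♯ + 0)}
    {R-suc : Law (λ r s → sub (R (succ₃ r) (succ₃ r ⊞ s)) (♯ + 1 +: X₀) (♯ + 1 +: X₀ +: X₁))
                 (λ r s → sub (R r (succ₃ r ⊞ s)) X₀ (♯ + 1 +: X₀ +: X₁) +: ♯ M *: sub (v (succ₃ r) s) (♯ + 1 +: X₀) X₁)}
    {T-eq : Law (λ r s → sub (R r (succ₃ r)) X₀ (♯ + 1 +: X₀))
                (λ r s → sub (T (succ₃ r)) (♯ + 1 +: X₀) (♯ + 1 +: X₁) +: ♯ M *: (X₁ *: sub (v′ (succ₃ r) (succ₃ r)) (♯ + 1 +: X₀) (♯ + 1 +: X₀)))} where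
    private
      V V′ : ℕ → ℕ → ℕ → ℕ → ℚ
      V a b _ _ = ev (v (res a) (res b)) (nat a) (nat b)
      V′ a b _ _ = ev (v′ (res a) (res b)) (nat a) (nat b)

      V-above : ∀ a b x y → V′ (a ℕ.+ b) b x y ≡ V a b x (x ℕ.+ y)
      V-above a b x y rewrite res-+ a b | nat-+ a b = trans (sym (ev-sub (v′ (res a ⊞ res b) (res b)) (X₀ +: X₁) X₁ (nat a) (nat b))) (law above (res a) (res b) (nat a) (nat b))

      V-below : ∀ a b x y → V′ a (a ℕ.+ b) x y ≡ V a b (x ℕ.+ y) y
      V-below a b x y rewrite res-+ a b | nat-+ a b = trans (sym (ev-sub (v′ (res a) (res a ⊞ res b)) X₀ (X₀ +: X₁) (nat a) (nat b))) (law below (res a) (res b) (nat a) (nat b))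

      Lf Lg : PS
      Lf = Lam (λ d _ → ev (f (res d)) (nat d) (nat d))
      Lg = Lam (λ d _ → ev (g (res d)) (nat d) (nat d))

      aˡ aʳ : ℕ → ℕ → ℚ
      aˡ = antidiagonalˡ V V′ V-above V-below
      aʳ = antidiagonalʳ V V′ V-above V-below

      aˡ-closed : ∀ k x → ι M · aˡ (suc k) x ≡ ev (R (res k) (res (suc k))) (nat k) (nat (suc k))
      aˡ-closed k x = sumFrom1-telescope k (ι M) (λ a → V a (suc k ∸ a) x x) (λ j → ev (R (res j) (res (suc k))) (nat j) (nat (suc k)))
        (trans (trans (sym (ev-sub (R r0 (res (suc k))) (♯ + 0) X₁ 0ℚ (nat (suc k)))) (law R-zero r0 (res (suc k)) 0ℚ (nat (suc k)))) ι-0) step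
        where
        step : ∀ j → j < k → ev (R (res (suc j)) (res (suc k))) (nat (suc j)) (nat (suc k))
             ≡ ev (R (res j) (res (suc k))) (nat j) (nat (suc k)) + ι M · V (suc j) (suc k ∸ suc j) x x
        step j j<k with ℕP.m≤n⇒∃[o]m+o≡n (ℕP.≤-trans (ℕP.n≤1+n j) j<k)
        ... | b , refl rewrite ℕP.m+n∸m≡n j b | res-+ (suc j) b | nat-+ (suc j) b | nat-+ 1 j =
          trans (sym (ev-sub (R (succ₃ (res j)) (succ₃ (res j) ⊞ res b)) (♯ + 1 +: X₀) (♯ + 1 +: X₀ +: X₁) (nat j) (nat b)))
          (trans (law R-suc (res j) (res b) (nat j) (nat b)) (cong₂ (λ y z → y + ι M · z)
            (ev-sub (R (res j) (succ₃ (res j) ⊞ res b)) X₀ (♯ + 1 +: X₀ +: X₁) (nat j) (nat b)) (ev-sub (v (succ₃ (res j)) (res b)) (♯ + 1 +: X₀) X₁ (nat j) (nat b))))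

      -- On a = b the summand depends on a alone, so the antidiagonal contributes its length e - 1
      -- times a constant.
      aʳ-closed : ∀ a k → aʳ a (suc k) ≡ nat k · ev (v′ (res a) (res a)) (nat a) (nat a)
      aʳ-closed a k = sumFrom1-const k (ev (v′ (res a) (res a)) (nat a) (nat a))

      pointwise : ∀ d e → 1 ≤ d → 1 ≤ e → ι M · aˡ d e ≡ ev (T (res d)) (nat d) (nat e) + ι M · aʳ d e
      pointwise (suc k) (suc j) _ _ rewrite aˡ-closed k (suc j) | aʳ-closed (suc k) j | nat-+ 1 k | nat-+ 1 j =
        trans (sym (ev-sub (R (res k) (res (suc k))) X₀ (♯ + 1 +: X₀) (nat k) (nat j))) (trans (law T-eq (res k) r0 (nat k) (nat j))
          (cong₂ (λ y z → y + ι M · (nat j · z)) (ev-sub (T (res (suc k))) (♯ + 1 +: X₀) (♯ + 1 +: X₁) (nat k) (nat j))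
            (ev-sub (v′ (res (suc k)) (res (suc k))) (♯ + 1 +: X₀) (♯ + 1 +: X₀) (nat k) (nat j))))

    convolution : K M *ₛ (Lf *ₛ Lg +ₛ Lf *ₛ Lg) ≈ Lam (λ d e → ev (T (res d)) (nat d) (nat e))
    convolution = Lam-convolution-closed V V′ V-above V-below M _ _ (λ d e → ev (T (res d)) (nat d) (nat e))
      (λ a b x y → split-products (v (res a) (res b)) (f (res a)) (g (res a)) (f (res b)) (g (res b)) (nat a) (nat b)) pointwise

-- Here the residues belong to the cofactors x and y. The diagonal x = y involves a single residue,
-- so `Rˡ` has one argument, whereas the antidiagonal x + y = e now runs through the classes and
-- needs the telescoping sum `Rʳ`: the roles of the two sides are exchanged.
module InnerResidue (M : ℤ) (f g : Z3 → Form) (v : Z3 → Z3 → Form) (Rˡ : Z3 → Form) (Rʳ : Z3 → Z3 → Form) (T : Z3 → Form) where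
  v′ : Z3 → Z3 → Form
  v′ r s = v r s -: (sub (f r) X₀ X₀ *: sub (g s) X₁ X₁ +: sub (f s) X₁ X₁ *: sub (g r) X₀ X₀)

  module _
    {above : Law (λ r s → sub (v′ r s) (X₀ +: X₁) X₁) (λ r s → v r (r ⊞ s))}
    {below : Law (λ r s → sub (v′ r s) X₀ (X₀ +: X₁)) (λ r s → v (r ⊞ s) s)}
    {Rˡ-zero : Law (λ r s → sub (Rˡ r) (♯ + 0) X₁) (λ r s → ♯ + 0)}
    {Rˡ-suc : Law (λ r s → sub (Rˡ r) (♯ + 1 +: X₀) (♯ + 1 +: X₀ +: X₁)) (λ r s → sub (Rˡ r) X₀ (♯ + 1 +: X₀ +: X₁) +: ♯ M *: sub (v r r) (♯ + 1 +: X₀) X₁)}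
    {Rʳ-zero : Law (λ r s → sub (Rʳ r0 s) (♯ + 0) X₁) (λ r s → ♯ + 0)}
    {Rʳ-suc : Law (λ r s → sub (Rʳ (succ₃ r) (succ₃ r ⊞ s)) (♯ + 1 +: X₀) X₁) (λ r s → Rʳ r (succ₃ r ⊞ s) +: ♯ M *: sub (v′ (succ₃ r) s) X₁ X₁)}
    {T-eq : Law (λ r s → sub (Rˡ (succ₃ r)) X₀ (♯ + 1 +: X₀)) (λ r s → sub (T (succ₃ r)) (♯ + 1 +: X₀) (♯ + 1 +: X₁) +: sub (Rʳ r (succ₃ r)) X₁ (♯ + 1 +: X₀))} where
    private
      V V′ : ℕ → ℕ → ℕ → ℕ → ℚ
      V a b x y = ev (v (res x) (res y)) (nat a) (nat b)
      V′ a b x y = ev (v′ (res x) (res y)) (nat a) (nat b)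

      V-above : ∀ a b x y → V′ (a ℕ.+ b) b x y ≡ V a b x (x ℕ.+ y)
      V-above a b x y rewrite res-+ x y | nat-+ a b = trans (sym (ev-sub (v′ (res x) (res y)) (X₀ +: X₁) X₁ (nat a) (nat b))) (law above (res x) (res y) (nat a) (nat b))

      V-below : ∀ a b x y → V′ a (a ℕ.+ b) x y ≡ V a b (x ℕ.+ y) y
      V-below a b x y rewrite res-+ x y | nat-+ a b = trans (sym (ev-sub (v′ (res x) (res y)) X₀ (X₀ +: X₁) (nat a) (nat b))) (law below (res x) (res y) (nat a) (nat b))

      Lf Lg : PS
      Lf = Lam (λ d e → ev (f (res e)) (nat d) (nat d))
      Lg = Lam (λ d e → ev (g (res e)) (nat d) (nat d))

      aˡ aʳ : ℕ → ℕ → ℚ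
      aˡ = antidiagonalˡ V V′ V-above V-below
      aʳ = antidiagonalʳ V V′ V-above V-below

      aˡ-closed : ∀ k x → ι M · aˡ (suc k) x ≡ ev (Rˡ (res x)) (nat k) (nat (suc k))
      aˡ-closed k x = sumFrom1-telescope k (ι M) (λ a → V a (suc k ∸ a) x x) (λ j → ev (Rˡ (res x)) (nat j) (nat (suc k)))
        (trans (trans (sym (ev-sub (Rˡ (res x)) (♯ + 0) X₁ 0ℚ (nat (suc k)))) (law Rˡ-zero (res x) r0 0ℚ (nat (suc k)))) ι-0) step
        where
        step : ∀ j → j < k → ev (Rˡ (res x)) (nat (suc j)) (nat (suc k))
             ≡ ev (Rˡ (res x)) (nat j) (nat (suc k)) + ι M · V (suc j) (suc k ∸ suc j) x x
        step j j<k with ℕP.m≤n⇒∃[o]m+o≡n (ℕP.≤-trans (ℕP.n≤1+n j) j<k)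
        ... | b , refl rewrite ℕP.m+n∸m≡n j b | nat-+ (suc j) b | nat-+ 1 j =
          trans (sym (ev-sub (Rˡ (res x)) (♯ + 1 +: X₀) (♯ + 1 +: X₀ +: X₁) (nat j) (nat b)))
          (trans (law Rˡ-suc (res x) r0 (nat j) (nat b)) (cong₂ (λ y z → y + ι M · z)
            (ev-sub (Rˡ (res x)) X₀ (♯ + 1 +: X₀ +: X₁) (nat j) (nat b)) (ev-sub (v (res x) (res x)) (♯ + 1 +: X₀) X₁ (nat j) (nat b))))

      aʳ-closed : ∀ a k → ι M · aʳ a (suc k) ≡ ev (Rʳ (res k) (res (suc k))) (nat k) (nat a)
      aʳ-closed a k = sumFrom1-telescope k (ι M) (λ x → V′ a a x (suc k ∸ x)) (λ j → ev (Rʳ (res j) (res (suc k))) (nat j) (nat a))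
        (trans (trans (sym (ev-sub (Rʳ r0 (res (suc k))) (♯ + 0) X₁ 0ℚ (nat a))) (law Rʳ-zero r0 (res (suc k)) 0ℚ (nat a))) ι-0) step
        where
        step : ∀ j → j < k → ev (Rʳ (res (suc j)) (res (suc k))) (nat (suc j)) (nat a)
             ≡ ev (Rʳ (res j) (res (suc k))) (nat j) (nat a) + ι M · V′ a a (suc j) (suc k ∸ suc j)
        step j j<k with ℕP.m≤n⇒∃[o]m+o≡n (ℕP.≤-trans (ℕP.n≤1+n j) j<k)
        ... | b , refl rewrite ℕP.m+n∸m≡n j b | res-+ (suc j) b | nat-+ 1 j =
          trans (sym (ev-sub (Rʳ (succ₃ (res j)) (succ₃ (res j) ⊞ res b)) (♯ + 1 +: X₀) X₁ (nat j) (nat a)))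
          (trans (law Rʳ-suc (res j) (res b) (nat j) (nat a)) (cong (λ z → ev (Rʳ (res j) (succ₃ (res j) ⊞ res b)) (nat j) (nat a) + ι M · z)
            (ev-sub (v′ (succ₃ (res j)) (res b)) X₁ X₁ (nat j) (nat a))))

      pointwise : ∀ d e → 1 ≤ d → 1 ≤ e → ι M · aˡ d e ≡ ev (T (res e)) (nat d) (nat e) + ι M · aʳ d e
      pointwise (suc k) (suc j) _ _ rewrite aˡ-closed k (suc j) | aʳ-closed (suc k) j | nat-+ 1 k | nat-+ 1 j =
        trans (sym (ev-sub (Rˡ (res (suc j))) X₀ (♯ + 1 +: X₀) (nat k) (nat j))) (trans (law T-eq (res j) r0 (nat k) (nat j))
          (cong₂ _+_ (ev-sub (T (res (suc j))) (♯ + 1 +: X₀) (♯ + 1 +: X₁) (nat k) (nat j)) (ev-sub (Rʳ (res j) (res (suc j))) X₁ (♯ + 1 +: X₀) (nat k) (nat j))))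

    convolution : K M *ₛ (Lf *ₛ Lg +ₛ Lf *ₛ Lg) ≈ Lam (λ d e → ev (T (res e)) (nat d) (nat e))
    convolution = Lam-convolution-closed V V′ V-above V-below M _ _ (λ d e → ev (T (res e)) (nat d) (nat e))
      (λ a b x y → split-products (v (res x) (res y)) (f (res x)) (g (res x)) (f (res y)) (g (res y)) (nat a) (nat b)) pointwise

-- Each v is the solution of the linear system imposed by the laws above and below, and R is its sum along
-- antidiagonals; the tables were found by linear algebra.
module χχ where
  f g T : Z3 → Form
  f r = ♯ χ₃ᶻ r
  g r = ♯ χ₃ᶻ r
  T r = ♯ tab₃ (+ 0) (neg 2) (+ 2) r +: ♯ tab₃ (+ 0) (+ 6) (+ 6) r *: X₁ +: ♯ (neg 4) *: X₀

  v R : Z3 → Z3 → Form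
  v r s = ♯ tab₉ (+ 0) (neg 2) (neg 2) (neg 2) (+ 0) (neg 2) (neg 2) (neg 2) (+ 0) r s
  R r s = ♯ tab₉ (+ 0) (+ 0) (+ 0) (neg 2) (neg 2) (+ 4) (neg 4) (+ 2) (+ 2) r s
    +: ♯ (neg 4) *: X₀

  open OuterResidue (+ 3) f g v R T public using (convolution)

module χ-dc where
  f g T : Z3 → Form
  f r = ♯ χ₃ᶻ r
  g r = ♯ c₃ᶻ r *: X₀
  T r = ♯ tab₃ (+ 0) (+ 2) (neg 2) r +: ♯ tab₃ (neg 2) (+ 1) (+ 1) r *: X₀ +: ♯ tab₃ (+ 0) (+ 3) (neg 3) r *: X₀ *: X₀ +: ♯ tab₃ (+ 0) (neg 6) (+ 6) r *: X₀ *: X₁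

  v R : Z3 → Z3 → Form
  v r s = ♯ tab₉ (+ 0) (+ 1) (neg 1) (+ 2) (+ 0) (+ 1) (neg 2) (neg 1) (+ 0) r s *: X₀
    +: ♯ tab₉ (+ 0) (+ 2) (neg 2) (+ 1) (+ 0) (neg 1) (neg 1) (+ 1) (+ 0) r s *: X₁
  R r s = ♯ tab₉ (+ 0) (+ 0) (+ 0) (+ 2) (+ 2) (neg 1) (neg 2) (+ 1) (neg 2) r s
    +: ♯ tab₉ (+ 0) (+ 0) (+ 0) (neg 3) (+ 0) (+ 3) (+ 0) (neg 3) (+ 3) r s *: X₁
    +: ♯ tab₉ (neg 2) (neg 2) (+ 1) (+ 4) (+ 1) (+ 1) (neg 2) (+ 1) (neg 2) r s *: X₀
    +: ♯ tab₉ (+ 0) (+ 3) (neg 3) (+ 0) (+ 3) (neg 3) (+ 0) (+ 3) (neg 3) r s *: X₀ *: X₁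

  open OuterResidue (+ 3) f g v R T public using (convolution)

module χ-dn where
  f g Rˡ T : Z3 → Form
  f r = ♯ χ₃ᶻ r
  g r = X₀ *: ♯ n₃ᶻ r
  Rˡ r = ♯ tab₃ (+ 0) (+ 3) (neg 3) r *: X₀ *: X₁
  T r = ♯ tab₃ (+ 0) (neg 1) (neg 1) r *: X₀ +: ♯ tab₃ (+ 0) (neg 2) (+ 2) r *: X₀ *: X₁ +: ♯ tab₃ (+ 0) (+ 3) (neg 3) r *: X₀ *: X₀

  v Rʳ : Z3 → Z3 → Form
  v r s = ♯ tab₉ (+ 0) (+ 0) (+ 0) (+ 1) (+ 1) (+ 0) (neg 1) (+ 0) (neg 1) r s *: X₀
    +: ♯ tab₉ (+ 0) (+ 1) (neg 1) (+ 0) (+ 1) (+ 0) (+ 0) (+ 0) (neg 1) r s *: X₁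
  Rʳ r s = ♯ tab₉ (+ 0) (+ 0) (+ 0) (+ 0) (+ 1) (+ 2) (+ 0) (neg 1) (+ 1) r s *: X₁
    +: ♯ tab₉ (+ 0) (+ 2) (neg 2) (+ 0) (+ 2) (neg 2) (+ 0) (+ 2) (neg 2) r s *: X₀ *: X₁

  open InnerResidue (+ 3) f g v Rˡ Rʳ T public using (convolution)

module d8c-dc where
  f g T : Z3 → Form
  f r = (♯ + 8 -: ♯ c₃ᶻ r) *: X₀
  g r = ♯ c₃ᶻ r *: X₀
  T r = ♯ tab₃ (+ 12) (+ 18) (+ 18) r *: X₀ +: ♯ tab₃ (neg 36) (neg 18) (neg 18) r *: X₀ *: X₀ *: X₁

  v R : Z3 → Z3 → Form
  v r s = ♯ tab₉ (+ 12) (neg 4) (neg 4) (+ 6) (neg 4) (neg 4) (+ 6) (neg 4) (neg 4) r s *: X₀ *: X₀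
    +: ♯ tab₉ (+ 12) (+ 6) (+ 6) (+ 6) (neg 4) (neg 14) (+ 6) (neg 14) (neg 4) r s *: X₀ *: X₁
    +: ♯ tab₉ (+ 12) (+ 6) (+ 6) (neg 4) (neg 4) (neg 4) (neg 4) (neg 4) (neg 4) r s *: X₁ *: X₁
  R r s = ♯ tab₉ (+ 0) (+ 0) (+ 0) (neg 2) (+ 0) (+ 0) (+ 2) (+ 0) (+ 0) r s
    +: ♯ tab₉ (+ 0) (+ 0) (+ 0) (+ 6) (+ 20) (+ 10) (+ 6) (+ 10) (+ 20) r s *: X₁
    +: ♯ tab₉ (+ 0) (+ 0) (+ 0) (neg 16) (neg 10) (neg 10) (neg 32) (neg 20) (neg 20) r s *: X₁ *: X₁
    +: ♯ tab₉ (+ 12) (neg 2) (neg 2) (+ 0) (neg 2) (neg 2) (+ 0) (neg 2) (neg 2) r s *: X₀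
    +: ♯ tab₉ (neg 18) (neg 14) (neg 4) (neg 12) (+ 16) (neg 4) (neg 6) (+ 16) (+ 26) r s *: X₀ *: X₁
    +: ♯ tab₉ (+ 4) (neg 2) (neg 2) (+ 4) (neg 2) (neg 2) (+ 4) (neg 2) (neg 2) r s *: X₀ *: X₁ *: X₁
    +: ♯ tab₉ (+ 18) (neg 6) (neg 6) (+ 12) (neg 6) (neg 6) (+ 6) (neg 6) (neg 6) r s *: X₀ *: X₀
    +: ♯ tab₉ (neg 12) (+ 6) (+ 6) (neg 12) (+ 6) (+ 6) (neg 12) (+ 6) (+ 6) r s *: X₀ *: X₀ *: X₁
    +: ♯ tab₉ (+ 8) (neg 4) (neg 4) (+ 8) (neg 4) (neg 4) (+ 8) (neg 4) (neg 4) r s *: X₀ *: X₀ *: X₀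

  open OuterResidue (+ 3) f g v R T public using (convolution)

module d²χ-d8c where
  f g T : Z3 → Form
  f r = ♯ χ₃ᶻ r *: X₀ *: X₀
  g r = (♯ + 8 -: ♯ c₃ᶻ r) *: X₀
  T r = ♯ tab₃ (+ 4) (+ 6) (+ 6) r *: X₀ +: ♯ tab₃ (+ 0) (neg 6) (+ 6) r *: X₀ *: X₀ *: X₀ *: X₁

  v R : Z3 → Z3 → Form
  v r s = ♯ tab₉ (+ 0) (+ 0) (+ 0) (+ 2) (+ 0) (+ 0) (neg 2) (+ 0) (+ 0) r s *: X₀ *: X₀ *: X₀
    +: ♯ tab₉ (+ 0) (+ 1) (neg 1) (+ 3) (+ 10) (neg 1) (neg 3) (+ 1) (neg 10) r s *: X₀ *: X₀ *: X₁
    +: ♯ tab₉ (+ 0) (+ 3) (neg 3) (+ 1) (+ 10) (+ 1) (neg 1) (neg 1) (neg 10) r s *: X₀ *: X₁ *: X₁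
    +: ♯ tab₉ (+ 0) (+ 2) (neg 2) (+ 0) (+ 0) (+ 0) (+ 0) (+ 0) (+ 0) r s *: X₁ *: X₁ *: X₁
  R r s = ♯ tab₉ (+ 0) (+ 0) (+ 0) (neg 2) (+ 0) (+ 0) (+ 2) (+ 0) (+ 0) r s
    +: ♯ tab₉ (+ 0) (+ 0) (+ 0) (+ 3) (+ 6) (+ 3) (+ 3) (+ 3) (+ 6) r s *: X₁
    +: ♯ tab₉ (+ 0) (+ 0) (+ 0) (+ 1) (+ 4) (+ 7) (neg 1) (neg 7) (neg 4) r s *: X₁ *: X₁
    +: ♯ tab₉ (+ 0) (+ 0) (+ 0) (+ 0) (neg 2) (+ 2) (+ 0) (neg 4) (+ 4) r s *: X₁ *: X₁ *: X₁
    +: ♯ tab₉ (+ 4) (+ 0) (+ 0) (neg 2) (+ 0) (+ 0) (neg 2) (+ 0) (+ 0) r s *: X₀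
    +: ♯ tab₉ (+ 0) (neg 4) (+ 4) (neg 6) (neg 4) (neg 14) (+ 6) (+ 14) (+ 4) r s *: X₀ *: X₁
    +: ♯ tab₉ (neg 1) (neg 10) (neg 1) (+ 2) (+ 5) (+ 17) (neg 1) (neg 13) (+ 2) r s *: X₀ *: X₁ *: X₁
    +: ♯ tab₉ (+ 0) (+ 2) (neg 2) (+ 0) (+ 2) (neg 2) (+ 0) (+ 2) (neg 2) r s *: X₀ *: X₁ *: X₁ *: X₁
    +: ♯ tab₉ (+ 0) (+ 0) (+ 0) (+ 6) (+ 0) (+ 0) (neg 6) (+ 0) (+ 0) r s *: X₀ *: X₀
    +: ♯ tab₉ (+ 3) (+ 6) (+ 3) (neg 6) (neg 3) (neg 15) (+ 3) (+ 15) (neg 6) r s *: X₀ *: X₀ *: X₁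
    +: ♯ tab₉ (+ 0) (neg 6) (+ 6) (+ 0) (neg 6) (+ 6) (+ 0) (neg 6) (+ 6) r s *: X₀ *: X₀ *: X₁ *: X₁
    +: ♯ tab₉ (neg 2) (+ 0) (+ 0) (+ 4) (+ 0) (+ 0) (neg 2) (+ 0) (+ 0) r s *: X₀ *: X₀ *: X₀
    +: ♯ tab₉ (+ 0) (+ 4) (neg 4) (+ 0) (+ 4) (neg 4) (+ 0) (+ 4) (neg 4) r s *: X₀ *: X₀ *: X₀ *: X₁

  open OuterResidue (+ 3) f g v R T public using (convolution)

module d²χ-dn where
  f g T : Z3 → Form
  f r = ♯ χ₃ᶻ r *: X₀ *: X₀
  g r = X₀ *: ♯ n₃ᶻ r
  T r = ♯ tab₃ (+ 0) (+ 4) (+ 4) r *: X₀ +: ♯ tab₃ (+ 0) (neg 3) (+ 3) r *: X₀ *: X₀ +: ♯ tab₃ (+ 0) (neg 1) (+ 1) r *: X₀ *: X₀ *: X₀ *: X₀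

  v R : Z3 → Z3 → Form
  v r s = ♯ tab₉ (+ 0) (+ 0) (+ 0) (+ 0) (+ 1) (+ 0) (+ 0) (+ 0) (neg 1) r s *: X₀ *: X₀ *: X₁
    +: ♯ tab₉ (+ 0) (+ 0) (+ 0) (+ 0) (+ 1) (+ 0) (+ 0) (+ 0) (neg 1) r s *: X₀ *: X₁ *: X₁
  R r s = ♯ tab₉ (+ 0) (+ 0) (+ 0) (+ 0) (+ 4) (+ 2) (+ 0) (+ 2) (+ 4) r s *: X₁
    +: ♯ tab₉ (+ 0) (+ 0) (+ 0) (+ 0) (+ 0) (+ 6) (+ 0) (neg 6) (+ 0) r s *: X₁ *: X₁
    +: ♯ tab₉ (+ 0) (neg 3) (+ 3) (+ 0) (neg 3) (neg 9) (+ 0) (+ 9) (+ 3) r s *: X₀ *: X₁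
    +: ♯ tab₉ (+ 0) (neg 3) (neg 3) (+ 0) (+ 3) (+ 9) (+ 0) (neg 9) (+ 3) r s *: X₀ *: X₁ *: X₁
    +: ♯ tab₉ (+ 0) (+ 3) (+ 3) (+ 0) (neg 3) (neg 9) (+ 0) (+ 9) (neg 3) r s *: X₀ *: X₀ *: X₁
    +: ♯ tab₉ (+ 0) (neg 3) (+ 3) (+ 0) (neg 3) (+ 3) (+ 0) (neg 3) (+ 3) r s *: X₀ *: X₀ *: X₁ *: X₁
    +: ♯ tab₉ (+ 0) (+ 2) (neg 2) (+ 0) (+ 2) (neg 2) (+ 0) (+ 2) (neg 2) r s *: X₀ *: X₀ *: X₀ *: X₁

  open OuterResidue (+ 18) f g v R T public using (convolution)

module d²χ-dc where
  f g Rˡ T : Z3 → Form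
  f r = ♯ χ₃ᶻ r *: X₀ *: X₀
  g r = ♯ c₃ᶻ r *: X₀
  Rˡ r = ♯ tab₃ (+ 0) (+ 1) (neg 1) r *: X₀ *: X₁
    +: ♯ tab₃ (+ 0) (neg 3) (+ 3) r *: X₀ *: X₁ *: X₁
    +: ♯ tab₃ (+ 0) (+ 3) (neg 3) r *: X₀ *: X₀ *: X₁
    +: ♯ tab₃ (+ 0) (neg 3) (+ 3) r *: X₀ *: X₀ *: X₁ *: X₁
    +: ♯ tab₃ (+ 0) (+ 2) (neg 2) r *: X₀ *: X₀ *: X₀ *: X₁
  T r = ♯ tab₃ (+ 0) (+ 1) (neg 1) r *: X₀ *: X₀ +: ♯ tab₃ (+ 0) (neg 1) (+ 1) r *: X₀ *: X₀ *: X₀ *: X₀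

  v Rʳ : Z3 → Z3 → Form
  v r s = ♯ tab₉ (+ 0) (+ 1) (neg 1) (+ 1) (neg 1) (+ 0) (neg 1) (+ 0) (+ 1) r s *: X₀ *: X₀ *: X₁
    +: ♯ tab₉ (+ 0) (+ 1) (neg 1) (+ 1) (neg 1) (+ 0) (neg 1) (+ 0) (+ 1) r s *: X₀ *: X₁ *: X₁
  -- Here `v′` vanishes on a = b for every pair of residues, so this side contributes nothing.
  Rʳ r s = ♯ + 0

  open InnerResidue (+ 6) f g v Rˡ Rʳ T public using (convolution)

-- Lambert series supported on multiples

sumFrom1-multiples : ∀ p n (g : ℕ → ℚ) → (∀ d → ¬ (suc p ∣ d) → g d ≡ 0ℚ) → sumFrom1 (n ℕ.* suc p) g ≡ sumFrom1 n (λ k → g (k ℕ.* suc p))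
sumFrom1-multiples p zero g e = refl
sumFrom1-multiples p (suc n) g e = trans (sumFrom1-split (n ℕ.* suc p) (suc p) g)
  (cong₂ _+_ (sumFrom1-multiples p n g e)
    (trans (cong (_+ g (suc p ℕ.+ n ℕ.* suc p)) (sumFrom1-0 p (λ i 1≤i i≤p → e (i ℕ.+ n ℕ.* suc p) (λ div → ℕP.<-irrefl refl
      (ℕP.<-≤-trans (s≤s i≤p) (∣⇒≤ {{ℕ.>-nonZero 1≤i}} (∣m+n∣m⇒∣n (subst (suc p ∣_) (ℕP.+-comm i (n ℕ.* suc p)) div) (n∣m*n n))))))))
     (ℚP.+-identityˡ _)))

-- The factor p stays in the constraint: d e p = n after the substitution d ↦ d p.
Lam-multiples : ∀ p n f → (∀ d e → d ℕ.* e ≡ n → ¬ (suc p ∣ d) → f d e ≡ 0ℚ) →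
  Lam f n ≡ sum² n (λ d e → δ (d ℕ.* e ℕ.* suc p) n · f (d ℕ.* suc p) e)
Lam-multiples p n f z = begin
  Lam f n
    ≡⟨ Lam-bound f (ℕP.m≤m*n n (suc p)) ⟩
  sum² (n ℕ.* suc p) (λ d e → δ (d ℕ.* e) n · f d e)
    ≡⟨ sumFrom1-multiples p n (λ d → sumFrom1 (n ℕ.* suc p) (λ e → δ (d ℕ.* e) n · f d e))
         (λ d p∤d → sumFrom1-0 (n ℕ.* suc p) (λ e _ _ → trans (δ-· (d ℕ.* e) n (λ de≡n → z d e de≡n p∤d)) (ℚP.*-zeroʳ (δ (d ℕ.* e) n)))) ⟩
  sumFrom1 n (λ d → sumFrom1 (n ℕ.* suc p) (λ e → δ (d ℕ.* suc p ℕ.* e) n · f (d ℕ.* suc p) e))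
    ≡⟨ sumFrom1-cong n (λ d 1≤d _ → trans
         (sumFrom1-extend (λ e → δ (d ℕ.* suc p ℕ.* e) n · f (d ℕ.* suc p) e) (ℕP.m≤m*n n (suc p))
           (λ e n<e → zero-· _ (δ-> (d ℕ.* suc p ℕ.* e) n (ℕP.<-≤-trans n<e (m≤n*m′ e (ℕP.≤-trans 1≤d (ℕP.m≤m*n d (suc p))))))))
         (sumFrom1-cong n (λ e _ _ → cong (λ m → δ m n · f (d ℕ.* suc p) e)
           (trans (ℕP.*-assoc d (suc p) e) (trans (cong (d ℕ.*_) (ℕP.*-comm (suc p) e)) (sym (ℕP.*-assoc d e (suc p)))))))) ⟩
  sum² n (λ d e → δ (d ℕ.* e ℕ.* suc p) n · f (d ℕ.* suc p) e) ∎
  where open ≡-Reasoning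

Lam-multiplesʳ : ∀ p n f → (∀ d e → d ℕ.* e ≡ n → ¬ (suc p ∣ e) → f d e ≡ 0ℚ) →
  Lam f n ≡ sum² n (λ d e → δ (d ℕ.* e ℕ.* suc p) n · f d (e ℕ.* suc p))
Lam-multiplesʳ p n f z = trans (at (Lam-flip f) n) (trans
  (Lam-multiples p n (λ d e → f e d) (λ d e de≡n → z e d (trans (ℕP.*-comm e d) de≡n)))
  (trans (sum²-swap n (λ d e → δ (d ℕ.* e ℕ.* suc p) n · f e (d ℕ.* suc p)))
    (sum²-cong n (λ d e _ _ → cong (λ m → δ (m ℕ.* suc p) n · f d (e ℕ.* suc p)) (ℕP.*-comm e d)))))

res-*3 : ∀ k → res (k ℕ.* 3) ≡ r0
res-*3 zero = refl
res-*3 (suc k) rewrite res-*3 k = refl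

d₃-∤ : ∀ d → ¬ (3 ∣ d) → d₃ᶻ (res d) ≡ + 0
d₃-∤ zero 3∤d = ⊥-elim (3∤d (3 ∣0))
d₃-∤ (suc zero) 3∤d = refl
d₃-∤ (suc (suc zero)) 3∤d = refl
d₃-∤ (suc (suc (suc d))) 3∤d = trans (cong d₃ᶻ (succ₃³ (res d))) (d₃-∤ d (λ 3∣d → 3∤d (∣m∣n⇒∣m+n ∣-refl 3∣d)))

-- Moving a factor 3 from the cofactor to the divisor preserves d e and multiplies the weight d by
-- 3. Both sides are therefore sums over the constraint 3 d e = n.
triple : Lam (λ d e → ι (d₃ᶻ (res d)) · nat d) ≈ K (+ 3) *ₛ Lam (λ d e → ι (d₃ᶻ (res e)) · nat d)
triple .at n = begin
  Lam (λ d e → ι (d₃ᶻ (res d)) · nat d) n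
    ≡⟨ Lam-multiples 2 n _ (λ d e _ 3∤d → zero-· (nat d) (trans (cong ι (d₃-∤ d 3∤d)) ι-0)) ⟩
  sum² n (λ d e → δ (d ℕ.* e ℕ.* 3) n · (ι (d₃ᶻ (res (d ℕ.* 3))) · nat (d ℕ.* 3)))
    ≡⟨ sum²-cong n (λ d e _ _ → trans
         (cong₂ (λ r y → δ (d ℕ.* e ℕ.* 3) n · (ι (d₃ᶻ r) · y)) (trans (res-*3 d) (sym (res-*3 e))) (nat-* d 3))
         (solveℚ 4 (λ x y z w → x ⟨·⟩ (y ⟨·⟩ (z ⟨·⟩ w)) ⟨=⟩ w ⟨·⟩ (x ⟨·⟩ (y ⟨·⟩ z))) refl
           (δ (d ℕ.* e ℕ.* 3) n) (ι (d₃ᶻ (res (e ℕ.* 3)))) (nat d) (nat 3))) ⟩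
  sum² n (λ d e → nat 3 · (δ (d ℕ.* e ℕ.* 3) n · (ι (d₃ᶻ (res (e ℕ.* 3))) · nat d)))
    ≡⟨ sum²-·ˡ n (nat 3) (λ d e → δ (d ℕ.* e ℕ.* 3) n · (ι (d₃ᶻ (res (e ℕ.* 3))) · nat d)) ⟩
  nat 3 · sum² n (λ d e → δ (d ℕ.* e ℕ.* 3) n · (ι (d₃ᶻ (res (e ℕ.* 3))) · nat d))
    ≡⟨ cong (λ z → nat 3 · z) (sym (Lam-multiplesʳ 2 n (λ d e → ι (d₃ᶻ (res e)) · nat d)
         (λ d e _ 3∤e → zero-· (nat d) (trans (cong ι (d₃-∤ e 3∤e)) ι-0)))) ⟩
  nat 3 · Lam (λ d e → ι (d₃ᶻ (res e)) · nat d) n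
    ≡⟨ sym (K-*ₛ (+ 3) _ n) ⟩
  (K (+ 3) *ₛ Lam (λ d e → ι (d₃ᶻ (res e)) · nat d)) n ∎
  where open ≡-Reasoning

Lam-linear : ∀ c₁ c₂ c₃ c₄ f₁ f₂ f₃ f₄ →
  K c₁ *ₛ Lam f₁ +ₛ K c₂ *ₛ Lam f₂ +ₛ K c₃ *ₛ Lam f₃ +ₛ K c₄ *ₛ Lam f₄
    ≈ Lam (λ d e → ι c₁ · f₁ d e + ι c₂ · f₂ d e + ι c₃ · f₃ d e + ι c₄ · f₄ d e)
Lam-linear c₁ c₂ c₃ c₄ f₁ f₂ f₃ f₄ = ≈-sym (≈-trans (Lam-+ _ _) (+ₛ-cong (≈-trans (Lam-+ _ _)
  (+ₛ-cong (≈-trans (Lam-+ _ _) (+ₛ-cong (Lam-K c₁ f₁) (Lam-K c₂ f₂))) (Lam-K c₃ f₃))) (Lam-K c₄ f₄)))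

-- The level 3 series: aS is the theta function of the hexagonal lattice, βS and γS are its cubes b³ and c³,
-- AS is the logarithmic derivative of u, and (P−A, P+A) = (PmS, PpS) with P = (E₂(q) + 3 E₂(q³)) / 4.

Lχ Lχ′ Ld Ldn Ldn′ Ldc Ldc′ Ld8c Ld²χ Ld²χ′ Ld⁴χ Ld⁴χ′ : PS
Lχ = Lam (λ d e → ι (χ₃ᶻ (res d)))
Lχ′ = Lam (λ d e → ι (χ₃ᶻ (res e)))
Ld = Lam (λ d e → nat d)
Ldn = Lam (λ d e → nat d · ι (n₃ᶻ (res d)))
Ldn′ = Lam (λ d e → nat d · ι (n₃ᶻ (res e)))
Ldc = Lam (λ d e → ι (c₃ᶻ (res d)) · nat d)
Ldc′ = Lam (λ d e → ι (c₃ᶻ (res e)) · nat d)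
Ld8c = Lam (λ d e → (ι (+ 8) - ι (c₃ᶻ (res d))) · nat d)
Ld²χ = Lam (λ d e → ι (χ₃ᶻ (res d)) · nat d · nat d)
Ld²χ′ = Lam (λ d e → ι (χ₃ᶻ (res e)) · nat d · nat d)
Ld⁴χ = Lam (λ d e → ι (χ₃ᶻ (res d)) · nat d · nat d · nat d · nat d)
Ld⁴χ′ = Lam (λ d e → ι (χ₃ᶻ (res e)) · nat d · nat d · nat d · nat d)

aS AS PmS PpS βS γS : PS
aS = K (+ 1) +ₛ K (+ 6) *ₛ Lχ
AS = K (+ 1) +ₛ K (+ 12) *ₛ Ldn
PmS = K (neg 2) *ₛ Ld8c
PpS = K (+ 2) +ₛ K (neg 6) *ₛ Ldc
βS = K (+ 1) +ₛ K (neg 9) *ₛ Ld²χ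
γS = K (+ 27) *ₛ Ld²χ′

Lam-combine : ∀ c₁ c₂ c₃ c₄ {f₁ f₂ f₃ f₄ g} →
  (∀ d e → ι c₁ · f₁ d e + ι c₂ · f₂ d e + ι c₃ · f₃ d e + ι c₄ · f₄ d e ≡ g d e) →
  K c₁ *ₛ Lam f₁ +ₛ K c₂ *ₛ Lam f₂ +ₛ K c₃ *ₛ Lam f₃ +ₛ K c₄ *ₛ Lam f₄ ≈ Lam g
Lam-combine c₁ c₂ c₃ c₄ {f₁} {f₂} {f₃} {f₄} e =
  ≈-trans (Lam-linear c₁ c₂ c₃ c₄ f₁ f₂ f₃ f₄) (Lam-cong (λ d d′ _ _ → e d d′))

θ-affine : ∀ c d f → θ (K c +ₛ K d *ₛ f) ≈ K d *ₛ θ f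
θ-affine c d f = ≈-trans (θ-+ₛ (K c) (K d *ₛ f)) (≈-trans (+ₛ-cong (≈-trans (θ-cong (≡⇒≈ (K-def c))) (θ-const (ι c))) (θ-K d f))
  (PSR.+-identityˡ (K d *ₛ θ f)))

Ldz′ : PS
Ldz′ = Lam (λ d e → ι (d₃ᶻ (res e)) · nat d)

module _ (c₁ c₂ : ℤ) {f₁ f₂ g : ℕ → ℕ → ℚ} where
  Lam-combine₂ : (∀ d e → ι c₁ · f₁ d e + ι c₂ · f₂ d e ≡ g d e) → K c₁ *ₛ Lam f₁ +ₛ K c₂ *ₛ Lam f₂ ≈ Lam g
  Lam-combine₂ e = ≈-trans (+ₛ-cong (≈-sym (Lam-K c₁ f₁)) (≈-sym (Lam-K c₂ f₂)))
    (≈-trans (≈-sym (Lam-+ _ _)) (Lam-cong (λ d d′ _ _ → e d d′)))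

-- Up to scale, `Ld` and `Ldz′` are the nonconstant parts of E₂(q) and E₂(q³). In terms of these
-- two, a weight 2 series with residues on d can be rewritten with residues on e, as the inner
-- convolutions require.
Ldn-split : Ldn ≈ Ld -ₛ K (+ 3) *ₛ Ldz′
Ldn-split = ≈-trans (≈-sym (Lam-combine₂ (+ 1) (neg 1) (λ d e →
    check₃ (λ r → ♯ + 1 *: X₀ +: ♯ (neg 1) *: (♯ d₃ᶻ r *: X₀)) (λ r → X₀ *: ♯ n₃ᶻ r) (res d) (nat d) (nat e))))
  (≈-trans (+ₛ-congˡ (*ₛ-congˡ triple))
  (solve 2 (λ x z → # 1 :* x :+ con (neg 1) :* (# 3 :* z) := x :- # 3 :* z) ≈-refl Ld Ldz′))

Ldn′-split : Ldn′ ≈ Ld -ₛ Ldz′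
Ldn′-split = ≈-trans (≈-sym (Lam-combine₂ (+ 1) (neg 1) (λ d e →
    check₃ (λ r → ♯ + 1 *: X₀ +: ♯ (neg 1) *: (♯ d₃ᶻ r *: X₀)) (λ r → X₀ *: ♯ n₃ᶻ r) (res e) (nat d) (nat e))))
  (solve 2 (λ x z → # 1 :* x :+ con (neg 1) :* z := x :- z) ≈-refl Ld Ldz′)

Ldc′-split : Ldc′ ≈ K (+ 3) *ₛ Ldz′ -ₛ Ld
Ldc′-split = ≈-trans (≈-sym (Lam-combine₂ (+ 3) (neg 1) (λ d e →
    check₃ (λ r → ♯ + 3 *: (♯ d₃ᶻ r *: X₀) +: ♯ (neg 1) *: X₀) (λ r → ♯ c₃ᶻ r *: X₀) (res e) (nat d) (nat e))))
  (solve 2 (λ x z → # 3 :* z :+ con (neg 1) :* x := # 3 :* z :- x) ≈-refl Ld Ldz′)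

Ld8c-split : Ld8c ≈ K (+ 9) *ₛ Ld -ₛ K (+ 9) *ₛ Ldz′
Ld8c-split = ≈-trans (≈-sym (Lam-combine₂ (+ 9) (neg 3) (λ d e →
    check₃ (λ r → ♯ + 9 *: X₀ +: ♯ (neg 3) *: (♯ d₃ᶻ r *: X₀)) (λ r → (♯ + 8 -: ♯ c₃ᶻ r) *: X₀) (res d) (nat d) (nat e))))
  (≈-trans (+ₛ-congˡ (*ₛ-congˡ triple))
  (solve 2 (λ x z → # 9 :* x :+ con (neg 3) :* (# 3 :* z) := # 9 :* x :- # 9 :* z) ≈-refl Ld Ldz′))

Lχ-flip : Lχ ≈ Lχ′
Lχ-flip = Lam-flip _

-- The convolution of χ₃ with itself yields coefficients e n₃(d) and d only; exchanging divisor and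
-- cofactor brings them to E₂(q) and E₂(q³), and the result is (3 E₂(q³) - E₂(q))/2.
a² : aS *ₛ aS ≈ AS
a² = begin
  aS *ₛ aS
    ≈⟨ solve 1 (λ x → (# 1 :+ # 6 :* x) :* (# 1 :+ # 6 :* x)
         := # 1 :+ (# 12 :* x :+ # 6 :* (# 3 :* (x :* x :+ x :* x)))) ≈-refl Lχ ⟩
  K (+ 1) +ₛ (K (+ 12) *ₛ Lχ +ₛ K (+ 6) *ₛ (K (+ 3) *ₛ (Lχ *ₛ Lχ +ₛ Lχ *ₛ Lχ)))
    ≈⟨ +ₛ-congˡ (+ₛ-congˡ (*ₛ-congˡ χχ.convolution)) ⟩
  K (+ 1) +ₛ (K (+ 12) *ₛ Lχ +ₛ K (+ 6) *ₛ Lam (λ d e → ev (χχ.T (res d)) (nat d) (nat e)))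
    ≈⟨ +ₛ-congˡ (Lam-combine₂ (+ 12) (+ 6) {g = λ d e → ι (+ 36) · (nat e · ι (n₃ᶻ (res d))) + ι (neg 24) · nat d} (λ d e →
         check₃ (λ r → ♯ + 12 *: ♯ χ₃ᶻ r +: ♯ + 6 *: χχ.T r)
                (λ r → ♯ + 36 *: (X₁ *: ♯ n₃ᶻ r) +: ♯ (neg 24) *: X₀) (res d) (nat d) (nat e))) ⟩
  K (+ 1) +ₛ Lam (λ d e → ι (+ 36) · (nat e · ι (n₃ᶻ (res d))) + ι (neg 24) · nat d)
    ≈⟨ +ₛ-congˡ (≈-trans (Lam-+ _ _) (+ₛ-cong (≈-trans (Lam-K (+ 36) _) (*ₛ-congˡ (Lam-flip _))) (Lam-K (neg 24) _))) ⟩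
  K (+ 1) +ₛ (K (+ 36) *ₛ Ldn′ +ₛ K (neg 24) *ₛ Ld)
    ≈⟨ +ₛ-congˡ (+ₛ-congʳ (*ₛ-congˡ Ldn′-split)) ⟩
  K (+ 1) +ₛ (K (+ 36) *ₛ (Ld -ₛ Ldz′) +ₛ K (neg 24) *ₛ Ld)
    ≈⟨ solve 2 (λ x z → # 1 :+ (# 36 :* (x :- z) :+ con (neg 24) :* x) := # 1 :+ # 12 :* (x :- # 3 :* z)) ≈-refl Ld Ldz′ ⟩
  K (+ 1) +ₛ K (+ 12) *ₛ (Ld -ₛ K (+ 3) *ₛ Ldz′)
    ≈⟨ +ₛ-congˡ (*ₛ-congˡ (≈-sym Ldn-split)) ⟩
  AS ∎
  where open ≈-Reasoning

Pp-Pm : PpS ≈ PmS +ₛ K (+ 2) *ₛ AS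
Pp-Pm = begin
  K (+ 2) +ₛ K (neg 6) *ₛ Ldc
    ≈⟨ +ₛ-congˡ (≈-trans (≈-sym (Lam-K (neg 6) _)) (≈-sym (Lam-combine₂ (neg 2) (+ 24) (λ d e →
         check₃ (λ r → ♯ (neg 2) *: ((♯ + 8 -: ♯ c₃ᶻ r) *: X₀) +: ♯ + 24 *: (X₀ *: ♯ n₃ᶻ r))
                (λ r → ♯ (neg 6) *: (♯ c₃ᶻ r *: X₀)) (res d) (nat d) (nat e))))) ⟩
  K (+ 2) +ₛ (K (neg 2) *ₛ Ld8c +ₛ K (+ 24) *ₛ Ldn)
    ≈⟨ solve 2 (λ x y → # 2 :+ (con (neg 2) :* x :+ # 24 :* y) := con (neg 2) :* x :+ # 2 :* (# 1 :+ # 12 :* y)) ≈-refl Ld8c Ldn ⟩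
  PmS +ₛ K (+ 2) *ₛ AS ∎
  where open ≈-Reasoning

-- The convolution of χ₃(d) with d c₃(d) contains the coefficient d e χ₃(d), which is that of θ
-- applied to `Lχ`. Solving for this term gives the derivative; the other derivative formulas arise
-- in the same way.
θa-∞ : K (+ 6) *ₛ θ aS ≈ aS *ₛ PpS -ₛ K (+ 2) *ₛ βS
θa-∞ = begin
  K (+ 6) *ₛ θ aS
    ≈⟨ *ₛ-congˡ (≈-trans (θ-affine (+ 1) (+ 6) Lχ) (*ₛ-congˡ (θ-Lam _))) ⟩
  K (+ 6) *ₛ (K (+ 6) *ₛ Lam (λ d e → nat d · nat e · ι (χ₃ᶻ (res d))))
    ≈⟨ solve 1 (λ x → # 6 :* (# 6 :* x) := # 36 :* x) ≈-refl _ ⟩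
  K (+ 36) *ₛ Lam (λ d e → nat d · nat e · ι (χ₃ᶻ (res d)))
    ≈⟨ ≈-trans (≈-sym (Lam-K (+ 36) _)) (≈-sym (Lam-combine (neg 6) (+ 12) (neg 6) (+ 18) (λ d e →
         check₃ (λ r → ♯ (neg 6) *: (♯ c₃ᶻ r *: X₀) +: ♯ + 12 *: ♯ χ₃ᶻ r +: ♯ (neg 6) *: χ-dc.T r
                        +: ♯ + 18 *: (♯ χ₃ᶻ r *: X₀ *: X₀))
                (λ r → ♯ + 36 *: (X₀ *: X₁ *: ♯ χ₃ᶻ r)) (res d) (nat d) (nat e)))) ⟩
  K (neg 6) *ₛ Ldc +ₛ K (+ 12) *ₛ Lχ +ₛ K (neg 6) *ₛ Lam (λ d e → ev (χ-dc.T (res d)) (nat d) (nat e)) +ₛ K (+ 18) *ₛ Ld²χ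
    ≈⟨ +ₛ-congʳ (+ₛ-congˡ (*ₛ-congˡ (≈-sym χ-dc.convolution))) ⟩
  K (neg 6) *ₛ Ldc +ₛ K (+ 12) *ₛ Lχ +ₛ K (neg 6) *ₛ (K (+ 3) *ₛ (Lχ *ₛ Ldc +ₛ Lχ *ₛ Ldc)) +ₛ K (+ 18) *ₛ Ld²χ
    ≈⟨ solve 3 (λ x y w → con (neg 6) :* y :+ # 12 :* x :+ con (neg 6) :* (# 3 :* (x :* y :+ x :* y)) :+ # 18 :* w
         := (# 1 :+ # 6 :* x) :* (# 2 :+ con (neg 6) :* y) :- # 2 :* (# 1 :+ con (neg 9) :* w)) ≈-refl Lχ Ldc Ld²χ ⟩
  aS *ₛ PpS -ₛ K (+ 2) *ₛ βS ∎
  where open ≈-Reasoning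

Pm-inner : PmS ≈ K (neg 18) *ₛ Ldn′
Pm-inner = ≈-trans (*ₛ-congˡ Ld8c-split) (≈-trans
  (solve 2 (λ x z → con (neg 2) :* (# 9 :* x :- # 9 :* z) := con (neg 18) :* (x :- z)) ≈-refl Ld Ldz′)
  (*ₛ-congˡ (≈-sym Ldn′-split)))

-- The counterpart of `θa-∞` at the cusp 0: the Fricke involution exchanges β with γ and P + A with
-- P - A. On the level of coefficients it corresponds to moving the residues from divisors to
-- cofactors, hence an inner convolution.
θa-0 : K (+ 6) *ₛ θ aS ≈ aS *ₛ PmS +ₛ K (+ 2) *ₛ γS
θa-0 = begin
  K (+ 6) *ₛ θ aS
    ≈⟨ *ₛ-congˡ (≈-trans (θ-affine (+ 1) (+ 6) Lχ) (*ₛ-congˡ (≈-trans (θ-cong Lχ-flip) (θ-Lam _)))) ⟩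
  K (+ 6) *ₛ (K (+ 6) *ₛ Lam (λ d e → nat d · nat e · ι (χ₃ᶻ (res e))))
    ≈⟨ solve 1 (λ x → # 6 :* (# 6 :* x) := # 36 :* x) ≈-refl _ ⟩
  K (+ 36) *ₛ Lam (λ d e → nat d · nat e · ι (χ₃ᶻ (res e)))
    ≈⟨ ≈-trans (≈-sym (Lam-K (+ 36) _)) (≈-sym (Lam-combine (neg 18) (+ 0) (neg 18) (+ 54) (λ d e →
         check₃ (λ r → ♯ (neg 18) *: (X₀ *: ♯ n₃ᶻ r) +: ♯ + 0 *: ♯ χ₃ᶻ r +: ♯ (neg 18) *: χ-dn.T r
                        +: ♯ + 54 *: (♯ χ₃ᶻ r *: X₀ *: X₀))
                (λ r → ♯ + 36 *: (X₀ *: X₁ *: ♯ χ₃ᶻ r)) (res e) (nat d) (nat e)))) ⟩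
  K (neg 18) *ₛ Ldn′ +ₛ K (+ 0) *ₛ Lχ′ +ₛ K (neg 18) *ₛ Lam (λ d e → ev (χ-dn.T (res e)) (nat d) (nat e)) +ₛ K (+ 54) *ₛ Ld²χ′
    ≈⟨ +ₛ-congʳ (+ₛ-congˡ (*ₛ-congˡ (≈-sym χ-dn.convolution))) ⟩
  K (neg 18) *ₛ Ldn′ +ₛ K (+ 0) *ₛ Lχ′ +ₛ K (neg 18) *ₛ (K (+ 3) *ₛ (Lχ′ *ₛ Ldn′ +ₛ Lχ′ *ₛ Ldn′)) +ₛ K (+ 54) *ₛ Ld²χ′
    ≈⟨ solve 3 (λ x y w → con (neg 18) :* y :+ # 0 :* x :+ con (neg 18) :* (# 3 :* (x :* y :+ x :* y)) :+ # 54 :* w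
         := (# 1 :+ # 6 :* x) :* (con (neg 18) :* y) :+ # 2 :* (# 27 :* w)) ≈-refl Lχ′ Ldn′ Ld²χ′ ⟩
  (K (+ 1) +ₛ K (+ 6) *ₛ Lχ′) *ₛ (K (neg 18) *ₛ Ldn′) +ₛ K (+ 2) *ₛ γS
    ≈⟨ +ₛ-congʳ (*ₛ-cong (+ₛ-congˡ (*ₛ-congˡ (≈-sym Lχ-flip))) (≈-sym Pm-inner)) ⟩
  aS *ₛ PmS +ₛ K (+ 2) *ₛ γS ∎
  where open ≈-Reasoning

-- The level 3 analogue of Ramanujan's formula for the derivative of E₂, that is 6 θP = P² - A², in
-- factored form.
θPm+θPp : K (+ 3) *ₛ (θ PmS +ₛ θ PpS) ≈ PmS *ₛ PpS
θPm+θPp = begin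
  K (+ 3) *ₛ (θ PmS +ₛ θ PpS)
    ≈⟨ *ₛ-congˡ (+ₛ-cong (≈-trans (θ-K (neg 2) Ld8c) (*ₛ-congˡ (θ-Lam _))) (≈-trans (θ-affine (+ 2) (neg 6) Ldc) (*ₛ-congˡ (θ-Lam _)))) ⟩
  K (+ 3) *ₛ (K (neg 2) *ₛ Lam (λ d e → nat d · nat e · ((ι (+ 8) - ι (c₃ᶻ (res d))) · nat d)) +ₛ K (neg 6) *ₛ Lam (λ d e → nat d · nat e · (ι (c₃ᶻ (res d)) · nat d)))
    ≈⟨ *ₛ-congˡ (Lam-combine₂ (neg 2) (neg 6) {g = λ d e → nat d · nat e · ((ι (neg 16) - ι (+ 4) · ι (c₃ᶻ (res d))) · nat d)} (λ d e →
         check₃ (λ r → ♯ (neg 2) *: (X₀ *: X₁ *: ((♯ + 8 -: ♯ c₃ᶻ r) *: X₀)) +: ♯ (neg 6) *: (X₀ *: X₁ *: (♯ c₃ᶻ r *: X₀)))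
                (λ r → X₀ *: X₁ *: ((♯ (neg 16) -: ♯ + 4 *: ♯ c₃ᶻ r) *: X₀)) (res d) (nat d) (nat e))) ⟩
  K (+ 3) *ₛ Lam (λ d e → nat d · nat e · ((ι (neg 16) - ι (+ 4) · ι (c₃ᶻ (res d))) · nat d))
    ≈⟨ ≈-trans (≈-sym (Lam-K (+ 3) _)) (≈-sym (Lam-combine₂ (neg 4) (+ 2) (λ d e →
         check₃ (λ r → ♯ (neg 4) *: ((♯ + 8 -: ♯ c₃ᶻ r) *: X₀) +: ♯ + 2 *: d8c-dc.T r)
                (λ r → ♯ + 3 *: (X₀ *: X₁ *: ((♯ (neg 16) -: ♯ + 4 *: ♯ c₃ᶻ r) *: X₀))) (res d) (nat d) (nat e)))) ⟩
  K (neg 4) *ₛ Ld8c +ₛ K (+ 2) *ₛ Lam (λ d e → ev (d8c-dc.T (res d)) (nat d) (nat e))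
    ≈⟨ +ₛ-congˡ (*ₛ-congˡ (≈-sym d8c-dc.convolution)) ⟩
  K (neg 4) *ₛ Ld8c +ₛ K (+ 2) *ₛ (K (+ 3) *ₛ (Ld8c *ₛ Ldc +ₛ Ld8c *ₛ Ldc))
    ≈⟨ solve 2 (λ x y → con (neg 4) :* x :+ # 2 :* (# 3 :* (x :* y :+ x :* y)) := (con (neg 2) :* x) :* (# 2 :+ con (neg 6) :* y)) ≈-refl Ld8c Ldc ⟩
  PmS *ₛ PpS ∎
  where open ≈-Reasoning

-- This is the logarithmic derivative P-/2 = 3 (E₂(q) - E₂(q³))/8 of η(q)⁹/η(q³)³, the product known
-- for β, here obtained from the Lambert series.
θβ : K (+ 2) *ₛ θ βS ≈ βS *ₛ PmS
θβ = begin
  K (+ 2) *ₛ θ βS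
    ≈⟨ *ₛ-congˡ (≈-trans (θ-affine (+ 1) (neg 9) Ld²χ) (*ₛ-congˡ (θ-Lam _))) ⟩
  K (+ 2) *ₛ (K (neg 9) *ₛ Lam (λ d e → nat d · nat e · (ι (χ₃ᶻ (res d)) · nat d · nat d)))
    ≈⟨ solve 1 (λ x → # 2 :* (con (neg 9) :* x) := con (neg 18) :* x) ≈-refl _ ⟩
  K (neg 18) *ₛ Lam (λ d e → nat d · nat e · (ι (χ₃ᶻ (res d)) · nat d · nat d))
    ≈⟨ ≈-trans (≈-sym (Lam-K (neg 18) _)) (≈-sym (Lam-combine₂ (neg 2) (+ 3) (λ d e →
         check₃ (λ r → ♯ (neg 2) *: ((♯ + 8 -: ♯ c₃ᶻ r) *: X₀) +: ♯ + 3 *: d²χ-d8c.T r)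
                (λ r → ♯ (neg 18) *: (X₀ *: X₁ *: (♯ χ₃ᶻ r *: X₀ *: X₀))) (res d) (nat d) (nat e)))) ⟩
  K (neg 2) *ₛ Ld8c +ₛ K (+ 3) *ₛ Lam (λ d e → ev (d²χ-d8c.T (res d)) (nat d) (nat e))
    ≈⟨ +ₛ-congˡ (*ₛ-congˡ (≈-sym d²χ-d8c.convolution)) ⟩
  K (neg 2) *ₛ Ld8c +ₛ K (+ 3) *ₛ (K (+ 3) *ₛ (Ld²χ *ₛ Ld8c +ₛ Ld²χ *ₛ Ld8c))
    ≈⟨ solve 2 (λ x y → con (neg 2) :* y :+ # 3 :* (# 3 :* (x :* y :+ x :* y)) := (# 1 :+ con (neg 9) :* x) :* (con (neg 2) :* y)) ≈-refl Ld²χ Ld8c ⟩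
  βS *ₛ PmS ∎
  where open ≈-Reasoning

-- A weight 5 Eisenstein series with character χ₃; `Aγ` gives its companion with the character on
-- the cofactor. Together they place `Cmix` in the ring generated by a, β and γ.
Aβ : AS *ₛ βS ≈ K (+ 1) +ₛ K (+ 3) *ₛ Ld⁴χ
Aβ = begin
  AS *ₛ βS
    -- The summand with coefficient 0 fills the fourth slot of `Lam-combine`; -3 · 36 = -108 matches
    -- the cross term 12 · (-9).
    ≈⟨ solve 2 (λ x y → (# 1 :+ # 12 :* y) :* (# 1 :+ con (neg 9) :* x)
         := # 1 :+ (# 12 :* y :+ con (neg 9) :* x :+ con (neg 3) :* (# 18 :* (x :* y :+ x :* y)) :+ # 0 :* x)) ≈-refl Ld²χ Ldn ⟩
  K (+ 1) +ₛ (K (+ 12) *ₛ Ldn +ₛ K (neg 9) *ₛ Ld²χ +ₛ K (neg 3) *ₛ (K (+ 18) *ₛ (Ld²χ *ₛ Ldn +ₛ Ld²χ *ₛ Ldn)) +ₛ K (+ 0) *ₛ Ld²χ)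
    ≈⟨ +ₛ-congˡ (+ₛ-congʳ (+ₛ-congˡ (*ₛ-congˡ d²χ-dn.convolution))) ⟩
  K (+ 1) +ₛ (K (+ 12) *ₛ Ldn +ₛ K (neg 9) *ₛ Ld²χ +ₛ K (neg 3) *ₛ Lam (λ d e → ev (d²χ-dn.T (res d)) (nat d) (nat e)) +ₛ K (+ 0) *ₛ Ld²χ)
    ≈⟨ +ₛ-congˡ (≈-trans (Lam-combine (+ 12) (neg 9) (neg 3) (+ 0) (λ d e →
         check₃ (λ r → ♯ + 12 *: (X₀ *: ♯ n₃ᶻ r) +: ♯ (neg 9) *: (♯ χ₃ᶻ r *: X₀ *: X₀) +: ♯ (neg 3) *: d²χ-dn.T r
                        +: ♯ + 0 *: (♯ χ₃ᶻ r *: X₀ *: X₀))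
                (λ r → ♯ + 3 *: (♯ χ₃ᶻ r *: X₀ *: X₀ *: X₀ *: X₀)) (res d) (nat d) (nat e))) (Lam-K (+ 3) _)) ⟩
  K (+ 1) +ₛ K (+ 3) *ₛ Ld⁴χ ∎
  where open ≈-Reasoning

A-inner : AS ≈ K (+ 1) +ₛ K (neg 12) *ₛ Ldc′
A-inner = ≈-trans (+ₛ-congˡ (*ₛ-congˡ Ldn-split)) (≈-trans
  (solve 2 (λ x z → # 1 :+ # 12 :* (x :- # 3 :* z) := # 1 :+ con (neg 12) :* (# 3 :* z :- x)) ≈-refl Ld Ldz′)
  (+ₛ-congˡ (*ₛ-congˡ (≈-sym Ldc′-split))))

Aγ : AS *ₛ γS ≈ K (+ 27) *ₛ Ld⁴χ′
Aγ = begin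
  AS *ₛ γS
    ≈⟨ *ₛ-congʳ A-inner ⟩
  (K (+ 1) +ₛ K (neg 12) *ₛ Ldc′) *ₛ (K (+ 27) *ₛ Ld²χ′)
    ≈⟨ solve 2 (λ x y → (# 1 :+ con (neg 12) :* y) :* (# 27 :* x) := # 27 :* x :+ con (neg 27) :* (# 6 :* (x :* y :+ x :* y))) ≈-refl Ld²χ′ Ldc′ ⟩
  K (+ 27) *ₛ Ld²χ′ +ₛ K (neg 27) *ₛ (K (+ 6) *ₛ (Ld²χ′ *ₛ Ldc′ +ₛ Ld²χ′ *ₛ Ldc′))
    ≈⟨ +ₛ-congˡ (*ₛ-congˡ d²χ-dc.convolution) ⟩
  K (+ 27) *ₛ Ld²χ′ +ₛ K (neg 27) *ₛ Lam (λ d e → ev (d²χ-dc.T (res e)) (nat d) (nat e))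
    ≈⟨ ≈-trans (Lam-combine₂ (+ 27) (neg 27) (λ d e →
         check₃ (λ r → ♯ + 27 *: (♯ χ₃ᶻ r *: X₀ *: X₀) +: ♯ (neg 27) *: d²χ-dc.T r)
                (λ r → ♯ + 27 *: (♯ χ₃ᶻ r *: X₀ *: X₀ *: X₀ *: X₀)) (res e) (nat d) (nat e))) (Lam-K (+ 27) _) ⟩
  K (+ 27) *ₛ Ld⁴χ′ ∎
  where open ≈-Reasoning

-- The eta quotient

K-suc-cancel : ∀ n {f g} → K (+ suc n) *ₛ f ≈ K (+ suc n) *ₛ g → f ≈ g
K-suc-cancel n {f} {g} e .at m = nat-suc-cancel n (trans (sym (K-*ₛ (+ suc n) f m)) (trans (at e m) (K-*ₛ (+ suc n) g m)))

LogDerivative : PS → PS → Set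
LogDerivative f l = θ f ≈ f *ₛ l

logDerivative-one : LogDerivative oneS (K (+ 0))
logDerivative-one = ≈-trans θ-one (≈-trans (≈-sym K-0) (≈-sym (PSR.*-identityˡ (K (+ 0)))))

logDerivative-* : ∀ {f g l m} → LogDerivative f l → LogDerivative g m → LogDerivative (f *ₛ g) (l +ₛ m)
logDerivative-* {f} {g} {l} {m} d e = ≈-trans (θ-*ₛ f g) (≈-trans (+ₛ-cong (*ₛ-congʳ d) (*ₛ-congˡ e))
  (solve 4 (λ f g l m → f :* l :* g :+ f :* (g :* m) := f :* g :* (l :+ m)) ≈-refl f g l m))

logDerivative-^ : ∀ {f l} n → LogDerivative f l → LogDerivative (f ^ₛ n) (K (+ n) *ₛ l)
logDerivative-^ {f} {l} zero d = ≈-trans logDerivative-one (*ₛ-congˡ (solve 1 (λ l → # 0 := # 0 :* l) ≈-refl l))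
logDerivative-^ {f} {l} (suc n) d = ≈-trans (logDerivative-* d (logDerivative-^ n d))
  (*ₛ-congˡ (≈-trans (solve 2 (λ k l → l :+ k :* l := (# 1 :+ k) :* l) ≈-refl (K (+ n)) l) (*ₛ-congʳ (≈-sym (K-+ (+ 1) (+ n))))))

logDerivative-inv1 : ∀ {f l} → f 0 ≡ 1ℚ → LogDerivative f l → LogDerivative (inv1 f) (-ₛ l)
logDerivative-inv1 {f} {l} f0 d = *ₛ-cancelˡ f f0 (begin
  f *ₛ θ (inv1 f)
    ≈⟨ solve 3 (λ f g x → f :* x := (f :* x :+ g) :- g) ≈-refl f (θ f *ₛ inv1 f) (θ (inv1 f)) ⟩
  (f *ₛ θ (inv1 f) +ₛ θ f *ₛ inv1 f) -ₛ θ f *ₛ inv1 f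
    ≈⟨ -ₛ-cong (≈-trans (PSR.+-comm _ _) (≈-trans (≈-sym (θ-*ₛ f (inv1 f))) (≈-trans (θ-cong (*ₛ-inv1 f f0)) (≈-trans θ-one (≈-sym K-0))))) (*ₛ-congʳ d) ⟩
  K (+ 0) -ₛ f *ₛ l *ₛ inv1 f
    ≈⟨ solve 3 (λ f l g → # 0 :- f :* l :* g := f :* (g :* :- l)) ≈-refl f l (inv1 f) ⟩
  f *ₛ (inv1 f *ₛ -ₛ l) ∎)
  where open ≈-Reasoning

qpow-*ₛ : ∀ j f k → (qpow j *ₛ f) (j ℕ.+ k) ≡ f k
qpow-*ₛ j f k = trans (*ₛ-at (qpow j) f (j ℕ.+ k)) (trans (sumTo-δ (j ℕ.+ k) j (λ i → f ((j ℕ.+ k) ∸ i)) (ℕP.m≤m+n j k))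
  (cong f (ℕP.m+n∸m≡n j k)))

qpow-*ₛ-< : ∀ j f m → m < j → (qpow j *ₛ f) m ≡ 0ℚ
qpow-*ₛ-< j f m m<j = trans (*ₛ-at (qpow j) f m) (sumTo-0 m (λ i i≤m → zero-· _ (δ-> j i (ℕP.≤-<-trans i≤m m<j))))

-- τ j = q^j / (1 − q^j)
τ : ℕ → PS
τ j m = sumFrom1 m (λ e → δ (j ℕ.* e) m)

sumFrom1-first : ∀ n f → sumFrom1 (suc n) f ≡ f 1 + sumFrom1 n (f ∘ suc)
sumFrom1-first n f = trans (cong (λ k → sumFrom1 k f) (ℕP.+-comm 1 n)) (trans (sumFrom1-split 1 n f)
  (cong₂ _+_ (ℚP.+-identityˡ (f 1)) (sumFrom1-cong n (λ i _ _ → cong f (ℕP.+-comm i 1)))))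

τ-bound : ∀ j {m n} → m ≤ n → τ (suc j) m ≡ sumFrom1 n (λ e → δ (suc j ℕ.* e) m)
τ-bound j {m} m≤n = sym (sumFrom1-extend (λ e → δ (suc j ℕ.* e) m) m≤n
  (λ e m<e → δ-> (suc j ℕ.* e) m (ℕP.<-≤-trans m<e (m≤n*m′ e {suc j} (s≤s z≤n)))))

τ-step : ∀ j → τ (suc j) ≈ qpow (suc j) +ₛ qpow (suc j) *ₛ τ (suc j)
τ-step j .at m = trans (trans (τ-bound j (ℕP.n≤1+n m)) (trans (sumFrom1-first m (λ e → δ (suc j ℕ.* e) m))
    (cong₂ _+_ (cong (λ k → δ k m) (ℕP.*-identityʳ (suc j))) rest)))
  (sym (+ₛ-at (qpow (suc j)) (qpow (suc j) *ₛ τ (suc j)) m))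
  where
  rest : sumFrom1 m (λ e → δ (suc j ℕ.* suc e) m) ≡ (qpow (suc j) *ₛ τ (suc j)) m
  rest with suc j ℕP.≤? m
  ... | no j≰m = trans (sumFrom1-0 m (λ e _ _ → δ-> (suc j ℕ.* suc e) m (ℕP.<-≤-trans (ℕP.≰⇒> j≰m) (m≤m*n′ (suc j) (s≤s z≤n)))))
    (sym (qpow-*ₛ-< (suc j) (τ (suc j)) m (ℕP.≰⇒> j≰m)))
  ... | yes j≤m with ℕP.m≤n⇒∃[o]m+o≡n j≤m
  ... | k , refl = trans (sumFrom1-cong (suc j ℕ.+ k) (λ e _ _ → trans (cong (λ x → δ x (suc j ℕ.+ k)) (ℕP.*-suc (suc j) e))
        (trans (sym (δ-∸ (suc j ℕ.* e) (suc j) (suc j ℕ.+ k) j≤m)) (cong (δ (suc j ℕ.* e)) (ℕP.m+n∸m≡n (suc j) k)))))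
      (trans (sym (τ-bound j (ℕP.m≤n+m k (suc j)))) (sym (qpow-*ₛ (suc j) (τ (suc j)) k)))

θ-qpow : ∀ j → θ (qpow j) ≈ K (+ j) *ₛ qpow j
θ-qpow j .at n = trans (θ-at (qpow j) n) (trans (ℚP.*-comm (nat n) (qpow j n)) (trans
  (δ-· j n {nat n} {nat j} (λ j≡n → cong nat (sym j≡n))) (trans (ℚP.*-comm (qpow j n) (nat j)) (sym (K-*ₛ (+ j) (qpow j) n)))))

cyclo : ℕ → PS
cyclo j = oneS -ₛ qpow (suc j)

cyclo-at-0 : ∀ j → cyclo j 0 ≡ 1ℚ
cyclo-at-0 j = trans (-ₛ-at oneS (qpow (suc j)) 0) (ℚP.+-identityʳ 1ℚ)

logDerivative-cyclo : ∀ j → LogDerivative (cyclo j) (-ₛ (K (+ suc j) *ₛ τ (suc j)))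
logDerivative-cyclo j = begin
  θ (cyclo j)
    ≈⟨ ≈-trans (θ--ₛ oneS (qpow (suc j))) (-ₛ-cong (≈-trans θ-one (≈-sym K-0)) (θ-qpow (suc j))) ⟩
  K (+ 0) -ₛ K (+ suc j) *ₛ qpow (suc j)
    ≈⟨ -ₛ-cong ≈-refl (*ₛ-congˡ (≈-trans (solve 2 (λ x y → x := (x :+ y) :- y) ≈-refl (qpow (suc j)) (qpow (suc j) *ₛ τ (suc j)))
         (-ₛ-cong (≈-trans (≈-sym (τ-step j)) (≈-sym (PSR.*-identityˡ _))) ≈-refl))) ⟩
  K (+ 0) -ₛ K (+ suc j) *ₛ (oneS *ₛ τ (suc j) -ₛ qpow (suc j) *ₛ τ (suc j))
    ≈⟨ solve 4 (λ k o x t → # 0 :- k :* (o :* t :- x :* t) := (o :- x) :* :- (k :* t)) ≈-refl (K (+ suc j)) oneS (qpow (suc j)) (τ (suc j)) ⟩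
  cyclo j *ₛ -ₛ (K (+ suc j) *ₛ τ (suc j)) ∎
  where open ≈-Reasoning

pred3 : ℕ → ℕ
pred3 j = ℕ.pred (3 ℕ.* suc j)

etaFactor : ℕ → PS
etaFactor j = cyclo (pred3 j) ^ₛ 12 *ₛ inv1 (cyclo j) ^ₛ 12

-ₛ≈⊖ : ∀ f g → f ⊖ g ≈ f -ₛ g
-ₛ≈⊖ f g = ≡⇒≈ (sym (-ₛ-def f g))

inv1-cong : ∀ {f g} → f ≈ g → inv1 f ≈ inv1 g
inv1-cong {f} {g} e .at n = sumTo-cong n (λ k _ → at (≈-trans (pow-^ₛ (oneS ⊖ f) k) (≈-trans
  (^ₛ-cong k (mk≈ λ m → cong (λ z → oneS m - z) (at e m))) (≈-sym (pow-^ₛ (oneS ⊖ g) k)))) n)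

⊛≈*ₛ : ∀ {f f′ g g′} → f ≈ f′ → g ≈ g′ → f ⊛ g ≈ f′ *ₛ g′
⊛≈*ₛ {f} {f′} {g} {g′} d e = ≈-trans (⊛-cong {f} {f′} {g} {g′} d e) (≡⇒≈ (sym (*ₛ-def f′ g′)))

etaProd-suc : ∀ j → etaProd (suc j) ≈ etaProd j *ₛ etaFactor j
etaProd-suc j = ⊛≈*ₛ ≈-refl (⊛≈*ₛ
  (≈-trans (pow-^ₛ (oneS ⊖ qpow (3 ℕ.* suc j)) 12) (^ₛ-cong 12 (-ₛ≈⊖ oneS (qpow (3 ℕ.* suc j)))))
  (≈-trans (pow-^ₛ (inv1 (oneS ⊖ qpow (suc j))) 12) (^ₛ-cong 12 (inv1-cong (-ₛ≈⊖ oneS (qpow (suc j)))))))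

etaLog : ℕ → PS
etaLog zero = K (+ 0)
etaLog (suc j) = etaLog j +ₛ K (+ 12) *ₛ (K (+ suc j) *ₛ τ (suc j) -ₛ K (+ 3) *ₛ (K (+ suc j) *ₛ τ (3 ℕ.* suc j)))

logDerivative-etaProd : ∀ j → LogDerivative (etaProd j) (etaLog j)
logDerivative-etaProd zero = logDerivative-one
logDerivative-etaProd (suc j) = begin
  θ (etaProd (suc j))
    ≈⟨ θ-cong (etaProd-suc j) ⟩
  θ (etaProd j *ₛ etaFactor j)
    ≈⟨ logDerivative-* (logDerivative-etaProd j) (logDerivative-* (logDerivative-^ 12 (logDerivative-cyclo (pred3 j)))
         (logDerivative-^ 12 (logDerivative-inv1 (cyclo-at-0 j) (logDerivative-cyclo j)))) ⟩
  etaProd j *ₛ etaFactor j *ₛ (etaLog j +ₛ (K (+ 12) *ₛ -ₛ (K (+ (3 ℕ.* suc j)) *ₛ τ (3 ℕ.* suc j)) +ₛ K (+ 12) *ₛ -ₛ (-ₛ (K (+ suc j) *ₛ τ (suc j)))))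
    ≈⟨ *ₛ-cong (≈-sym (etaProd-suc j)) (+ₛ-congˡ (+ₛ-congʳ (*ₛ-congˡ (PSR.-‿cong (*ₛ-congʳ (≈-trans (≡⇒≈ (cong K (ℤP.pos-* 3 (suc j)))) (K-* (+ 3) (+ suc j)))))))) ⟩
  etaProd (suc j) *ₛ (etaLog j +ₛ (K (+ 12) *ₛ -ₛ (K (+ 3) *ₛ K (+ suc j) *ₛ τ (3 ℕ.* suc j)) +ₛ K (+ 12) *ₛ -ₛ (-ₛ (K (+ suc j) *ₛ τ (suc j)))))
    ≈⟨ *ₛ-congˡ (solve 4 (λ l k t s → l :+ (# 12 :* :- (# 3 :* k :* t) :+ # 12 :* :- (:- (k :* s)))
         := l :+ # 12 :* (k :* s :- # 3 :* (k :* t))) ≈-refl (etaLog j) (K (+ suc j)) (τ (3 ℕ.* suc j)) (τ (suc j))) ⟩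
  etaProd (suc j) *ₛ etaLog (suc j) ∎
  where open ≈-Reasoning

etaLog-at : ∀ N m → etaLog N m ≡ ι (+ 12) · (sumFrom1 N (λ j → nat j · τ j m) - ι (+ 3) · sumFrom1 N (λ j → nat j · τ (3 ℕ.* j) m))
etaLog-at zero m = trans (at K-0 m) (trans (zeroS-at m) (trans (sym ι-0) (trans
  (solveℚ 0 (conℚ (+ 0) ⟨=⟩ conℚ (+ 12) ⟨·⟩ (conℚ (+ 0) ⟨-⟩ conℚ (+ 3) ⟨·⟩ conℚ (+ 0))) refl)
  (cong (λ z → ι (+ 12) · (z - ι (+ 3) · z)) ι-0))))
etaLog-at (suc N) m = trans (+ₛ-at (etaLog N) _ m) (trans (cong₂ _+_ (etaLog-at N m)
    (trans (K-*ₛ (+ 12) _ m) (cong (λ z → ι (+ 12) · z) (trans (-ₛ-at _ _ m) (cong₂ _-_ (K-*ₛ (+ suc N) (τ (suc N)) m)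
      (trans (K-*ₛ (+ 3) _ m) (cong (λ z → ι (+ 3) · z) (K-*ₛ (+ suc N) (τ (3 ℕ.* suc N)) m))))))))
  (solveℚ 4 (λ x y a b → conℚ (+ 12) ⟨·⟩ (x ⟨-⟩ conℚ (+ 3) ⟨·⟩ y) ⟨+⟩ conℚ (+ 12) ⟨·⟩ (a ⟨-⟩ conℚ (+ 3) ⟨·⟩ b)
      ⟨=⟩ conℚ (+ 12) ⟨·⟩ (x ⟨+⟩ a ⟨-⟩ conℚ (+ 3) ⟨·⟩ (y ⟨+⟩ b))) refl
    (sumFrom1 N (λ j → nat j · τ j m)) (sumFrom1 N (λ j → nat j · τ (3 ℕ.* j) m)) (nat (suc N) · τ (suc N) m) (nat (suc N) · τ (3 ℕ.* suc N) m)))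

-- τ j starts at q^j, so the terms with j ≤ N already give all coefficients up to q^N. The terms τ
-- (3 j) form the Lambert sum of E₂(q³), which `Ldn-split` combines with that of E₂(q).
etaLog-Ldn : ∀ N → etaLog N ≈[ suc N ] K (+ 12) *ₛ Ldn
etaLog-Ldn N m (s≤s m≤N) = trans (etaLog-at N m) (trans (cong₂ (λ x y → ι (+ 12) · (x - ι (+ 3) · y)) all thirds)
  (trans (cong (λ z → ι (+ 12) · z) (sym (trans (at Ldn-split m) (trans (-ₛ-at Ld (K (+ 3) *ₛ Ldz′) m) (cong (λ z → Ld m - z) (K-*ₛ (+ 3) Ldz′ m))))))
   (sym (K-*ₛ (+ 12) Ldn m))))
  where
  all : sumFrom1 N (λ j → nat j · τ j m) ≡ Ld m
  all = trans (sumFrom1-cong N (λ { (suc j) _ _ → trans (cong (λ z → nat (suc j) · z) (τ-bound j m≤N)) (trans (sym (sumFrom1-·ˡ N (nat (suc j)) (λ e → δ (suc j ℕ.* e) m)))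
      (sumFrom1-cong N (λ e _ _ → ℚP.*-comm (nat (suc j)) (δ (suc j ℕ.* e) m)))) }))
    (sym (Lam-bound (λ d e → nat d) m≤N))
  thirds : sumFrom1 N (λ j → nat j · τ (3 ℕ.* j) m) ≡ Ldz′ m
  thirds = trans (sumFrom1-cong N (λ { (suc j) _ _ → trans (cong (λ z → nat (suc j) · z) (τ-bound (pred3 j) m≤N))
      (trans (sym (sumFrom1-·ˡ N (nat (suc j)) (λ e → δ (3 ℕ.* suc j ℕ.* e) m)))
      (sumFrom1-cong N (λ e _ _ → trans (ℚP.*-comm (nat (suc j)) (δ (3 ℕ.* suc j ℕ.* e) m)) (cong₂ _·_
         (cong (λ x → δ x m) (trans (ℕP.*-assoc 3 (suc j) e) (ℕP.*-comm 3 (suc j ℕ.* e))))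
         (sym (one-· (nat (suc j)) (trans (cong (ι ∘ d₃ᶻ) (res-*3 e)) ι-1))))))) }))
    (trans (sum²-extend (λ d e → δ (d ℕ.* e ℕ.* 3) m · (ι (d₃ᶻ (res (e ℕ.* 3))) · nat d)) m≤N
        (λ d e 1≤d 1≤e out → zero-· _ (δ-> (d ℕ.* e ℕ.* 3) m (ℕP.<-≤-trans (larger d e 1≤d 1≤e out) (ℕP.m≤m*n (d ℕ.* e) 3)))))
      (sym (Lam-multiplesʳ 2 m (λ d e → ι (d₃ᶻ (res e)) · nat d) (λ d e _ 3∤e → zero-· (nat d) (trans (cong ι (d₃-∤ e 3∤e)) ι-0)))))
    where
    larger : ∀ d e → 1 ≤ d → 1 ≤ e → m < d ⊎ m < e → m < d ℕ.* e
    larger d e 1≤d 1≤e (inj₁ m<d) = ℕP.<-≤-trans m<d (m≤m*n′ d 1≤e)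
    larger d e 1≤d 1≤e (inj₂ m<e) = ℕP.<-≤-trans m<e (m≤n*m′ e 1≤d)

*ₛ-one[] : ∀ n {f g} → f ≈[ n ] oneS → g ≈[ n ] oneS → f *ₛ g ≈[ n ] oneS
*ₛ-one[] n {f} {g} d e i i<n = trans (*ₛ-cong[] n {f} {oneS} {g} {oneS} d e i i<n) (at (PSR.*-identityˡ oneS) i)

^ₛ-one[] : ∀ n {f} k → f ≈[ n ] oneS → f ^ₛ k ≈[ n ] oneS
^ₛ-one[] n zero d i i<n = refl
^ₛ-one[] n {f} (suc k) d = *ₛ-one[] n {f} {f ^ₛ k} d (^ₛ-one[] n k d)

inv1-one[] : ∀ n {f} → f 0 ≡ 1ℚ → f ≈[ n ] oneS → inv1 f ≈[ n ] oneS
inv1-one[] n {f} f0 d i i<n = trans (sym (at (PSR.*-identityˡ (inv1 f)) i))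
  (trans (sym (*ₛ-cong[] n {f} {oneS} {inv1 f} {inv1 f} d (λ _ _ → refl) i i<n)) (at (*ₛ-inv1 f f0) i))

cyclo-one[] : ∀ j n → n ≤ suc j → cyclo j ≈[ n ] oneS
cyclo-one[] j n n≤j i i<n = trans (-ₛ-at oneS (qpow (suc j)) i) (trans (cong (λ z → oneS i - z) (δ-> (suc j) i (ℕP.<-≤-trans i<n n≤j))) (ℚP.+-identityʳ (oneS i)))

etaFactor-one[] : ∀ j → etaFactor j ≈[ suc j ] oneS
etaFactor-one[] j = *ₛ-one[] (suc j) {cyclo (pred3 j) ^ₛ 12} {inv1 (cyclo j) ^ₛ 12}
  (^ₛ-one[] (suc j) {cyclo (pred3 j)} 12 (cyclo-one[] (pred3 j) (suc j) (ℕP.m≤m+n (suc j) _)))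
  (^ₛ-one[] (suc j) {inv1 (cyclo j)} 12 (inv1-one[] (suc j) (cyclo-at-0 j) (cyclo-one[] j (suc j) ℕP.≤-refl)))

-- Factor j is 1 + O(q^(j+1)), so coefficient i is settled after i factors. This reconciles the
-- diagonal definition of `etaQuot` with its partial products.
etaProd-stable : ∀ i k → etaProd (k ℕ.+ i) i ≡ etaProd i i
etaProd-stable i zero = refl
etaProd-stable i (suc k) = trans (at (etaProd-suc (k ℕ.+ i)) i)
  (trans (*ₛ-cong[] (suc (k ℕ.+ i)) {etaProd (k ℕ.+ i)} {etaProd (k ℕ.+ i)} {etaFactor (k ℕ.+ i)} {oneS} (λ _ _ → refl)
     (etaFactor-one[] (k ℕ.+ i)) i (s≤s (ℕP.m≤n+m i k)))
   (trans (at (PSR.*-identityʳ (etaProd (k ℕ.+ i))) i) (etaProd-stable i k)))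

etaQuot-etaProd : ∀ n → etaQuot ≈[ suc n ] etaProd n
etaQuot-etaProd n i (s≤s i≤n) with ℕP.m≤n⇒∃[o]m+o≡n i≤n
... | k , refl = sym (trans (cong (λ m → etaProd m i) (ℕP.+-comm i k)) (etaProd-stable i k))

etaQuot-at-0 : etaQuot 0 ≡ 1ℚ
etaQuot-at-0 = refl

logDerivative-etaQuot : LogDerivative etaQuot (K (+ 12) *ₛ Ldn)
logDerivative-etaQuot .at n = trans (θ-at etaQuot n) (trans (sym (θ-at (etaProd n) n)) (trans (at (logDerivative-etaProd n) n)
  (sym (*ₛ-cong[] (suc n) {etaQuot} {etaProd n} {K (+ 12) *ₛ Ldn} {etaLog n} (etaQuot-etaProd n) (λ i i<n → sym (etaLog-Ldn n i i<n)) n ℕP.≤-refl))))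

-- The modular parametrisation

-ₛ-self : ∀ f → f -ₛ f ≈ zeroS
-ₛ-self f = PSR.-‿inverseʳ f

-- Eliminating θa from its two expressions `θa-∞` and `θa-0`. With A = a² this is the cubic theta
-- identity a³ = b³ + c³.
aA : aS *ₛ AS ≈ βS +ₛ γS
aA = K-suc-cancel 1 (begin
  K (+ 2) *ₛ (aS *ₛ AS)
    ≈⟨ solve 4 (λ a A p b → # 2 :* (a :* A) := (a :* (p :+ # 2 :* A) :- # 2 :* b) :+ (# 2 :* b :- a :* p)) ≈-refl aS AS PmS βS ⟩
  (aS *ₛ (PmS +ₛ K (+ 2) *ₛ AS) -ₛ K (+ 2) *ₛ βS) +ₛ (K (+ 2) *ₛ βS -ₛ aS *ₛ PmS)
    ≈⟨ +ₛ-congʳ (≈-trans (-ₛ-cong (*ₛ-congˡ (≈-sym Pp-Pm)) ≈-refl) (≈-trans (≈-sym θa-∞) θa-0)) ⟩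
  (aS *ₛ PmS +ₛ K (+ 2) *ₛ γS) +ₛ (K (+ 2) *ₛ βS -ₛ aS *ₛ PmS)
    ≈⟨ solve 3 (λ x g b → (x :+ # 2 :* g) :+ (# 2 :* b :- x) := # 2 :* (b :+ g)) ≈-refl (aS *ₛ PmS) γS βS ⟩
  K (+ 2) *ₛ (βS +ₛ γS) ∎)
  where open ≈-Reasoning

aaa : aS *ₛ (aS *ₛ aS) ≈ βS +ₛ γS
aaa = ≈-trans (*ₛ-congˡ a²) aA

θ-cube : ∀ f → θ (f *ₛ (f *ₛ f)) ≈ K (+ 3) *ₛ (f *ₛ f *ₛ θ f)
θ-cube f = ≈-trans (θ-*ₛ f (f *ₛ f)) (≈-trans (+ₛ-congˡ (*ₛ-congˡ (θ-*ₛ f f)))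
  (solve 2 (λ f d → d :* (f :* f) :+ f :* (d :* f :+ f :* d) := # 3 :* (f :* f :* d)) ≈-refl f (θ f)))

β-as-difference : βS ≈ aS *ₛ (aS *ₛ aS) -ₛ γS
β-as-difference = ≈-trans (solve 2 (λ b g → b := b :+ g :- g) ≈-refl βS γS) (-ₛ-cong (≈-sym aaa) ≈-refl)

γ-as-difference : γS ≈ aS *ₛ (aS *ₛ aS) -ₛ βS
γ-as-difference = ≈-trans (solve 2 (λ b g → g := b :+ g :- b) ≈-refl βS γS) (-ₛ-cong (≈-sym aaa) ≈-refl)

-- Obtained by differentiating γ = a³ - β, with θa and θβ already known. It reflects the product γ =
-- 27 η(q³)⁹/η(q)³, whose logarithmic derivative is P+/2.
θγ : K (+ 2) *ₛ θ γS ≈ γS *ₛ PpS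
θγ = begin
  K (+ 2) *ₛ θ γS
    ≈⟨ *ₛ-congˡ (≈-trans (θ-cong γ-as-difference) (≈-trans (θ--ₛ _ βS) (-ₛ-cong (θ-cube aS) ≈-refl))) ⟩
  K (+ 2) *ₛ (K (+ 3) *ₛ (aS *ₛ aS *ₛ θ aS) -ₛ θ βS)
    ≈⟨ solve 3 (λ a x y → # 2 :* (# 3 :* (a :* a :* x) :- y) := a :* a :* (# 6 :* x) :- # 2 :* y) ≈-refl aS (θ aS) (θ βS) ⟩
  aS *ₛ aS *ₛ (K (+ 6) *ₛ θ aS) -ₛ K (+ 2) *ₛ θ βS
    ≈⟨ -ₛ-cong (*ₛ-congˡ θa-∞) θβ ⟩
  aS *ₛ aS *ₛ (aS *ₛ PpS -ₛ K (+ 2) *ₛ βS) -ₛ βS *ₛ PmS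
    ≈⟨ solve 4 (λ a p b m → a :* a :* (a :* p :- # 2 :* b) :- b :* m := a :* (a :* a) :* p :- b :* (m :+ # 2 :* (a :* a))) ≈-refl aS PpS βS PmS ⟩
  aS *ₛ (aS *ₛ aS) *ₛ PpS -ₛ βS *ₛ (PmS +ₛ K (+ 2) *ₛ (aS *ₛ aS))
    ≈⟨ -ₛ-cong (*ₛ-congʳ aaa) (*ₛ-congˡ (≈-trans (+ₛ-congˡ (*ₛ-congˡ a²)) (≈-sym Pp-Pm))) ⟩
  (βS +ₛ γS) *ₛ PpS -ₛ βS *ₛ PpS
    ≈⟨ solve 3 (λ b g p → (b :+ g) :* p :- b :* p := g :* p) ≈-refl βS γS PpS ⟩
  γS *ₛ PpS ∎
  where open ≈-Reasoning

-- If g vanishes below degree n, only the constant term of f meets it there. Both uniqueness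
-- arguments for differential equations compare such leading coefficients.
*ₛ-leading : ∀ f g n → g ≈[ n ] zeroS → (f *ₛ g) n ≡ f 0 · g n
*ₛ-leading f g zero e = *ₛ-at-0 f g
*ₛ-leading f g (suc n) e = trans (*ₛ-at-suc f g n) (trans (cong (λ z → f 0 · g (suc n) + z)
  (trans (*ₛ-cong[] (suc n) {tail f} {tail f} {g} {zeroS} (λ _ _ → refl) e n ℕP.≤-refl) (trans (at (PSR.zeroʳ (tail f)) n) (zeroS-at n))))
  (ℚP.+-identityʳ _))

affine-at-0 : ∀ c d f → f 0 ≡ 0ℚ → (K c +ₛ K d *ₛ f) 0 ≡ ι c
affine-at-0 c d f f0 = trans (+ₛ-at (K c) (K d *ₛ f) 0) (trans (cong₂ _+_ (K-at-0 c) (trans (K-*ₛ d f 0) (trans (cong (λ z → ι d · z) f0) (ℚP.*-zeroʳ (ι d))))) (ℚP.+-identityʳ (ι c)))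

aS-at-0 : aS 0 ≡ 1ℚ
aS-at-0 = trans (affine-at-0 (+ 1) (+ 6) Lχ (Lam-at-0 _)) ι-1

AS-at-0 : AS 0 ≡ 1ℚ
AS-at-0 = trans (affine-at-0 (+ 1) (+ 12) Ldn (Lam-at-0 _)) ι-1

βS-at-0 : βS 0 ≡ 1ℚ
βS-at-0 = trans (affine-at-0 (+ 1) (neg 9) Ld²χ (Lam-at-0 _)) ι-1

γS-at-0 : γS 0 ≡ 0ℚ
γS-at-0 = trans (K-*ₛ (+ 27) Ld²χ′ 0) (trans (cong (λ z → ι (+ 27) · z) (Lam-at-0 _)) (ℚP.*-zeroʳ (ι (+ 27))))

γS-at-1 : γS 1 ≡ ι (+ 27)
γS-at-1 = trans (K-*ₛ (+ 27) Ld²χ′ 1) (trans (cong (λ z → ι (+ 27) · z) (trans (Lam-at _ 1)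
  (trans (ℚP.+-identityˡ _) (trans (ℚP.+-identityˡ _) (trans (ℚP.*-identityˡ _) (cong₂ _·_ (cong₂ _·_ ι-1 ι-1) ι-1))))))
  (ℚP.*-identityʳ (ι (+ 27))))

-- A solution of 2 θ w = w P+ is determined by its coefficient of q, as P+ has constant term 2.
Pp-ode-unique : ∀ w → w 0 ≡ 0ℚ → w 1 ≡ 0ℚ → K (+ 2) *ₛ θ w ≈ w *ₛ PpS → w ≈ zeroS
Pp-ode-unique w w0 w1 e = ≈[]⇒≈ vanish
  where
  next : ∀ n → w ≈[ n ] zeroS → w n ≡ 0ℚ
  next zero _ = w0
  next (suc zero) _ = w1
  -- With n = k + 2, comparing leading coefficients gives 2 n w(n) = 2 w(n), hence (n - 1) w(n) = 0.
  -- For n = 1 this is empty, which is why the coefficient of q must be given.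
  next (suc (suc k)) below = nat-suc-cancel k (begin
    nat (suc k) · w n
      ≡⟨ solveℚ 2 (λ x w → x ⟨·⟩ w ⟨=⟩ (conℚ (+ 1) ⟨+⟩ x) ⟨·⟩ w ⟨-⟩ w) refl (nat (suc k)) (w n) ⟩
    (ι (+ 1) + nat (suc k)) · w n - w n
      ≡⟨ cong (λ z → z · w n - w n) (sym (nat-+ 1 (suc k))) ⟩
    nat n · w n - w n
      ≡⟨ cong (_- w n) (nat-suc-cancel 1 doubled) ⟩
    w n - w n
      ≡⟨ trans (ℚP.+-inverseʳ (w n)) (sym (ℚP.*-zeroʳ (nat (suc k)))) ⟩
    nat (suc k) · 0ℚ ∎)
    where
    open ≡-Reasoning
    n : ℕ
    n = suc (suc k)
    doubled : nat 2 · (nat n · w n) ≡ nat 2 · w n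
    doubled = begin
      nat 2 · (nat n · w n) ≡⟨ cong (λ z → nat 2 · z) (sym (θ-at w n)) ⟩
      nat 2 · θ w n ≡⟨ sym (K-*ₛ (+ 2) (θ w) n) ⟩
      (K (+ 2) *ₛ θ w) n ≡⟨ at (≈-trans e (PSR.*-comm w PpS)) n ⟩
      (PpS *ₛ w) n ≡⟨ *ₛ-leading PpS w n below ⟩
      PpS 0 · w n ≡⟨ cong (_· w n) (affine-at-0 (+ 2) (neg 6) Ldc (Lam-at-0 _)) ⟩
      nat 2 · w n ∎
  vanish : ∀ n → w ≈[ n ] zeroS
  vanish (suc n) i (s≤s i≤n) with ℕP.m≤n⇒m<n∨m≡n i≤n
  ... | inj₁ i<n = vanish n i i<n
  ... | inj₂ refl = trans (next i (vanish i)) (sym (zeroS-at i))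

X : PS
X = qpow 1

X-*ₛ-suc : ∀ f n → (X *ₛ f) (suc n) ≡ f n
X-*ₛ-suc f n = qpow-*ₛ 1 f n

X-*ₛ-zero : ∀ f → (X *ₛ f) 0 ≡ 0ℚ
X-*ₛ-zero f = qpow-*ₛ-< 1 f 0 (s≤s z≤n)

shiftq-X : ∀ f → shiftq f ≈ X *ₛ f
shiftq-X f .at zero = sym (X-*ₛ-zero f)
shiftq-X f .at (suc n) = sym (X-*ₛ-suc f n)

θX : θ X ≈ X
θX = ≈-trans (θ-qpow 1) (≈-trans (*ₛ-congʳ K-1) (PSR.*-identityˡ X))

θu : θ uS ≈ uS *ₛ AS
θu = begin
  θ uS
    ≈⟨ ≈-trans (θ-cong (shiftq-X etaQuot)) (≈-trans (θ-*ₛ X etaQuot) (+ₛ-cong (*ₛ-congʳ θX) (*ₛ-congˡ logDerivative-etaQuot))) ⟩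
  X *ₛ etaQuot +ₛ X *ₛ (etaQuot *ₛ (K (+ 12) *ₛ Ldn))
    ≈⟨ solve 3 (λ x e l → x :* e :+ x :* (e :* (# 12 :* l)) := x :* e :* (# 1 :+ # 12 :* l)) ≈-refl X etaQuot Ldn ⟩
  X *ₛ etaQuot *ₛ AS
    ≈⟨ *ₛ-congʳ (≈-sym (shiftq-X etaQuot)) ⟩
  uS *ₛ AS ∎
  where open ≈-Reasoning

-- The logarithmic derivative of u β is A + P-/2 = P+/2, the same as that of γ, and both 27 u β and
-- γ begin with 27 q. At this point the eta quotient is tied to the theta functions.
27uβ : K (+ 27) *ₛ (uS *ₛ βS) ≈ γS
27uβ = begin
  K (+ 27) *ₛ (uS *ₛ βS) ≈⟨ solve 2 (λ x g → x := x :- g :+ g) ≈-refl (K (+ 27) *ₛ (uS *ₛ βS)) γS ⟩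
  w +ₛ γS ≈⟨ +ₛ-congʳ (Pp-ode-unique w w0 w1 ode) ⟩
  zeroS +ₛ γS ≈⟨ PSR.+-identityˡ γS ⟩
  γS ∎
  where
  open ≈-Reasoning
  w : PS
  w = K (+ 27) *ₛ (uS *ₛ βS) -ₛ γS
  w0 : w 0 ≡ 0ℚ
  w0 = trans (-ₛ-at _ γS 0) (trans (cong₂ _-_ (trans (K-*ₛ (+ 27) _ 0) (trans (cong (λ z → ι (+ 27) · z) (*ₛ-at-0-zero uS βS refl)) (ℚP.*-zeroʳ (ι (+ 27))))) γS-at-0) refl)
  w1 : w 1 ≡ 0ℚ
  w1 = trans (-ₛ-at _ γS 1) (trans (cong₂ _-_ (trans (K-*ₛ (+ 27) _ 1) (trans (cong (λ z → ι (+ 27) · z)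
         (trans (*ₛ-at-suc-zero uS βS 0 refl) (*ₛ-at-0-one (tail uS) βS refl βS-at-0))) (ℚP.*-identityʳ (ι (+ 27))))) γS-at-1)
         (ℚP.+-inverseʳ (ι (+ 27))))
  ode : K (+ 2) *ₛ θ w ≈ w *ₛ PpS
  ode = begin
    K (+ 2) *ₛ θ w
      ≈⟨ *ₛ-congˡ (≈-trans (θ--ₛ _ γS) (-ₛ-cong (≈-trans (θ-K (+ 27) _) (*ₛ-congˡ (θ-*ₛ uS βS))) ≈-refl)) ⟩
    K (+ 2) *ₛ (K (+ 27) *ₛ (θ uS *ₛ βS +ₛ uS *ₛ θ βS) -ₛ θ γS)
      ≈⟨ solve 5 (λ u b x y z → # 2 :* (# 27 :* (x :* b :+ u :* y) :- z) := # 27 :* (# 2 :* x :* b :+ u :* (# 2 :* y)) :- # 2 :* z) ≈-refl uS βS (θ uS) (θ βS) (θ γS) ⟩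
    K (+ 27) *ₛ (K (+ 2) *ₛ θ uS *ₛ βS +ₛ uS *ₛ (K (+ 2) *ₛ θ βS)) -ₛ K (+ 2) *ₛ θ γS
      ≈⟨ -ₛ-cong (*ₛ-congˡ (+ₛ-cong (*ₛ-congʳ (*ₛ-congˡ θu)) (*ₛ-congˡ θβ))) θγ ⟩
    K (+ 27) *ₛ (K (+ 2) *ₛ (uS *ₛ AS) *ₛ βS +ₛ uS *ₛ (βS *ₛ PmS)) -ₛ γS *ₛ PpS
      ≈⟨ solve 5 (λ u b A m gp → # 27 :* (# 2 :* (u :* A) :* b :+ u :* (b :* m)) :- gp := # 27 :* (u :* b) :* (m :+ # 2 :* A) :- gp) ≈-refl uS βS AS PmS (γS *ₛ PpS) ⟩
    K (+ 27) *ₛ (uS *ₛ βS) *ₛ (PmS +ₛ K (+ 2) *ₛ AS) -ₛ γS *ₛ PpS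
      ≈⟨ -ₛ-cong (*ₛ-congˡ (≈-sym Pp-Pm)) ≈-refl ⟩
    K (+ 27) *ₛ (uS *ₛ βS) *ₛ PpS -ₛ γS *ₛ PpS
      ≈⟨ solve 3 (λ x g p → x :* p :- g :* p := (x :- g) :* p) ≈-refl (K (+ 27) *ₛ (uS *ₛ βS)) γS PpS ⟩
    w *ₛ PpS ∎

δS : PS
δS = βS -ₛ γS

δS-at-0 : δS 0 ≡ 1ℚ
δS-at-0 = trans (-ₛ-at βS γS 0) (cong₂ _-_ βS-at-0 γS-at-0)

sS : PS
sS = βS +ₛ γS

sS-at-0 : sS 0 ≡ 1ℚ
sS-at-0 = trans (+ₛ-at βS γS 0) (cong₂ _+_ βS-at-0 γS-at-0)

1+27u : PS
1+27u = K (+ 1) +ₛ K (+ 27) *ₛ uS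

1+27u-at-0 : 1+27u 0 ≡ 1ℚ
1+27u-at-0 = trans (affine-at-0 (+ 1) (+ 27) uS refl) ι-1

tS-inv1 : tS ≈ uS *ₛ inv1 (1+27u *ₛ 1+27u)
tS-inv1 = ⊛≈*ₛ ≈-refl (inv1-cong square)
  where
  base : oneS ⊕ scale (+ 27 / 1) uS ≈ 1+27u
  base = ≈-trans (≡⇒≈ (sym (+ₛ-def oneS (scale (+ 27 / 1) uS)))) (+ₛ-cong (≈-sym K-1)
    (≈-trans (scale-*ₛ (+ 27 / 1) uS) (*ₛ-congʳ (≡⇒≈ (trans (cong const (sym (ι-def (+ 27)))) (sym (K-def (+ 27))))))))
  square : pow (oneS ⊕ scale (+ 27 / 1) uS) 2 ≈ 1+27u *ₛ 1+27u
  square = ≈-trans (pow-^ₛ _ 2) (≈-trans (^ₛ-cong 2 base) (*ₛ-congˡ (PSR.*-identityʳ 1+27u)))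

tS-*ₛ : tS *ₛ (1+27u *ₛ 1+27u) ≈ uS
tS-*ₛ = ≈-trans (*ₛ-congʳ tS-inv1) (≈-trans (PSR.*-assoc uS _ _)
  (≈-trans (*ₛ-congˡ (inv1-*ₛ (1+27u *ₛ 1+27u) (*ₛ-at-0-one 1+27u 1+27u 1+27u-at-0 1+27u-at-0))) (PSR.*-identityʳ uS)))

β-1+27u : βS *ₛ 1+27u ≈ sS
β-1+27u = ≈-trans (solve 2 (λ b u → b :* (# 1 :+ # 27 :* u) := b :+ # 27 :* (u :* b)) ≈-refl βS uS) (+ₛ-congˡ 27uβ)

-- As 27 u = γ/β, the definition of t gives 27 t = 27 u/(1 + 27 u)² = β γ/(β + γ)².
27ts² : K (+ 27) *ₛ (tS *ₛ (sS *ₛ sS)) ≈ βS *ₛ γS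
27ts² = begin
  K (+ 27) *ₛ (tS *ₛ (sS *ₛ sS))
    ≈⟨ *ₛ-congˡ (*ₛ-congˡ (*ₛ-cong (≈-sym β-1+27u) (≈-sym β-1+27u))) ⟩
  K (+ 27) *ₛ (tS *ₛ (βS *ₛ 1+27u *ₛ (βS *ₛ 1+27u)))
    ≈⟨ solve 3 (λ t b d → # 27 :* (t :* (b :* d :* (b :* d))) := # 27 :* (t :* (d :* d) :* b :* b)) ≈-refl tS βS 1+27u ⟩
  K (+ 27) *ₛ (tS *ₛ (1+27u *ₛ 1+27u) *ₛ βS *ₛ βS)
    ≈⟨ *ₛ-congˡ (*ₛ-congʳ (*ₛ-congʳ tS-*ₛ)) ⟩
  K (+ 27) *ₛ (uS *ₛ βS *ₛ βS)
    ≈⟨ solve 2 (λ u b → # 27 :* (u :* b :* b) := b :* (# 27 :* (u :* b))) ≈-refl uS βS ⟩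
  βS *ₛ (K (+ 27) *ₛ (uS *ₛ βS))
    ≈⟨ *ₛ-congˡ 27uβ ⟩
  βS *ₛ γS ∎
  where open ≈-Reasoning

-- Logarithmic differentiation of 27 t s² = β γ gives θt/t = A (β - γ)/s, and A/s = 1/a by `aA`. The
-- computation is multiplied by 54 s A, so that it stays polynomial and can be cancelled at the end.
θt : aS *ₛ θ tS ≈ tS *ₛ δS
θt = *ₛ-cancelˡ AS AS-at-0 (*ₛ-cancelˡ sS sS-at-0 (K-suc-cancel 53 (begin
  K (+ 54) *ₛ (sS *ₛ (AS *ₛ (aS *ₛ θ tS)))
    ≈⟨ solve 4 (λ s A a x → # 54 :* (s :* (A :* (a :* x))) := # 54 :* (s :* (a :* A) :* x)) ≈-refl sS AS aS (θ tS) ⟩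
  K (+ 54) *ₛ (sS *ₛ (aS *ₛ AS) *ₛ θ tS)
    ≈⟨ *ₛ-congˡ (*ₛ-congʳ (*ₛ-congˡ aA)) ⟩
  K (+ 54) *ₛ (sS *ₛ sS *ₛ θ tS)
    ≈⟨ solve 4 (λ s t x y → # 54 :* (s :* s :* x) := # 2 :* (# 27 :* (x :* (s :* s) :+ t :* (y :* s :+ s :* y))) :- # 54 :* (t :* s :* (# 2 :* y))) ≈-refl sS tS (θ tS) (θ sS) ⟩
  K (+ 2) *ₛ (K (+ 27) *ₛ (θ tS *ₛ (sS *ₛ sS) +ₛ tS *ₛ (θ sS *ₛ sS +ₛ sS *ₛ θ sS))) -ₛ K (+ 54) *ₛ (tS *ₛ sS *ₛ (K (+ 2) *ₛ θ sS))
    ≈⟨ -ₛ-cong (*ₛ-congˡ differentiated) (*ₛ-congˡ (*ₛ-congˡ θs)) ⟩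
  K (+ 2) *ₛ (θ βS *ₛ γS +ₛ βS *ₛ θ γS) -ₛ K (+ 54) *ₛ (tS *ₛ sS *ₛ (βS *ₛ PmS +ₛ γS *ₛ PpS))
    ≈⟨ -ₛ-cong (≈-trans (solve 4 (λ b g x y → # 2 :* (x :* g :+ b :* y) := (# 2 :* x) :* g :+ b :* (# 2 :* y)) ≈-refl βS γS (θ βS) (θ γS))
         (≈-trans (+ₛ-cong (*ₛ-congʳ θβ) (*ₛ-congˡ θγ)) (≈-trans (solve 4 (λ b g m p → b :* m :* g :+ b :* (g :* p) := b :* g :* (m :+ p)) ≈-refl βS γS PmS PpS)
           (*ₛ-congʳ (≈-sym 27ts²))))) ≈-refl ⟩
  K (+ 27) *ₛ (tS *ₛ (sS *ₛ sS)) *ₛ (PmS +ₛ PpS) -ₛ K (+ 54) *ₛ (tS *ₛ sS *ₛ (βS *ₛ PmS +ₛ γS *ₛ PpS))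
    ≈⟨ -ₛ-cong (*ₛ-congˡ (+ₛ-congˡ Pp-Pm)) (*ₛ-congˡ (*ₛ-congˡ (+ₛ-congˡ (*ₛ-congˡ Pp-Pm)))) ⟩
  K (+ 27) *ₛ (tS *ₛ (sS *ₛ sS)) *ₛ (PmS +ₛ (PmS +ₛ K (+ 2) *ₛ AS)) -ₛ K (+ 54) *ₛ (tS *ₛ sS *ₛ (βS *ₛ PmS +ₛ γS *ₛ (PmS +ₛ K (+ 2) *ₛ AS)))
    ≈⟨ solve 5 (λ t b g m A → # 27 :* (t :* ((b :+ g) :* (b :+ g))) :* (m :+ (m :+ # 2 :* A)) :- # 54 :* (t :* (b :+ g) :* (b :* m :+ g :* (m :+ # 2 :* A)))
         := # 54 :* ((b :+ g) :* (A :* (t :* (b :- g))))) ≈-refl tS βS γS PmS AS ⟩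
  K (+ 54) *ₛ (sS *ₛ (AS *ₛ (tS *ₛ δS))) ∎)))
  where
  open ≈-Reasoning
  θs : K (+ 2) *ₛ θ sS ≈ βS *ₛ PmS +ₛ γS *ₛ PpS
  θs = ≈-trans (*ₛ-congˡ (θ-+ₛ βS γS)) (≈-trans (PSR.distribˡ (K (+ 2)) (θ βS) (θ γS)) (+ₛ-cong θβ θγ))
  differentiated : K (+ 27) *ₛ (θ tS *ₛ (sS *ₛ sS) +ₛ tS *ₛ (θ sS *ₛ sS +ₛ sS *ₛ θ sS)) ≈ θ βS *ₛ γS +ₛ βS *ₛ θ γS
  differentiated = ≈-trans (*ₛ-congˡ (≈-trans (+ₛ-congˡ (*ₛ-congˡ (≈-sym (θ-*ₛ sS sS)))) (≈-sym (θ-*ₛ tS (sS *ₛ sS)))))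
    (≈-trans (≈-sym (θ-K (+ 27) _)) (≈-trans (θ-cong 27ts²) (θ-*ₛ βS γS)))

χ₃-res : ∀ n → χ₃ n ≡ ι (χ₃ᶻ (res n))
χ₃-res zero = sym ι-0
χ₃-res (suc zero) = sym ι-1
χ₃-res (suc (suc zero)) = trans (cong -_ (sym ι-1)) (sym (ι-neg (+ 1)))
χ₃-res (suc (suc (suc n))) = trans (cong (λ r → if r ≡ᵇ 0 then 0ℚ else (if r ≡ᵇ 1 then 1ℚ else - 1ℚ)) (trans (cong (_% 3) (ℕP.+-comm 3 n)) ([m+n]%n≡m%n n 3)))
  (trans (χ₃-res n) (cong (ι ∘ χ₃ᶻ) (sym (succ₃³ (res n)))))
Ccoeff : ℕ → ℕ → ℚ
Ccoeff d e = ((+ 3 / 1) · χ₃ d - (+ 27 / 1) · χ₃ e) · fromℕ (d ℕ.^ 4)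
fourth : ∀ d → fromℕ (d ℕ.^ 4) ≡ nat d · (nat d · (nat d · nat d))
fourth d = trans (fromℕ-def (d ℕ.^ 4)) (trans (nat-* d _) (cong (λ z → nat d · z) (trans (nat-* d _) (cong (λ z → nat d · z)
  (trans (nat-* d _) (cong (λ z → nat d · nat z) (ℕP.*-identityʳ d)))))))
expand : ∀ d e → Ccoeff d e ≡ ι (+ 3) · (ι (χ₃ᶻ (res d)) · nat d · nat d · nat d · nat d) + ι (neg 27) · (ι (χ₃ᶻ (res e)) · nat d · nat d · nat d · nat d)
expand d e = trans (cong₂ _·_ (cong₂ _-_ (cong₂ _·_ (sym (ι-def (+ 3))) (χ₃-res d)) (cong₂ _·_ (sym (ι-def (+ 27))) (χ₃-res e))) (fourth d))
  (solveℚ 3 (λ x y d → (conℚ (+ 3) ⟨·⟩ x ⟨-⟩ conℚ (+ 27) ⟨·⟩ y) ⟨·⟩ (d ⟨·⟩ (d ⟨·⟩ (d ⟨·⟩ d)))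
    ⟨=⟩ conℚ (+ 3) ⟨·⟩ (x ⟨·⟩ d ⟨·⟩ d ⟨·⟩ d ⟨·⟩ d) ⟨+⟩ conℚ (neg 27) ⟨·⟩ (y ⟨·⟩ d ⟨·⟩ d ⟨·⟩ d ⟨·⟩ d)) refl (ι (χ₃ᶻ (res d))) (ι (χ₃ᶻ (res e))) (nat d))
Cmix-Lam : Cmix ≈ oneS +ₛ Lam Ccoeff
Cmix-Lam .at zero = sym (trans (+ₛ-at oneS (Lam Ccoeff) 0) (cong (λ z → 1ℚ + z) (Lam-at-0 Ccoeff)))
Cmix-Lam .at (suc n) = trans (sum²-cong (suc n) (λ d e _ _ → select (d ℕ.* e ≡ᵇ suc n) (Ccoeff d e)))
  (sym (trans (+ₛ-at oneS (Lam Ccoeff) (suc n)) (trans (ℚP.+-identityˡ _) (Lam-at Ccoeff (suc n)))))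
  where
  select : ∀ b x → (if b then x else 0ℚ) ≡ ind b · x
  select true x = sym (ℚP.*-identityˡ x)
  select false x = sym (ℚP.*-zeroˡ x)

Aδ : AS *ₛ δS ≈ Cmix
Aδ = ≈-trans (PSR.distribˡ AS βS (-ₛ γS)) (≈-trans (≈-trans (solve 3 (λ A b g → A :* b :+ A :* (:- g) := A :* b :- A :* g) ≈-refl AS βS γS) (-ₛ-cong Aβ Aγ)) combine)
  where
  combine : (K (+ 1) +ₛ K (+ 3) *ₛ Ld⁴χ) -ₛ K (+ 27) *ₛ Ld⁴χ′ ≈ Cmix
  combine = ≈-trans (solve 2 (λ x y → (# 1 :+ # 3 :* x) :- # 27 :* y := # 1 :+ (# 3 :* x :+ con (neg 27) :* y)) ≈-refl Ld⁴χ Ld⁴χ′)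
    (≈-trans (+ₛ-cong K-1 (Lam-combine₂ (+ 3) (neg 27) (λ d e → sym (expand d e)))) (≈-sym Cmix-Lam))

-- Power series in t

-- The logarithmic derivative θt/t, a unit with constant term 1.
Eo : PS
Eo = δS *ₛ inv1 aS

aEo : aS *ₛ Eo ≈ δS
aEo = ≈-trans (solve 3 (λ a d i → a :* (d :* i) := d :* (a :* i)) ≈-refl aS δS (inv1 aS))
  (≈-trans (*ₛ-congˡ (*ₛ-inv1 aS aS-at-0)) (PSR.*-identityʳ δS))

Eo-at-0 : Eo 0 ≡ 1ℚ
Eo-at-0 = *ₛ-at-0-one δS (inv1 aS) δS-at-0 refl

θt-Eo : θ tS ≈ tS *ₛ Eo
θt-Eo = *ₛ-cancelˡ aS aS-at-0 (≈-trans θt (≈-trans (*ₛ-congˡ (≈-sym aEo))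
  (solve 3 (λ t a e → t :* (a :* e) := a :* (t :* e)) ≈-refl tS aS Eo)))

tS-at-0 : tS 0 ≡ 0ℚ
tS-at-0 = refl

+ₛ-cong[] : ∀ n {f f′ g g′} → f ≈[ n ] f′ → g ≈[ n ] g′ → f +ₛ g ≈[ n ] f′ +ₛ g′
+ₛ-cong[] n {f} {f′} {g} {g′} d e i i<n = trans (+ₛ-at f g i) (trans (cong₂ _+_ (d i i<n) (e i i<n)) (sym (+ₛ-at f′ g′ i)))

opaque
  unfolding _*ₛ_

  tail-+ₛ : ∀ f g → tail (f +ₛ g) ≈ tail f +ₛ tail g
  tail-+ₛ f g .at n = refl

  const-* : ∀ c d → const c *ₛ const d ≈ const (c · d)
  const-* c d = mk≈ λ { zero → refl ; (suc n) → trans (const-⊛ c (const d) (suc n)) (ℚP.*-zeroʳ c) }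

tail-const*ₛ : ∀ c f → tail (const c *ₛ f) ≈ const c *ₛ tail f
tail-const*ₛ c f .at n = trans (const-*ₛ c f (suc n)) (sym (const-*ₛ c (tail f) n))

tail-*ₛ : ∀ f g → tail (f *ₛ g) ≈ const (f 0) *ₛ tail g +ₛ tail f *ₛ g
tail-*ₛ f g .at n = trans (*ₛ-at-suc f g n) (sym (trans (+ₛ-at _ _ n) (cong (_+ (tail f *ₛ g) n) (const-*ₛ (f 0) (tail g) n))))

≈[]-trans : ∀ {n f g h} → f ≈[ n ] g → g ≈[ n ] h → f ≈[ n ] h
≈[]-trans d e i i<n = trans (d i i<n) (e i i<n)

tail-θ : ∀ g → tail (θ g) ≈ tail g +ₛ θ (tail g)
tail-θ g .at n = trans (θ-at g (suc n)) (trans (cong (_· g (suc n)) (nat-+ 1 n)) (trans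
  (solveℚ 2 (λ n g → (conℚ (+ 1) ⟨+⟩ n) ⟨·⟩ g ⟨=⟩ g ⟨+⟩ n ⟨·⟩ g) refl (nat n) (g (suc n)))
  (sym (trans (+ₛ-at (tail g) (θ (tail g)) n) (cong (λ z → g (suc n) + z) (θ-at (tail g) n))))))

module Compose (t : PS) (t-at-0 : t 0 ≡ 0ℚ) where

  -- Horner's scheme cut off after k steps, which makes substitution into a series a structural
  -- recursion. Because t has no constant term, a further step changes only higher coefficients.
  composeTo : ℕ → PS → PS
  composeTo zero g = const (g 0)
  composeTo (suc k) g = const (g 0) +ₛ t *ₛ composeTo k (tail g)

  -- compose g is g(t(q)).
  compose : PS → PS
  compose g n = composeTo n g n

  composeTo-stable : ∀ k g → composeTo k g ≈[ suc k ] composeTo (suc k) g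
  composeTo-stable zero g zero _ = sym (trans (+ₛ-at (const (g 0)) (t *ₛ const (g 1)) 0)
    (trans (cong (λ z → g 0 + z) (*ₛ-at-0-zero t (const (g 1)) t-at-0)) (ℚP.+-identityʳ (g 0))))
  composeTo-stable zero g (suc i) (s≤s ())
  composeTo-stable (suc k) g = +ₛ-cong[] (suc (suc k)) {const (g 0)} {const (g 0)} {t *ₛ composeTo k (tail g)} {t *ₛ composeTo (suc k) (tail g)}
    (λ _ _ → refl) (*ₛ-gain (suc k) {t} {composeTo k (tail g)} {composeTo (suc k) (tail g)} t-at-0 (composeTo-stable k (tail g)))

  compose-composeTo : ∀ k g → compose g ≈[ suc k ] composeTo k g
  compose-composeTo k g i (s≤s i≤k) with ℕP.m≤n⇒∃[o]m+o≡n i≤k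
  ... | o , refl = trans (extend o) (cong (λ m → composeTo m g i) (ℕP.+-comm o i))
    where
    extend : ∀ o → composeTo i g i ≡ composeTo (o ℕ.+ i) g i
    extend zero = refl
    extend (suc o) = trans (extend o) (composeTo-stable (o ℕ.+ i) g i (s≤s (ℕP.m≤n+m i o)))

  compose-step : ∀ g → compose g ≈ const (g 0) +ₛ t *ₛ compose (tail g)
  compose-step g .at zero = sym (trans (+ₛ-at (const (g 0)) _ 0) (trans (cong (λ z → g 0 + z) (*ₛ-at-0-zero t _ t-at-0)) (ℚP.+-identityʳ (g 0))))
  compose-step g .at (suc m) = +ₛ-cong[] (suc (suc m)) {const (g 0)} {const (g 0)} {t *ₛ composeTo m (tail g)} {t *ₛ compose (tail g)}
    (λ _ _ → refl) (*ₛ-gain (suc m) {t} {composeTo m (tail g)} {compose (tail g)} t-at-0 (λ i i<m → sym (compose-composeTo m (tail g) i i<m))) (suc m) ℕP.≤-refl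

  composeTo-cong : ∀ k {f g} → f ≈ g → composeTo k f ≈ composeTo k g
  composeTo-cong zero e = ≡⇒≈ (cong const (at e 0))
  composeTo-cong (suc k) e = +ₛ-cong (≡⇒≈ (cong const (at e 0))) (*ₛ-congˡ (composeTo-cong k (mk≈ λ n → at e (suc n))))

  compose-cong : ∀ {f g} → f ≈ g → compose f ≈ compose g
  compose-cong e .at n = at (composeTo-cong n e) n

  composeTo-+ : ∀ k f g → composeTo k (f +ₛ g) ≈ composeTo k f +ₛ composeTo k g
  composeTo-+ zero f g = ≈-trans (≡⇒≈ (cong const (+ₛ-at f g 0))) (≈-sym (const-+ (f 0) (g 0)))
  composeTo-+ (suc k) f g = ≈-trans (+ₛ-cong (≈-trans (≡⇒≈ (cong const (+ₛ-at f g 0))) (≈-sym (const-+ (f 0) (g 0))))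
      (*ₛ-congˡ (≈-trans (composeTo-cong k (tail-+ₛ f g)) (composeTo-+ k (tail f) (tail g)))))
    (solve 5 (λ a b t x y → (a :+ b) :+ t :* (x :+ y) := (a :+ t :* x) :+ (b :+ t :* y)) ≈-refl (const (f 0)) (const (g 0)) t _ _)

  compose-+ : ∀ f g → compose (f +ₛ g) ≈ compose f +ₛ compose g
  compose-+ f g .at n = trans (at (composeTo-+ n f g) n) (trans (+ₛ-at _ _ n) (sym (+ₛ-at (compose f) (compose g) n)))

  composeTo-const : ∀ k c f → composeTo k (const c *ₛ f) ≈ const c *ₛ composeTo k f
  composeTo-const zero c f = ≈-trans (≡⇒≈ (cong const (const-*ₛ c f 0))) (≈-sym (const-* c (f 0)))
  composeTo-const (suc k) c f = ≈-trans (+ₛ-cong (≈-trans (≡⇒≈ (cong const (const-*ₛ c f 0))) (≈-sym (const-* c (f 0))))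
      (*ₛ-congˡ (≈-trans (composeTo-cong k (tail-const*ₛ c f)) (composeTo-const k c (tail f)))))
    (solve 4 (λ c a t x → c :* a :+ t :* (c :* x) := c :* (a :+ t :* x)) ≈-refl (const c) (const (f 0)) t _)

  compose-const : ∀ c f → compose (const c *ₛ f) ≈ const c *ₛ compose f
  compose-const c f .at n = trans (at (composeTo-const n c f) n) (trans (const-*ₛ c _ n) (sym (const-*ₛ c (compose f) n)))

  compose-K : ∀ z f → compose (K z *ₛ f) ≈ K z *ₛ compose f
  compose-K z f = ≈-trans (compose-cong (*ₛ-congʳ (≡⇒≈ (K-def z)))) (≈-trans (compose-const (ι z) f) (*ₛ-congʳ (≡⇒≈ (sym (K-def z)))))

  -- The tail of a product is f(0) · tail g + tail f · g, so the induction has to range over all f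
  -- and g at precision n; the factor t in front of the tail raises the precision to n + 1.
  compose-*[] : ∀ n f g → compose (f *ₛ g) ≈[ n ] compose f *ₛ compose g
  compose-*[] (suc n) f g = ≈[]-trans {suc n} {compose (f *ₛ g)} {const (f 0) *ₛ const (g 0) +ₛ t *ₛ compose (const (f 0) *ₛ tail g +ₛ tail f *ₛ g)}
    (≈⇒≈[] (suc n) (≈-trans (compose-step (f *ₛ g)) (+ₛ-cong (≈-trans (≡⇒≈ (cong const (*ₛ-at-0 f g))) (≈-sym (const-* (f 0) (g 0))))
      (*ₛ-congˡ (compose-cong (tail-*ₛ f g))))))
    (≈[]-trans {suc n} {_} {const (f 0) *ₛ const (g 0) +ₛ t *ₛ (const (f 0) *ₛ compose (tail g) +ₛ compose (tail f) *ₛ compose g)}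
      (+ₛ-cong[] (suc n) {const (f 0) *ₛ const (g 0)} {const (f 0) *ₛ const (g 0)} (λ _ _ → refl)
        (*ₛ-gain n {t} {compose (const (f 0) *ₛ tail g +ₛ tail f *ₛ g)} {const (f 0) *ₛ compose (tail g) +ₛ compose (tail f) *ₛ compose g} t-at-0
          (≈[]-trans {n} {compose (const (f 0) *ₛ tail g +ₛ tail f *ₛ g)} {const (f 0) *ₛ compose (tail g) +ₛ compose (tail f *ₛ g)}
            (≈⇒≈[] n (≈-trans (compose-+ _ _) (+ₛ-congʳ (compose-const (f 0) (tail g)))))
            (+ₛ-cong[] n {const (f 0) *ₛ compose (tail g)} {const (f 0) *ₛ compose (tail g)} {compose (tail f *ₛ g)} {compose (tail f) *ₛ compose g}
              (λ _ _ → refl) (compose-*[] n (tail f) g)))))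
      (≈⇒≈[] (suc n) (≈-trans
        (solve 6 (λ a b t x y z → a :* b :+ t :* (a :* x :+ y :* z) := a :* (b :+ t :* x) :+ t :* y :* z) ≈-refl
          (const (f 0)) (const (g 0)) t (compose (tail g)) (compose (tail f)) (compose g))
        (≈-trans (+ₛ-congʳ (*ₛ-congˡ (≈-sym (compose-step g))))
        (≈-trans (solve 4 (λ a t y z → a :* z :+ t :* y :* z := (a :+ t :* y) :* z) ≈-refl (const (f 0)) t (compose (tail f)) (compose g))
          (*ₛ-congʳ (≈-sym (compose-step f))))))))

  compose-* : ∀ f g → compose (f *ₛ g) ≈ compose f *ₛ compose g
  compose-* f g = ≈[]⇒≈ (λ n → compose-*[] n f g)

  -- The chain rule with E = θt/t. On the right, θ acts on the coefficients of g, where it stands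
  -- for t d/dt.
  θ-compose[] : ∀ {E} → θ t ≈ t *ₛ E → ∀ n g → θ (compose g) ≈[ n ] E *ₛ compose (θ g)
  θ-compose[] {E} θt (suc n) g = ≈[]-trans {suc n} {θ (compose g)} {t *ₛ (E *ₛ c +ₛ θ c)}
    (≈⇒≈[] (suc n) (≈-trans (θ-cong (compose-step g)) (≈-trans (θ-+ₛ _ _) (≈-trans (+ₛ-cong (θ-const (g 0)) (≈-trans (θ-*ₛ t c) (+ₛ-congʳ (*ₛ-congʳ θt))))
      (≈-trans (PSR.+-identityˡ _) (solve 4 (λ t e c d → t :* e :* c :+ t :* d := t :* (e :* c :+ d)) ≈-refl t E c (θ c)))))))
    (≈[]-trans {suc n} {_} {t *ₛ (E *ₛ c +ₛ E *ₛ compose (θ (tail g)))}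
      (*ₛ-gain n {t} {E *ₛ c +ₛ θ c} {E *ₛ c +ₛ E *ₛ compose (θ (tail g))} t-at-0
        (+ₛ-cong[] n {E *ₛ c} {E *ₛ c} {θ c} {E *ₛ compose (θ (tail g))} (λ _ _ → refl) (θ-compose[] θt n (tail g))))
      (≈⇒≈[] (suc n) (≈-trans (solve 4 (λ t e c d → t :* (e :* c :+ e :* d) := e :* (t :* (c :+ d))) ≈-refl t E c (compose (θ (tail g))))
        (*ₛ-congˡ (≈-trans (*ₛ-congˡ (≈-trans (≈-sym (compose-+ (tail g) (θ (tail g)))) (compose-cong (≈-sym (tail-θ g)))))
          (≈-trans (≈-sym (PSR.+-identityˡ _)) (≈-trans (+ₛ-congʳ (≡⇒≈ (cong const (sym (trans (θ-at g 0) (zero-· (g 0) ι-0))))))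
            (≈-sym (compose-step (θ g))))))))))
    where
    c : PS
    c = compose (tail g)

  θ-compose : ∀ {E} → θ t ≈ t *ₛ E → ∀ g → θ (compose g) ≈ E *ₛ compose (θ g)
  θ-compose θt g = ≈[]⇒≈ (λ n → θ-compose[] θt n g)

  compose-X : ∀ f → compose (X *ₛ f) ≈ t *ₛ compose f
  compose-X f = ≈-trans (compose-step (X *ₛ f)) (≈-trans (+ₛ-cong (≡⇒≈ (cong const (X-*ₛ-zero f))) (*ₛ-congˡ (compose-cong (mk≈ (X-*ₛ-suc f)))))
    (PSR.+-identityˡ _))

-- The hypergeometric equation

-- Three series y₀, y₁, y₂ standing for y, D y, D² y with D = t d/dt.
record HypergeometricODE (y₀ y₁ y₂ : PS) : Set where
  field
    first : aS *ₛ θ y₀ ≈ δS *ₛ y₁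
    second : aS *ₛ θ y₁ ≈ δS *ₛ y₂
    equation : y₂ ≈ tS *ₛ (K (+ 108) *ₛ y₂ +ₛ K (+ 54) *ₛ y₁ +ₛ K (+ 6) *ₛ y₀)
open HypergeometricODE

ODE-difference : ∀ {y₀ y₁ y₂ z₀ z₁ z₂} → HypergeometricODE y₀ y₁ y₂ → HypergeometricODE z₀ z₁ z₂ →
  HypergeometricODE (y₀ -ₛ z₀) (y₁ -ₛ z₁) (y₂ -ₛ z₂)
ODE-difference {y₀} {y₁} {y₂} {z₀} {z₁} {z₂} Y Z = record
  { first = linear y₀ z₀ y₁ z₁ (first Y) (first Z)
  ; second = linear y₁ z₁ y₂ z₂ (second Y) (second Z)
  ; equation = ≈-trans (-ₛ-cong (equation Y) (equation Z))
      (solve 7 (λ t y₀ y₁ y₂ z₀ z₁ z₂ → t :* (# 108 :* y₂ :+ # 54 :* y₁ :+ # 6 :* y₀) :- t :* (# 108 :* z₂ :+ # 54 :* z₁ :+ # 6 :* z₀)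
        := t :* (# 108 :* (y₂ :- z₂) :+ # 54 :* (y₁ :- z₁) :+ # 6 :* (y₀ :- z₀))) ≈-refl tS y₀ y₁ y₂ z₀ z₁ z₂) }
  where
  linear : ∀ y z y′ z′ → aS *ₛ θ y ≈ δS *ₛ y′ → aS *ₛ θ z ≈ δS *ₛ z′ → aS *ₛ θ (y -ₛ z) ≈ δS *ₛ (y′ -ₛ z′)
  linear y z y′ z′ d e = ≈-trans (*ₛ-congˡ (θ--ₛ y z)) (≈-trans (solve 3 (λ a x y → a :* (x :- y) := a :* x :- a :* y) ≈-refl aS (θ y) (θ z))
    (≈-trans (-ₛ-cong d e) (solve 3 (λ a x y → a :* x :- a :* y := a :* (x :- y)) ≈-refl δS y′ z′)))

-- The factor t makes coefficient n of y₂ depend on lower coefficients only; then n [y₁] = [y₂] and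
-- n [y₀] = [y₁] settle every n ≥ 1. The exponent 0 is double at the origin, so the constant term of
-- y₀ is the only freedom.
ODE-unique : ∀ {y₀ y₁ y₂} → HypergeometricODE y₀ y₁ y₂ → y₀ 0 ≡ 0ℚ → y₀ ≈ zeroS
ODE-unique {y₀} {y₁} {y₂} Y y₀0 = ≈[]⇒≈ (λ n → proj₁ (vanish n))
  where
  Vanish : ℕ → Set
  Vanish n = (y₀ ≈[ n ] zeroS) × (y₁ ≈[ n ] zeroS) × (y₂ ≈[ n ] zeroS)
  θ-zero[] : ∀ n {y} → y ≈[ n ] zeroS → θ y ≈[ n ] zeroS
  θ-zero[] n {y} e i i<n = trans (θ-at y i) (trans (cong (λ z → nat i · z) (trans (e i i<n) (zeroS-at i))) (trans (ℚP.*-zeroʳ (nat i)) (sym (zeroS-at i))))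
  leading : ∀ n {y y′} → aS *ₛ θ y ≈ δS *ₛ y′ → y ≈[ n ] zeroS → y′ ≈[ n ] zeroS → nat n · y n ≡ y′ n
  leading n {y} {y′} e d d′ = begin
    nat n · y n ≡⟨ sym (θ-at y n) ⟩
    θ y n ≡⟨ sym (one-· (θ y n) aS-at-0) ⟩
    aS 0 · θ y n ≡⟨ sym (*ₛ-leading aS (θ y) n (θ-zero[] n d)) ⟩
    (aS *ₛ θ y) n ≡⟨ at e n ⟩
    (δS *ₛ y′) n ≡⟨ *ₛ-leading δS y′ n d′ ⟩
    δS 0 · y′ n ≡⟨ one-· (y′ n) δS-at-0 ⟩
    y′ n ∎
    where open ≡-Reasoning
  extend : ∀ n {y} → y ≈[ n ] zeroS → y n ≡ 0ℚ → y ≈[ suc n ] zeroS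
  extend n e yn i (s≤s i≤n) with ℕP.m≤n⇒m<n∨m≡n i≤n
  ... | inj₁ i<n = e i i<n
  ... | inj₂ refl = trans yn (sym (zeroS-at i))
  backward : ∀ n {y y′} → aS *ₛ θ y ≈ δS *ₛ y′ → y 0 ≡ 0ℚ → y ≈[ n ] zeroS → y′ ≈[ n ] zeroS → y′ n ≡ 0ℚ → y n ≡ 0ℚ
  backward zero e y0 _ _ _ = y0
  backward (suc n) e y0 d d′ y′n = nat-suc-cancel n (trans (leading (suc n) e d d′) (trans y′n (sym (ℚP.*-zeroʳ (nat (suc n))))))
  y₁0 : y₁ 0 ≡ 0ℚ
  y₁0 = trans (sym (leading 0 (first Y) (λ _ ()) (λ _ ()))) (zero-· (y₀ 0) ι-0)
  vanish : ∀ n → Vanish n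
  vanish zero = (λ _ ()) , (λ _ ()) , (λ _ ())
  vanish (suc n) with vanish n
  ... | v₀ , v₁ , v₂ = extend n v₀ y₀n , extend n v₁ y₁n , extend n v₂ y₂n
    where
    combination : K (+ 108) *ₛ y₂ +ₛ K (+ 54) *ₛ y₁ +ₛ K (+ 6) *ₛ y₀ ≈[ n ] zeroS
    combination i i<n = trans (+ₛ-cong[] n {_} {K (+ 108) *ₛ zeroS +ₛ K (+ 54) *ₛ zeroS} {_} {K (+ 6) *ₛ zeroS}
      (+ₛ-cong[] n {_} {K (+ 108) *ₛ zeroS} {_} {K (+ 54) *ₛ zeroS}
         (*ₛ-cong[] n {K (+ 108)} {K (+ 108)} (λ _ _ → refl) v₂) (*ₛ-cong[] n {K (+ 54)} {K (+ 54)} (λ _ _ → refl) v₁))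
         (*ₛ-cong[] n {K (+ 6)} {K (+ 6)} (λ _ _ → refl) v₀) i i<n)
      (at (≈-trans (+ₛ-cong (≈-trans (+ₛ-cong (PSR.zeroʳ _) (PSR.zeroʳ _)) (PSR.+-identityˡ zeroS)) (PSR.zeroʳ _)) (PSR.+-identityˡ zeroS)) i)
    y₂n : y₂ n ≡ 0ℚ
    y₂n = trans (at (equation Y) n) (trans (*ₛ-leading tS _ n combination) (zero-· ((K (+ 108) *ₛ y₂ +ₛ K (+ 54) *ₛ y₁ +ₛ K (+ 6) *ₛ y₀) n) tS-at-0))
    y₁n : y₁ n ≡ 0ℚ
    y₁n = backward n (second Y) y₁0 v₁ v₂ y₂n
    y₀n : y₀ n ≡ 0ℚ
    y₀n = backward n (first Y) y₀0 v₀ v₁ y₁n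

open Compose tS tS-at-0

-- D a and D² a: since θ = (δ/a) D for functions of t, the operator D = t d/dt acts on q-series as
-- (a/δ) θ.
aS₁ aS₂ : PS
aS₁ = inv1 δS *ₛ (aS *ₛ θ aS)
aS₂ = inv1 δS *ₛ (aS *ₛ θ aS₁)

δ-inv1 : ∀ x → δS *ₛ (inv1 δS *ₛ x) ≈ x
δ-inv1 x = ≈-trans (≈-sym (PSR.*-assoc δS (inv1 δS) x)) (≈-trans (*ₛ-congʳ (*ₛ-inv1 δS δS-at-0)) (PSR.*-identityˡ x))

δaS₁ : δS *ₛ aS₁ ≈ aS *ₛ θ aS
δaS₁ = δ-inv1 (aS *ₛ θ aS)

δaS₂ : δS *ₛ aS₂ ≈ aS *ₛ θ aS₁
δaS₂ = δ-inv1 (aS *ₛ θ aS₁)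

-- With this and β = a³ - γ, all series become polynomials in a, γ and P-, a ring in which θ acts
-- with rational coefficients. The differential equation for a thus reduces to a polynomial
-- identity.
Pp-a² : PpS ≈ PmS +ₛ K (+ 2) *ₛ (aS *ₛ aS)
Pp-a² = ≈-trans Pp-Pm (+ₛ-congˡ (*ₛ-congˡ (≈-sym a²)))

2θδ : K (+ 2) *ₛ θ δS ≈ (aS *ₛ (aS *ₛ aS) -ₛ K (+ 2) *ₛ γS) *ₛ PmS -ₛ K (+ 2) *ₛ (aS *ₛ aS *ₛ γS)
2θδ = begin
  K (+ 2) *ₛ θ δS
    ≈⟨ ≈-trans (*ₛ-congˡ (θ--ₛ βS γS)) (solve 2 (λ x y → # 2 :* (x :- y) := # 2 :* x :- # 2 :* y) ≈-refl (θ βS) (θ γS)) ⟩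
  K (+ 2) *ₛ θ βS -ₛ K (+ 2) *ₛ θ γS
    ≈⟨ -ₛ-cong θβ θγ ⟩
  βS *ₛ PmS -ₛ γS *ₛ PpS
    ≈⟨ -ₛ-cong (*ₛ-congʳ β-as-difference) (*ₛ-congˡ Pp-a²) ⟩
  (aS *ₛ (aS *ₛ aS) -ₛ γS) *ₛ PmS -ₛ γS *ₛ (PmS +ₛ K (+ 2) *ₛ (aS *ₛ aS))
    ≈⟨ solve 3 (λ a g p → (a :* (a :* a) :- g) :* p :- g :* (p :+ # 2 :* (a :* a)) := (a :* (a :* a) :- # 2 :* g) :* p :- # 2 :* (a :* a :* g)) ≈-refl aS γS PmS ⟩
  (aS *ₛ (aS *ₛ aS) -ₛ K (+ 2) *ₛ γS) *ₛ PmS -ₛ K (+ 2) *ₛ (aS *ₛ aS *ₛ γS) ∎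
  where open ≈-Reasoning

-- From `θPm+θPp` alone only the sum of the two derivatives is known; their difference is 2 θA = 4 a
-- θa, supplied by `θa-0`.
6θPm : K (+ 6) *ₛ θ PmS ≈ PmS *ₛ PmS -ₛ K (+ 4) *ₛ (aS *ₛ γS)
6θPm = begin
  K (+ 6) *ₛ θ PmS
    ≈⟨ solve 3 (λ x y z → # 6 :* x := # 3 :* (x :+ (x :+ # 2 :* y)) :- # 6 :* y) ≈-refl (θ PmS) (θ AS) (θ PpS) ⟩
  K (+ 3) *ₛ (θ PmS +ₛ (θ PmS +ₛ K (+ 2) *ₛ θ AS)) -ₛ K (+ 6) *ₛ θ AS
    ≈⟨ -ₛ-cong (≈-trans (*ₛ-congˡ (+ₛ-congˡ (≈-sym (≈-trans (θ-cong Pp-Pm) (≈-trans (θ-+ₛ PmS _) (+ₛ-congˡ (θ-K (+ 2) AS))))))) θPm+θPp)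
         (*ₛ-congˡ (≈-trans (θ-cong (≈-sym a²)) (θ-*ₛ aS aS))) ⟩
  PmS *ₛ PpS -ₛ K (+ 6) *ₛ (θ aS *ₛ aS +ₛ aS *ₛ θ aS)
    ≈⟨ ≈-trans (-ₛ-cong (*ₛ-congˡ Pp-a²) ≈-refl) (solve 3 (λ p a x → p :* (p :+ # 2 :* (a :* a)) :- # 6 :* (x :* a :+ a :* x)
         := p :* (p :+ # 2 :* (a :* a)) :- # 2 :* (a :* (# 6 :* x))) ≈-refl PmS aS (θ aS)) ⟩
  PmS *ₛ (PmS +ₛ K (+ 2) *ₛ (aS *ₛ aS)) -ₛ K (+ 2) *ₛ (aS *ₛ (K (+ 6) *ₛ θ aS))
    ≈⟨ -ₛ-cong ≈-refl (*ₛ-congˡ (*ₛ-congˡ θa-0)) ⟩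
  PmS *ₛ (PmS +ₛ K (+ 2) *ₛ (aS *ₛ aS)) -ₛ K (+ 2) *ₛ (aS *ₛ (aS *ₛ PmS +ₛ K (+ 2) *ₛ γS))
    ≈⟨ solve 3 (λ p a g → p :* (p :+ # 2 :* (a :* a)) :- # 2 :* (a :* (a :* p :+ # 2 :* g)) := p :* p :- # 4 :* (a :* g)) ≈-refl PmS aS γS ⟩
  PmS *ₛ PmS -ₛ K (+ 4) *ₛ (aS *ₛ γS) ∎
  where open ≈-Reasoning

18θ²a : K (+ 18) *ₛ θ (θ aS) ≈ aS *ₛ PmS *ₛ PmS +ₛ K (+ 4) *ₛ (γS *ₛ PmS) +ₛ K (+ 4) *ₛ (aS *ₛ aS *ₛ γS)
18θ²a = K-suc-cancel 1 (begin
  K (+ 2) *ₛ (K (+ 18) *ₛ θ (θ aS))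
    ≈⟨ ≈-trans (solve 1 (λ x → # 2 :* (# 18 :* x) := # 6 :* (# 6 :* x)) ≈-refl (θ (θ aS)))
         (*ₛ-congˡ (≈-trans (≈-sym (θ-K (+ 6) (θ aS))) (≈-trans (θ-cong θa-0) (≈-trans (θ-+ₛ _ _) (+ₛ-cong (θ-*ₛ aS PmS) (θ-K (+ 2) γS)))))) ⟩
  K (+ 6) *ₛ (θ aS *ₛ PmS +ₛ aS *ₛ θ PmS +ₛ K (+ 2) *ₛ θ γS)
    ≈⟨ solve 5 (λ x p a y z → # 6 :* (x :* p :+ a :* y :+ # 2 :* z) := # 6 :* x :* p :+ a :* (# 6 :* y) :+ # 6 :* (# 2 :* z)) ≈-refl (θ aS) PmS aS (θ PmS) (θ γS) ⟩
  K (+ 6) *ₛ θ aS *ₛ PmS +ₛ aS *ₛ (K (+ 6) *ₛ θ PmS) +ₛ K (+ 6) *ₛ (K (+ 2) *ₛ θ γS)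
    ≈⟨ +ₛ-cong (+ₛ-cong (*ₛ-congʳ θa-0) (*ₛ-congˡ 6θPm)) (*ₛ-congˡ (≈-trans θγ (*ₛ-congˡ Pp-a²))) ⟩
  (aS *ₛ PmS +ₛ K (+ 2) *ₛ γS) *ₛ PmS +ₛ aS *ₛ (PmS *ₛ PmS -ₛ K (+ 4) *ₛ (aS *ₛ γS)) +ₛ K (+ 6) *ₛ (γS *ₛ (PmS +ₛ K (+ 2) *ₛ (aS *ₛ aS)))
    ≈⟨ solve 3 (λ a p g → (a :* p :+ # 2 :* g) :* p :+ a :* (p :* p :- # 4 :* (a :* g)) :+ # 6 :* (g :* (p :+ # 2 :* (a :* a)))
         := # 2 :* (a :* p :* p :+ # 4 :* (g :* p) :+ # 4 :* (a :* a :* g))) ≈-refl aS PmS γS ⟩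
  K (+ 2) *ₛ (aS *ₛ PmS *ₛ PmS +ₛ K (+ 4) *ₛ (γS *ₛ PmS) +ₛ K (+ 4) *ₛ (aS *ₛ aS *ₛ γS)) ∎)
  where open ≈-Reasoning

δ-as-a : δS ≈ aS *ₛ (aS *ₛ aS) -ₛ K (+ 2) *ₛ γS
δ-as-a = ≈-trans (-ₛ-cong β-as-difference ≈-refl) (solve 2 (λ x g → x :- g :- g := x :- # 2 :* g) ≈-refl (aS *ₛ (aS *ₛ aS)) γS)

-- Second derivative of a along t, cleared of denominators; a³ = β + γ turns it into a polynomial identity in a, γ and P−.
δ³aS₂ : K (+ 36) *ₛ (δS *ₛ (δS *ₛ (δS *ₛ aS₂)))
      ≈ K (+ 72) *ₛ (βS *ₛ γS *ₛ (δS *ₛ aS₁)) +ₛ K (+ 8) *ₛ (βS *ₛ γS *ₛ (δS *ₛ aS))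
δ³aS₂ = begin
  K (+ 36) *ₛ (δS *ₛ (δS *ₛ (δS *ₛ aS₂)))
    ≈⟨ *ₛ-congˡ (*ₛ-congˡ (*ₛ-congˡ δaS₂)) ⟩
  K (+ 36) *ₛ (δS *ₛ (δS *ₛ (aS *ₛ θ aS₁)))
    -- The product rule read backwards: only δ · D a = a θa is free of division, so δ θ(D a) is
    -- replaced by θ(δ · D a) - θδ · D a.
    ≈⟨ solve 5 (λ d a x y b → # 36 :* (d :* (d :* (a :* x))) := # 36 :* (d :* (a :* (y :* b :+ d :* x))) :- # 36 :* (a :* y :* (d :* b))) ≈-refl δS aS (θ aS₁) (θ δS) aS₁ ⟩
  K (+ 36) *ₛ (δS *ₛ (aS *ₛ (θ δS *ₛ aS₁ +ₛ δS *ₛ θ aS₁))) -ₛ K (+ 36) *ₛ (aS *ₛ θ δS *ₛ (δS *ₛ aS₁))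
    ≈⟨ -ₛ-cong (*ₛ-congˡ (*ₛ-congˡ (*ₛ-congˡ (≈-trans (≈-sym (θ-*ₛ δS aS₁)) (≈-trans (θ-cong δaS₁) (θ-*ₛ aS (θ aS))))))) (*ₛ-congˡ (*ₛ-congˡ δaS₁)) ⟩
  K (+ 36) *ₛ (δS *ₛ (aS *ₛ (θ aS *ₛ θ aS +ₛ aS *ₛ θ (θ aS)))) -ₛ K (+ 36) *ₛ (aS *ₛ θ δS *ₛ (aS *ₛ θ aS))
    ≈⟨ solve 5 (λ d a x y z → # 36 :* (d :* (a :* (x :* x :+ a :* y))) :- # 36 :* (a :* z :* (a :* x))
         := d :* (a :* ((# 6 :* x) :* (# 6 :* x) :+ # 2 :* (a :* (# 18 :* y)))) :- # 3 :* (a :* (# 2 :* z) :* (a :* (# 6 :* x))))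
         ≈-refl δS aS (θ aS) (θ (θ aS)) (θ δS) ⟩
  δS *ₛ (aS *ₛ (K (+ 6) *ₛ θ aS *ₛ (K (+ 6) *ₛ θ aS) +ₛ K (+ 2) *ₛ (aS *ₛ (K (+ 18) *ₛ θ (θ aS)))))
    -ₛ K (+ 3) *ₛ (aS *ₛ (K (+ 2) *ₛ θ δS) *ₛ (aS *ₛ (K (+ 6) *ₛ θ aS)))
    ≈⟨ -ₛ-cong (*ₛ-cong δ-as-a (*ₛ-congˡ (+ₛ-cong (*ₛ-cong θa-0 θa-0) (*ₛ-congˡ (*ₛ-congˡ 18θ²a)))))
         (*ₛ-congˡ (*ₛ-cong (*ₛ-congˡ 2θδ) (*ₛ-congˡ θa-0))) ⟩
  (aS *ₛ (aS *ₛ aS) -ₛ K (+ 2) *ₛ γS) *ₛ (aS *ₛ ((aS *ₛ PmS +ₛ K (+ 2) *ₛ γS) *ₛ (aS *ₛ PmS +ₛ K (+ 2) *ₛ γS)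
       +ₛ K (+ 2) *ₛ (aS *ₛ (aS *ₛ PmS *ₛ PmS +ₛ K (+ 4) *ₛ (γS *ₛ PmS) +ₛ K (+ 4) *ₛ (aS *ₛ aS *ₛ γS)))))
    -ₛ K (+ 3) *ₛ (aS *ₛ ((aS *ₛ (aS *ₛ aS) -ₛ K (+ 2) *ₛ γS) *ₛ PmS -ₛ K (+ 2) *ₛ (aS *ₛ aS *ₛ γS)) *ₛ (aS *ₛ (aS *ₛ PmS +ₛ K (+ 2) *ₛ γS)))
    ≈⟨ solve 3 (λ a p g → let c = a :* (a :* a) ; x = a :* p :+ # 2 :* g ; d = c :- # 2 :* g in
         d :* (a :* (x :* x :+ # 2 :* (a :* (a :* p :* p :+ # 4 :* (g :* p) :+ # 4 :* (a :* a :* g)))))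
           :- # 3 :* (a :* (d :* p :- # 2 :* (a :* a :* g)) :* (a :* x))
         := # 12 :* ((c :- g) :* g :* (a :* x)) :+ # 8 :* ((c :- g) :* g :* (d :* a))) ≈-refl aS PmS γS ⟩
  K (+ 12) *ₛ ((aS *ₛ (aS *ₛ aS) -ₛ γS) *ₛ γS *ₛ (aS *ₛ (aS *ₛ PmS +ₛ K (+ 2) *ₛ γS)))
    +ₛ K (+ 8) *ₛ ((aS *ₛ (aS *ₛ aS) -ₛ γS) *ₛ γS *ₛ ((aS *ₛ (aS *ₛ aS) -ₛ K (+ 2) *ₛ γS) *ₛ aS))
    ≈⟨ +ₛ-cong (*ₛ-congˡ (*ₛ-cong (*ₛ-congʳ (≈-sym β-as-difference)) (*ₛ-congˡ (≈-sym θa-0))))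
         (*ₛ-congˡ (*ₛ-cong (*ₛ-congʳ (≈-sym β-as-difference)) (*ₛ-congʳ (≈-sym δ-as-a)))) ⟩
  K (+ 12) *ₛ (βS *ₛ γS *ₛ (aS *ₛ (K (+ 6) *ₛ θ aS))) +ₛ K (+ 8) *ₛ (βS *ₛ γS *ₛ (δS *ₛ aS))
    ≈⟨ +ₛ-congʳ (≈-trans (solve 3 (λ w a x → # 12 :* (w :* (a :* (# 6 :* x))) := # 72 :* (w :* (a :* x))) ≈-refl (βS *ₛ γS) aS (θ aS))
         (*ₛ-congˡ (*ₛ-congˡ (≈-sym δaS₁)))) ⟩
  K (+ 72) *ₛ (βS *ₛ γS *ₛ (δS *ₛ aS₁)) +ₛ K (+ 8) *ₛ (βS *ₛ γS *ₛ (δS *ₛ aS)) ∎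
  where open ≈-Reasoning

-- Since (β + γ)² = (β - γ)² + 4 β γ, the identity `δ³aS₂` becomes one for s² D² a, and β γ = 27 t
-- s² introduces t. The coefficients are 144 · 27/36 = 108, 72 · 27/36 = 54 and 8 · 27/36 = 6.
aS-equation : aS₂ ≈ tS *ₛ (K (+ 108) *ₛ aS₂ +ₛ K (+ 54) *ₛ aS₁ +ₛ K (+ 6) *ₛ aS)
aS-equation = *ₛ-cancelˡ (sS *ₛ sS) (*ₛ-at-0-one sS sS sS-at-0 sS-at-0) (*ₛ-cancelˡ δS δS-at-0 (K-suc-cancel 35 (begin
  K (+ 36) *ₛ (δS *ₛ (sS *ₛ sS *ₛ aS₂))
    ≈⟨ solve 3 (λ b g y → # 36 :* ((b :- g) :* ((b :+ g) :* (b :+ g) :* y)) := # 36 :* ((b :- g) :* ((b :- g) :* ((b :- g) :* y))) :+ # 144 :* (b :* g :* ((b :- g) :* y))) ≈-refl βS γS aS₂ ⟩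
  K (+ 36) *ₛ (δS *ₛ (δS *ₛ (δS *ₛ aS₂))) +ₛ K (+ 144) *ₛ (βS *ₛ γS *ₛ (δS *ₛ aS₂))
    ≈⟨ +ₛ-congʳ δ³aS₂ ⟩
  K (+ 72) *ₛ (βS *ₛ γS *ₛ (δS *ₛ aS₁)) +ₛ K (+ 8) *ₛ (βS *ₛ γS *ₛ (δS *ₛ aS)) +ₛ K (+ 144) *ₛ (βS *ₛ γS *ₛ (δS *ₛ aS₂))
    ≈⟨ +ₛ-cong (+ₛ-cong (*ₛ-congˡ (*ₛ-congʳ (≈-sym 27ts²))) (*ₛ-congˡ (*ₛ-congʳ (≈-sym 27ts²)))) (*ₛ-congˡ (*ₛ-congʳ (≈-sym 27ts²))) ⟩
  K (+ 72) *ₛ (K (+ 27) *ₛ (tS *ₛ (sS *ₛ sS)) *ₛ (δS *ₛ aS₁)) +ₛ K (+ 8) *ₛ (K (+ 27) *ₛ (tS *ₛ (sS *ₛ sS)) *ₛ (δS *ₛ aS)) +ₛ K (+ 144) *ₛ (K (+ 27) *ₛ (tS *ₛ (sS *ₛ sS)) *ₛ (δS *ₛ aS₂))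
    ≈⟨ solve 6 (λ t s d x y z → # 72 :* (# 27 :* (t :* (s :* s)) :* (d :* y)) :+ # 8 :* (# 27 :* (t :* (s :* s)) :* (d :* x)) :+ # 144 :* (# 27 :* (t :* (s :* s)) :* (d :* z))
         := # 36 :* (d :* (s :* s :* (t :* (# 108 :* z :+ # 54 :* y :+ # 6 :* x))))) ≈-refl tS sS δS aS aS₁ aS₂ ⟩
  K (+ 36) *ₛ (δS *ₛ (sS *ₛ sS *ₛ (tS *ₛ (K (+ 108) *ₛ aS₂ +ₛ K (+ 54) *ₛ aS₁ +ₛ K (+ 6) *ₛ aS)))) ∎)))
  where open ≈-Reasoning

aS-ODE : HypergeometricODE aS aS₁ aS₂
aS-ODE = record { first = ≈-sym δaS₁ ; second = ≈-sym δaS₂ ; equation = aS-equation }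

rescale : PS → PS
rescale f n = nat (108 ℕ.^ n) · f n

hyp : PS
hyp = rescale F21

-- The ratio of consecutive coefficients, after rescaling by 108^n, is 108 (n + 1/6)(n + 1/3)/(n +
-- 1)², and 108 (n + 1/6)(n + 1/3) = 6 (6 n + 1)(3 n + 1) = 108 n² + 54 n + 6.
hyp-suc : ∀ n → nat (suc n) · (nat (suc n) · hyp (suc n)) ≡ ι (+ 108) · (nat n · (nat n · hyp n)) + ι (+ 54) · (nat n · hyp n) + ι (+ 6) · hyp n
hyp-suc n = begin
  N · (N · (nat (108 ℕ.* 108 ℕ.^ n) · (p₁ · (s + fromℕ n) · (p₂ · (r + fromℕ n)) · (i · (+ 1 / suc n) · (i · (+ 1 / suc n))))))
    ≡⟨ cong₂ (λ w z → N · (N · (w · (p₁ · (s + z) · (p₂ · (r + z)) · (i · (+ 1 / suc n) · (i · (+ 1 / suc n))))))) (nat-* 108 (108 ℕ.^ n)) (fromℕ-def n) ⟩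
  N · (N · (ι (+ 108) · m · (p₁ · (s + k) · (p₂ · (r + k)) · (i · (+ 1 / suc n) · (i · (+ 1 / suc n))))))
    ≡⟨ cong (λ w → N · (N · (ι (+ 108) · m · (p₁ · (s + k) · (p₂ · (r + k)) · (i · w · (i · w)))))) (sym (recip-def n)) ⟩
  N · (N · (ι (+ 108) · m · (p₁ · (s + k) · (p₂ · (r + k)) · (i · recip n · (i · recip n)))))
    ≡⟨ solveℚ 9 (λ N R m p₁ p₂ i s r k → N ⟨·⟩ (N ⟨·⟩ (conℚ (+ 108) ⟨·⟩ m ⟨·⟩ (p₁ ⟨·⟩ (s ⟨+⟩ k) ⟨·⟩ (p₂ ⟨·⟩ (r ⟨+⟩ k)) ⟨·⟩ (i ⟨·⟩ R ⟨·⟩ (i ⟨·⟩ R)))))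
         ⟨=⟩ (N ⟨·⟩ R) ⟨·⟩ (N ⟨·⟩ R) ⟨·⟩ conℚ (+ 6) ⟨·⟩ (conℚ (+ 6) ⟨·⟩ s ⟨+⟩ conℚ (+ 6) ⟨·⟩ k) ⟨·⟩ (conℚ (+ 3) ⟨·⟩ r ⟨+⟩ conℚ (+ 3) ⟨·⟩ k) ⟨·⟩ (m ⟨·⟩ (p₁ ⟨·⟩ p₂ ⟨·⟩ (i ⟨·⟩ i)))) refl
         N (recip n) m p₁ p₂ i s r k ⟩
  (N · recip n) · (N · recip n) · ι (+ 6) · (ι (+ 6) · s + ι (+ 6) · k) · (ι (+ 3) · r + ι (+ 3) · k) · hyp n
    ≡⟨ cong₂ (λ a b → a · a · ι (+ 6) · (b + ι (+ 6) · k) · (ι (+ 3) · r + ι (+ 3) · k) · hyp n) (trans (recip-inverse n) (sym ι-1)) sixth ⟩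
  ι (+ 1) · ι (+ 1) · ι (+ 6) · (ι (+ 1) + ι (+ 6) · k) · (ι (+ 3) · r + ι (+ 3) · k) · hyp n
    ≡⟨ cong (λ b → ι (+ 1) · ι (+ 1) · ι (+ 6) · (ι (+ 1) + ι (+ 6) · k) · (b + ι (+ 3) · k) · hyp n) third ⟩
  ι (+ 1) · ι (+ 1) · ι (+ 6) · (ι (+ 1) + ι (+ 6) · k) · (ι (+ 1) + ι (+ 3) · k) · hyp n
    ≡⟨ solveℚ 2 (λ k h → conℚ (+ 1) ⟨·⟩ conℚ (+ 1) ⟨·⟩ conℚ (+ 6) ⟨·⟩ (conℚ (+ 1) ⟨+⟩ conℚ (+ 6) ⟨·⟩ k) ⟨·⟩ (conℚ (+ 1) ⟨+⟩ conℚ (+ 3) ⟨·⟩ k) ⟨·⟩ h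
         ⟨=⟩ conℚ (+ 108) ⟨·⟩ (k ⟨·⟩ (k ⟨·⟩ h)) ⟨+⟩ conℚ (+ 54) ⟨·⟩ (k ⟨·⟩ h) ⟨+⟩ conℚ (+ 6) ⟨·⟩ h) refl k (hyp n) ⟩
  ι (+ 108) · (k · (k · hyp n)) + ι (+ 54) · (k · hyp n) + ι (+ 6) · hyp n ∎
  where
  open ≡-Reasoning
  N m p₁ p₂ i s r k : ℚ
  N = nat (suc n)
  m = nat (108 ℕ.^ n)
  p₁ = poch (+ 1 / 6) n
  p₂ = poch (+ 1 / 3) n
  i = invFact n
  s = + 1 / 6
  r = + 1 / 3
  k = nat n
  sixth : ι (+ 6) · s ≡ ι (+ 1)
  sixth = trans (cong (_· s) (ι-def (+ 6))) (trans refl (sym ι-1))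
  third : ι (+ 3) · r ≡ ι (+ 1)
  third = trans (cong (_· r) (ι-def (+ 3))) (trans refl (sym ι-1))

hyp-equation : θ (θ hyp) ≈ X *ₛ (K (+ 108) *ₛ θ (θ hyp) +ₛ K (+ 54) *ₛ θ hyp +ₛ K (+ 6) *ₛ hyp)
hyp-equation .at zero = trans (θ-at (θ hyp) 0) (trans (zero-· (θ hyp 0) ι-0) (sym (X-*ₛ-zero (K (+ 108) *ₛ θ (θ hyp) +ₛ K (+ 54) *ₛ θ hyp +ₛ K (+ 6) *ₛ hyp))))
hyp-equation .at (suc n) = begin
  θ (θ hyp) (suc n)
    ≡⟨ θθ (suc n) ⟩
  nat (suc n) · (nat (suc n) · hyp (suc n))
    ≡⟨ hyp-suc n ⟩
  ι (+ 108) · (nat n · (nat n · hyp n)) + ι (+ 54) · (nat n · hyp n) + ι (+ 6) · hyp n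
    ≡⟨ cong₂ (λ x y → ι (+ 108) · x + ι (+ 54) · y + ι (+ 6) · hyp n) (sym (θθ n)) (sym (θ-at hyp n)) ⟩
  ι (+ 108) · θ (θ hyp) n + ι (+ 54) · θ hyp n + ι (+ 6) · hyp n
    ≡⟨ sym (trans (+ₛ-at _ _ n) (cong₂ _+_ (trans (+ₛ-at _ _ n) (cong₂ _+_ (K-*ₛ (+ 108) _ n) (K-*ₛ (+ 54) _ n))) (K-*ₛ (+ 6) _ n))) ⟩
  (K (+ 108) *ₛ θ (θ hyp) +ₛ K (+ 54) *ₛ θ hyp +ₛ K (+ 6) *ₛ hyp) n
    ≡⟨ sym (X-*ₛ-suc _ n) ⟩
  (X *ₛ (K (+ 108) *ₛ θ (θ hyp) +ₛ K (+ 54) *ₛ θ hyp +ₛ K (+ 6) *ₛ hyp)) (suc n) ∎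
  where
  open ≡-Reasoning
  θθ : ∀ n → θ (θ hyp) n ≡ nat n · (nat n · hyp n)
  θθ n = trans (θ-at (θ hyp) n) (cong (λ z → nat n · z) (θ-at hyp n))

hyp-ODE : HypergeometricODE (compose hyp) (compose (θ hyp)) (compose (θ (θ hyp)))
hyp-ODE = record
  { first = step hyp
  ; second = step (θ hyp)
  ; equation = ≈-trans (compose-cong hyp-equation) (≈-trans (compose-X _) (*ₛ-congˡ (≈-trans (compose-+ _ _) (+ₛ-cong
      (≈-trans (compose-+ _ _) (+ₛ-cong (compose-K (+ 108) _) (compose-K (+ 54) _))) (compose-K (+ 6) _))))) }
  where
  step : ∀ g → aS *ₛ θ (compose g) ≈ δS *ₛ compose (θ g)
  step g = ≈-trans (*ₛ-congˡ (θ-compose θt-Eo g)) (≈-trans (≈-sym (PSR.*-assoc aS Eo _)) (*ₛ-congʳ aEo))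

-- Both sides solve the hypergeometric equation in t and have constant term 1, so their difference
-- is the zero solution.
compose-hyp : compose hyp ≈ aS
compose-hyp = ≈-trans (solve 2 (λ x y → x := (x :- y) :+ y) ≈-refl (compose hyp) aS)
  (≈-trans (+ₛ-congʳ (ODE-unique (ODE-difference hyp-ODE aS-ODE) (trans (-ₛ-at (compose hyp) aS 0) (trans (cong₂ _-_ hyp-at-0 aS-at-0) refl)))) (PSR.+-identityˡ aS))
  where
  hyp-at-0 : compose hyp 0 ≡ 1ℚ
  hyp-at-0 = trans (ℚP.*-comm (nat 1) 1ℚ) (trans (ℚP.*-identityˡ (nat 1)) ι-1)

hyp³ : PS
hyp³ = hyp *ₛ (hyp *ₛ hyp)

Cmix-compose : Cmix ≈ compose hyp³ *ₛ Eo
Cmix-compose = begin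
  Cmix ≈⟨ ≈-sym Aδ ⟩
  AS *ₛ δS ≈⟨ *ₛ-cong (≈-sym a²) (≈-sym aEo) ⟩
  aS *ₛ aS *ₛ (aS *ₛ Eo) ≈⟨ solve 2 (λ a e → a :* a :* (a :* e) := a :* (a :* a) :* e) ≈-refl aS Eo ⟩
  aS *ₛ (aS *ₛ aS) *ₛ Eo ≈⟨ *ₛ-congʳ (≈-sym (≈-trans (compose-* hyp (hyp *ₛ hyp)) (*ₛ-cong compose-hyp (≈-trans (compose-* hyp hyp) (*ₛ-cong compose-hyp compose-hyp))))) ⟩
  compose hyp³ *ₛ Eo ∎
  where open ≈-Reasoning

rescale-* : ∀ f g → rescale (f *ₛ g) ≈ rescale f *ₛ rescale g
rescale-* f g .at n = trans (cong (λ z → nat (108 ℕ.^ n) · z) (*ₛ-at f g n)) (trans (sym (sumTo-·ˡ n (nat (108 ℕ.^ n)) _))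
  (trans (sumTo-cong n (λ i i≤n → trans (cong (_· (f i · g (n ∸ i))) (trans (cong (λ k → nat (108 ℕ.^ k)) (sym (ℕP.m+[n∸m]≡n i≤n)))
      (trans (cong nat (ℕP.^-distribˡ-+-* 108 i (n ∸ i))) (nat-* (108 ℕ.^ i) (108 ℕ.^ (n ∸ i))))))
    (solveℚ 4 (λ a b c d → a ⟨·⟩ b ⟨·⟩ (c ⟨·⟩ d) ⟨=⟩ a ⟨·⟩ c ⟨·⟩ (b ⟨·⟩ d)) refl (nat (108 ℕ.^ i)) (nat (108 ℕ.^ (n ∸ i))) (f i) (g (n ∸ i)))))
  (sym (*ₛ-at (rescale f) (rescale g) n))))

Amix-hyp³ : ∀ n → Amix n ≡ hyp³ n
Amix-hyp³ n = trans (cong₂ _·_ (fromℕ-def (108 ℕ.^ n)) (at (≈-trans (pow-^ₛ F21 3) (*ₛ-congˡ (*ₛ-congˡ (PSR.*-identityʳ F21)))) n))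
  (at (≈-trans (rescale-* F21 (F21 *ₛ F21)) (*ₛ-congˡ (rescale-* F21 F21))) n)

-- The residue [q^n] t^k (θt/t) (q/t)^n vanishes for k ≠ n, being the residue of a derivative.

Tq-at-0 : tOverQ 0 ≡ 1ℚ
Tq-at-0 = begin
  tOverQ 0 ≡⟨ sym (ℚP.*-identityʳ (tOverQ 0)) ⟩
  tOverQ 0 · 1ℚ ≡⟨ cong (λ z → tOverQ 0 · z) (sym (*ₛ-at-0-one 1+27u 1+27u 1+27u-at-0 1+27u-at-0)) ⟩
  tOverQ 0 · (1+27u *ₛ 1+27u) 0 ≡⟨ sym (*ₛ-at-0 tOverQ (1+27u *ₛ 1+27u)) ⟩
  (tail tS *ₛ (1+27u *ₛ 1+27u)) 0 ≡⟨ sym (*ₛ-at-suc-zero tS (1+27u *ₛ 1+27u) 0 tS-at-0) ⟩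
  (tS *ₛ (1+27u *ₛ 1+27u)) 1 ≡⟨ at tS-*ₛ 1 ⟩
  uS 1 ≡⟨ etaQuot-at-0 ⟩
  1ℚ ∎
  where open ≡-Reasoning

tS-X : tS ≈ X *ₛ tOverQ
tS-X .at zero = trans tS-at-0 (sym (X-*ₛ-zero tOverQ))
tS-X .at (suc n) = sym (X-*ₛ-suc tOverQ n)

HT : Hmix *ₛ tOverQ ≈ oneS
HT = inv1-*ₛ tOverQ Tq-at-0

X-cancel : ∀ {f g} → X *ₛ f ≈ X *ₛ g → f ≈ g
X-cancel {f} {g} e .at n = trans (sym (X-*ₛ-suc f n)) (trans (at e (suc n)) (X-*ₛ-suc g n))

TEo : tOverQ *ₛ Eo ≈ tOverQ +ₛ θ tOverQ
TEo = X-cancel (≈-trans (≈-sym (PSR.*-assoc X tOverQ Eo)) (≈-trans (*ₛ-congʳ (≈-sym tS-X)) (≈-trans (≈-sym θt-Eo)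
  (≈-trans (θ-cong tS-X) (≈-trans (θ-*ₛ X tOverQ) (≈-trans (+ₛ-congʳ (*ₛ-congʳ θX)) (≈-sym (PSR.distribˡ X tOverQ (θ tOverQ)))))))))

-- From t = q/H the logarithmic derivative is 1 - θH/H, and 1/H is `tOverQ`.
Eo-H : Eo ≈ oneS -ₛ tOverQ *ₛ θ Hmix
Eo-H = begin
  Eo ≈⟨ ≈-trans (≈-sym (PSR.*-identityˡ Eo)) (*ₛ-congʳ (≈-sym HT)) ⟩
  Hmix *ₛ tOverQ *ₛ Eo ≈⟨ ≈-trans (PSR.*-assoc Hmix tOverQ Eo) (*ₛ-congˡ TEo) ⟩
  Hmix *ₛ (tOverQ +ₛ θ tOverQ) ≈⟨ solve 4 (λ h t x y → h :* (t :+ x) := (h :* t :- t :* y) :+ (y :* t :+ h :* x)) ≈-refl Hmix tOverQ (θ tOverQ) (θ Hmix) ⟩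
  (Hmix *ₛ tOverQ -ₛ tOverQ *ₛ θ Hmix) +ₛ (θ Hmix *ₛ tOverQ +ₛ Hmix *ₛ θ tOverQ)
    ≈⟨ +ₛ-cong (-ₛ-cong HT ≈-refl) (≈-trans (≈-sym (θ-*ₛ Hmix tOverQ)) (≈-trans (θ-cong HT) θ-one)) ⟩
  (oneS -ₛ tOverQ *ₛ θ Hmix) +ₛ zeroS ≈⟨ PSR.+-identityʳ _ ⟩
  oneS -ₛ tOverQ *ₛ θ Hmix ∎
  where open ≈-Reasoning

-- By `Eo-H`, (k + 1) Eo H^(k+1) = (k + 1) H^(k+1) - θ(H^(k+1)), and θ multiplies the coefficient of
-- q^(k+1) by k + 1.
residue-zero : ∀ k → (Eo *ₛ Hmix ^ₛ suc k) (suc k) ≡ 0ℚ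
residue-zero k = nat-suc-cancel k (begin
  nat (suc k) · (Eo *ₛ Hmix ^ₛ suc k) (suc k)
    ≡⟨ sym (K-*ₛ (+ suc k) _ (suc k)) ⟩
  (K (+ suc k) *ₛ (Eo *ₛ Hmix ^ₛ suc k)) (suc k)
    ≡⟨ at exact (suc k) ⟩
  (K (+ suc k) *ₛ Hmix ^ₛ suc k -ₛ θ (Hmix ^ₛ suc k)) (suc k)
    ≡⟨ trans (-ₛ-at _ _ (suc k)) (cong₂ _-_ (K-*ₛ (+ suc k) _ (suc k)) (θ-at (Hmix ^ₛ suc k) (suc k))) ⟩
  nat (suc k) · (Hmix ^ₛ suc k) (suc k) - nat (suc k) · (Hmix ^ₛ suc k) (suc k)
    ≡⟨ trans (ℚP.+-inverseʳ (nat (suc k) · (Hmix ^ₛ suc k) (suc k))) (sym (ℚP.*-zeroʳ (nat (suc k)))) ⟩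
  nat (suc k) · 0ℚ ∎)
  where
  open ≡-Reasoning
  exact : K (+ suc k) *ₛ (Eo *ₛ Hmix ^ₛ suc k) ≈ K (+ suc k) *ₛ Hmix ^ₛ suc k -ₛ θ (Hmix ^ₛ suc k)
  exact = ≈-trans (*ₛ-congˡ (*ₛ-congʳ Eo-H)) (≈-trans
    (solve 6 (λ m o h p t y → m :* ((o :- t :* y) :* (h :* p)) := m :* (o :* (h :* p)) :- m :* (p :* (h :* t :* y))) ≈-refl (K (+ suc k)) oneS Hmix (Hmix ^ₛ k) tOverQ (θ Hmix))
    (-ₛ-cong (*ₛ-congˡ (PSR.*-identityˡ _)) (≈-trans (*ₛ-congˡ (*ₛ-congˡ (≈-trans (*ₛ-congʳ HT) (PSR.*-identityˡ _)))) (≈-sym (θ-^ₛ Hmix k)))))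

-- Writing g(t) = g(0) + t · (tail g)(t) and t H = q lowers the exponent of H and the index of the
-- coefficient together by one. In this form no negative powers of t or q occur.
residue : ∀ n g → (compose g *ₛ Eo *ₛ Hmix ^ₛ n) n ≡ g n
residue zero g = trans (*ₛ-at-0 _ oneS) (trans (ℚP.*-identityʳ _) (trans (*ₛ-at-0 (compose g) Eo) (trans (cong (λ z → g 0 · z) Eo-at-0) (ℚP.*-identityʳ (g 0)))))
residue (suc n) g = begin
  (compose g *ₛ Eo *ₛ Hmix ^ₛ suc n) (suc n)
    ≡⟨ at split (suc n) ⟩
  (const (g 0) *ₛ (Eo *ₛ Hmix ^ₛ suc n) +ₛ X *ₛ (compose (tail g) *ₛ Eo *ₛ Hmix ^ₛ n)) (suc n)
    ≡⟨ trans (+ₛ-at _ _ (suc n)) (cong₂ _+_ (trans (const-*ₛ (g 0) _ (suc n)) (trans (cong (λ z → g 0 · z) (residue-zero n)) (ℚP.*-zeroʳ (g 0)))) (X-*ₛ-suc _ n)) ⟩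
  0ℚ + (compose (tail g) *ₛ Eo *ₛ Hmix ^ₛ n) n
    ≡⟨ trans (ℚP.+-identityˡ _) (residue n (tail g)) ⟩
  g (suc n) ∎
  where
  open ≡-Reasoning
  split : compose g *ₛ Eo *ₛ Hmix ^ₛ suc n ≈ const (g 0) *ₛ (Eo *ₛ Hmix ^ₛ suc n) +ₛ X *ₛ (compose (tail g) *ₛ Eo *ₛ Hmix ^ₛ n)
  split = ≈-trans (*ₛ-congʳ (*ₛ-congʳ (≈-trans (compose-step g) (+ₛ-congˡ (*ₛ-congʳ tS-X)))))
    (≈-trans (solve 7 (λ c x t y e h p → (c :+ x :* t :* y) :* e :* (h :* p) := c :* (e :* (h :* p)) :+ h :* t :* (x :* (y :* e :* p))) ≈-refl
        (const (g 0)) X tOverQ (compose (tail g)) Eo Hmix (Hmix ^ₛ n))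
      (+ₛ-congˡ (≈-trans (*ₛ-congʳ HT) (PSR.*-identityˡ _))))

Amix-coefficient : ∀ n → Amix n ≡ (Cmix ⊛ pow Hmix n) n
Amix-coefficient n = trans (Amix-hyp³ n) (trans (sym (residue n hyp³))
  (sym (at (⊛≈*ₛ Cmix-compose (pow-^ₛ Hmix n)) n)))

-- p-integral rationals

module Padic (p′ : ℕ) (p-prime : Prime (suc p′)) where

  p : ℕ
  p = suc p′

  p∤* : ∀ {m n} → ¬ (p ∣ m) → ¬ (p ∣ n) → ¬ (p ∣ m ℕ.* n)
  p∤* {m} {n} p∤m p∤n p∣mn with euclidsLemma m n p-prime p∣mn
  ... | inj₁ p∣m = p∤m p∣m
  ... | inj₂ p∣n = p∤n p∣n

  p∤< : ∀ n → 1 ≤ n → n < p → ¬ (p ∣ n)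
  p∤< n 1≤n n<p p∣n = ℕP.<-irrefl refl (ℕP.<-≤-trans n<p (∣⇒≤ {{ℕ.>-nonZero 1≤n}} p∣n))

  1<p : 1 < p
  1<p = ℕ.nonTrivial⇒n>1 p {{prime⇒nonTrivial p-prime}}

  -- D k x says x ∈ p^k Z_(p), without reference to lowest terms.
  record D (k : ℕ) (x : ℚ) : Set where
    constructor mkD
    field
      denominator : ℕ
      numerator : ℤ
      p∤denominator : ¬ (p ∣ denominator)
      clear : nat denominator · x ≡ nat (p ℕ.^ k) · ι numerator

  D-resp : ∀ {k x y} → x ≡ y → D k x → D k y
  D-resp refl d = d

  D-ι : ∀ z → D 0 (ι z)
  D-ι z = mkD 1 z (p∤< 1 (s≤s z≤n) 1<p) refl

  D-zero : ∀ k → D k 0ℚ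
  D-zero k = mkD 1 (+ 0) (p∤< 1 (s≤s z≤n) 1<p) (trans (ℚP.*-zeroʳ (nat 1)) (sym (trans (cong (λ z → nat (p ℕ.^ k) · z) ι-0) (ℚP.*-zeroʳ (nat (p ℕ.^ k))))))

  D-one : D 0 1ℚ
  D-one = D-resp ι-1 (D-ι (+ 1))

  D-+ : ∀ {k x y} → D k x → D k y → D k (x + y)
  D-+ {k} {x} {y} (mkD b a p∤b e) (mkD c d p∤c f) = mkD (b ℕ.* c) (+ c ℤ.* a ℤ.+ + b ℤ.* d) (p∤* p∤b p∤c) (begin
    nat (b ℕ.* c) · (x + y)
      ≡⟨ cong (_· (x + y)) (nat-* b c) ⟩
    nat b · nat c · (x + y)
      ≡⟨ solveℚ 4 (λ b c x y → b ⟨·⟩ c ⟨·⟩ (x ⟨+⟩ y) ⟨=⟩ c ⟨·⟩ (b ⟨·⟩ x) ⟨+⟩ b ⟨·⟩ (c ⟨·⟩ y)) refl (nat b) (nat c) x y ⟩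
    nat c · (nat b · x) + nat b · (nat c · y)
      ≡⟨ cong₂ (λ u v → nat c · u + nat b · v) e f ⟩
    nat c · (nat (p ℕ.^ k) · ι a) + nat b · (nat (p ℕ.^ k) · ι d)
      ≡⟨ solveℚ 5 (λ c b q a d → c ⟨·⟩ (q ⟨·⟩ a) ⟨+⟩ b ⟨·⟩ (q ⟨·⟩ d) ⟨=⟩ q ⟨·⟩ (c ⟨·⟩ a ⟨+⟩ b ⟨·⟩ d)) refl (nat c) (nat b) (nat (p ℕ.^ k)) (ι a) (ι d) ⟩
    nat (p ℕ.^ k) · (nat c · ι a + nat b · ι d)
      ≡⟨ cong (λ z → nat (p ℕ.^ k) · z) (sym (trans (ι-+ (+ c ℤ.* a) (+ b ℤ.* d)) (cong₂ _+_ (ι-* (+ c) a) (ι-* (+ b) d)))) ⟩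
    nat (p ℕ.^ k) · ι (+ c ℤ.* a ℤ.+ + b ℤ.* d) ∎)
    where open ≡-Reasoning

  D-· : ∀ {j k x y} → D j x → D k y → D (j ℕ.+ k) (x · y)
  D-· {j} {k} {x} {y} (mkD b a p∤b e) (mkD c d p∤c f) = mkD (b ℕ.* c) (a ℤ.* d) (p∤* p∤b p∤c) (begin
    nat (b ℕ.* c) · (x · y)
      ≡⟨ cong (_· (x · y)) (nat-* b c) ⟩
    nat b · nat c · (x · y)
      ≡⟨ solveℚ 4 (λ b c x y → b ⟨·⟩ c ⟨·⟩ (x ⟨·⟩ y) ⟨=⟩ (b ⟨·⟩ x) ⟨·⟩ (c ⟨·⟩ y)) refl (nat b) (nat c) x y ⟩
    (nat b · x) · (nat c · y)
      ≡⟨ cong₂ _·_ e f ⟩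
    (nat (p ℕ.^ j) · ι a) · (nat (p ℕ.^ k) · ι d)
      ≡⟨ solveℚ 4 (λ b c x y → (b ⟨·⟩ x) ⟨·⟩ (c ⟨·⟩ y) ⟨=⟩ b ⟨·⟩ c ⟨·⟩ (x ⟨·⟩ y)) refl (nat (p ℕ.^ j)) (nat (p ℕ.^ k)) (ι a) (ι d) ⟩
    nat (p ℕ.^ j) · nat (p ℕ.^ k) · (ι a · ι d)
      ≡⟨ cong₂ _·_ (trans (sym (nat-* (p ℕ.^ j) (p ℕ.^ k))) (cong nat (sym (ℕP.^-distribˡ-+-* p j k)))) (sym (ι-* a d)) ⟩
    nat (p ℕ.^ (j ℕ.+ k)) · ι (a ℤ.* d) ∎)
    where open ≡-Reasoning

  D-neg : ∀ {k x} → D k x → D k (- x)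
  D-neg {k} {x} d = D-resp (trans (cong (_· x) (trans (ι-neg (+ 1)) (cong -_ ι-1))) (trans (sym (ℚP.neg-distribˡ-* 1ℚ x)) (cong -_ (ℚP.*-identityˡ x)))) (D-· (D-ι (neg 1)) d)

  D-- : ∀ {k x y} → D k x → D k y → D k (x - y)
  D-- d e = D-+ d (D-neg e)

  D-p^ : ∀ k → D k (nat (p ℕ.^ k))
  D-p^ k = mkD 1 (+ 1) (p∤< 1 (s≤s z≤n) 1<p) (ℚP.*-comm (nat 1) _)

  D-weaken : ∀ {k x} j → D (j ℕ.+ k) x → D k x
  D-weaken {k} {x} j (mkD b a p∤b e) = mkD b (+ (p ℕ.^ j) ℤ.* a) p∤b (trans e (begin
    nat (p ℕ.^ (j ℕ.+ k)) · ι a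
      ≡⟨ cong (_· ι a) (trans (cong nat (ℕP.^-distribˡ-+-* p j k)) (nat-* (p ℕ.^ j) (p ℕ.^ k))) ⟩
    nat (p ℕ.^ j) · nat (p ℕ.^ k) · ι a
      ≡⟨ solveℚ 3 (λ x y z → x ⟨·⟩ y ⟨·⟩ z ⟨=⟩ y ⟨·⟩ (x ⟨·⟩ z)) refl (nat (p ℕ.^ j)) (nat (p ℕ.^ k)) (ι a) ⟩
    nat (p ℕ.^ k) · (nat (p ℕ.^ j) · ι a)
      ≡⟨ cong (λ z → nat (p ℕ.^ k) · z) (sym (ι-* (+ (p ℕ.^ j)) a)) ⟩
    nat (p ℕ.^ k) · ι (+ (p ℕ.^ j) ℤ.* a) ∎))
    where open ≡-Reasoning

  D-≤ : ∀ {j k x} → j ≤ k → D k x → D j x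
  D-≤ {j} {k} {x} j≤k d with ℕP.m≤n⇒∃[o]m+o≡n j≤k
  ... | o , refl = D-weaken o (subst (λ m → D m x) (ℕP.+-comm j o) d)

  D-cancel : ∀ {k x} b → ¬ (p ∣ b) → D k (nat b · x) → D k x
  D-cancel {k} {x} b p∤b (mkD c a p∤c e) = mkD (c ℕ.* b) a (p∤* p∤c p∤b)
    (trans (cong (_· x) (nat-* c b)) (trans (ℚP.*-assoc (nat c) (nat b) x) e))

  D-recip : ∀ {k x} n → ¬ (p ∣ suc n) → D k x → D k (recip n · x)
  D-recip {k} {x} n p∤n d = D-cancel (suc n) p∤n (D-resp (sym (trans (sym (ℚP.*-assoc (nat (suc n)) (recip n) x)) (one-· x (recip-inverse n)))) d)

  D-recip-p : ∀ {k x} → D (suc k) x → D k (recip p′ · x)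
  D-recip-p {k} {x} (mkD b a p∤b e) = mkD b a p∤b (begin
    nat b · (recip p′ · x)
      ≡⟨ solveℚ 3 (λ b r x → b ⟨·⟩ (r ⟨·⟩ x) ⟨=⟩ r ⟨·⟩ (b ⟨·⟩ x)) refl (nat b) (recip p′) x ⟩
    recip p′ · (nat b · x)
      ≡⟨ cong (λ z → recip p′ · z) (trans e (cong (_· ι a) (nat-* p (p ℕ.^ k)))) ⟩
    recip p′ · (nat p · nat (p ℕ.^ k) · ι a)
      ≡⟨ solveℚ 4 (λ r p q a → r ⟨·⟩ (p ⟨·⟩ q ⟨·⟩ a) ⟨=⟩ p ⟨·⟩ r ⟨·⟩ (q ⟨·⟩ a)) refl (recip p′) (nat p) (nat (p ℕ.^ k)) (ι a) ⟩
    nat p · recip p′ · (nat (p ℕ.^ k) · ι a)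
      ≡⟨ one-· _ (recip-inverse p′) ⟩
    nat (p ℕ.^ k) · ι a ∎)
    where open ≡-Reasoning

  recip-p* : ∀ i x → recip (i ℕ.+ p′ ℕ.* suc i) · x ≡ recip i · (recip p′ · x)
  recip-p* i x = nat-suc-cancel (i ℕ.+ p′ ℕ.* suc i) (begin
    nat (p ℕ.* suc i) · (recip (i ℕ.+ p′ ℕ.* suc i) · x)
      ≡⟨ trans (sym (ℚP.*-assoc (nat (p ℕ.* suc i)) (recip (i ℕ.+ p′ ℕ.* suc i)) x)) (one-· x (recip-inverse (i ℕ.+ p′ ℕ.* suc i))) ⟩
    x
      ≡⟨ sym (trans (cong₂ (λ a b → a · b · x) (recip-inverse p′) (recip-inverse i)) (trans (cong (_· x) (ℚP.*-identityˡ 1ℚ)) (ℚP.*-identityˡ x))) ⟩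
    (nat p · recip p′) · (nat (suc i) · recip i) · x
      ≡⟨ solveℚ 5 (λ p r n s x → (p ⟨·⟩ r) ⟨·⟩ (n ⟨·⟩ s) ⟨·⟩ x ⟨=⟩ p ⟨·⟩ n ⟨·⟩ (s ⟨·⟩ (r ⟨·⟩ x))) refl (nat p) (recip p′) (nat (suc i)) (recip i) x ⟩
    nat p · nat (suc i) · (recip i · (recip p′ · x))
      ≡⟨ cong (_· (recip i · (recip p′ · x))) (sym (nat-* p (suc i))) ⟩
    nat (p ℕ.* suc i) · (recip i · (recip p′ · x)) ∎)
    where open ≡-Reasoning

  -- The index j stands for the denominator j + 1; i + p′ (i + 1) is the predecessor of p (i + 1).
  data Divides : ℕ → Set where
    coprime : ∀ {j} → ¬ (p ∣ suc j) → Divides j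
    multiple : ∀ i → Divides (i ℕ.+ p′ ℕ.* suc i)

  divides? : ∀ j → Divides j
  divides? j with p ∣? suc j
  ... | no p∤j = coprime p∤j
  ... | yes (divides zero ())
  ... | yes (divides (suc i) e) = subst Divides (sym (ℕP.suc-injective (trans e (ℕP.*-comm (suc i) p)))) (multiple i)

  i≤p′*suci : ∀ i → suc i ≤ p′ ℕ.* suc i
  i≤p′*suci i = m≤n*m′ (suc i) (ℕP.≤-pred 1<p)

  -- v_p(j + 1) ≤ j
  D-recip-any : ∀ j {e x} → D (e ℕ.+ j) x → D e (recip j · x)
  D-recip-any j = <-rec (λ j → ∀ {e x} → D (e ℕ.+ j) x → D e (recip j · x)) step j
    where
    step : ∀ j → (∀ {i} → i < j → ∀ {e x} → D (e ℕ.+ i) x → D e (recip i · x)) → ∀ {e x} → D (e ℕ.+ j) x → D e (recip j · x)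
    step j rec {e} {x} d with divides? j
    ... | coprime p∤j = D-recip j p∤j (D-≤ (ℕP.m≤m+n e j) d)
    ... | multiple i = D-resp (sym (recip-p* i x)) (rec (ℕP.<-≤-trans (ℕP.n<1+n i) (ℕP.≤-trans (i≤p′*suci i) (ℕP.m≤n+m _ i)))
          (D-recip-p (D-≤ (subst (_≤ e ℕ.+ (i ℕ.+ p′ ℕ.* suc i)) (ℕP.+-suc e i) (ℕP.+-monoʳ-≤ e (ℕP.≤-trans (i≤p′*suci i) (ℕP.m≤n+m _ i)))) d)))

  -- If p ∤ j + 1, the exponent j + 1 ≥ 4 suffices. If j + 1 = p (i + 1), the division costs at most
  -- i + 1 powers of p, while p - 1 ≥ 4 gives j + 1 ≥ 4 + (i + 1). The logarithm therefore may be
  -- cut after the cubic term.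
  D-recip-4 : 7 ≤ p → ∀ j {x} → 3 ≤ j → D (suc j) x → D 4 (recip j · x)
  D-recip-4 7≤p j {x} 3≤j d with divides? j
  ... | coprime p∤j = D-recip j p∤j (D-≤ (s≤s 3≤j) d)
  ... | multiple i = D-resp (sym (recip-p* i x)) (D-recip-any i {4} (D-recip-p (D-≤ (s≤s bound) d)))
    where
    bound : 4 ℕ.+ i ≤ i ℕ.+ p′ ℕ.* suc i
    bound = subst (_≤ i ℕ.+ p′ ℕ.* suc i) (ℕP.+-comm i 4) (ℕP.+-monoʳ-≤ i
      (ℕP.≤-trans (ℕP.≤-trans (s≤s (s≤s (s≤s (s≤s z≤n)))) (ℕP.≤-pred 7≤p)) (m≤m*n′ p′ (s≤s z≤n))))

  D-sumTo : ∀ {k} n f → (∀ i → D k (f i)) → D k (sumTo n f)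
  D-sumTo zero f d = d 0
  D-sumTo (suc n) f d = D-+ (D-sumTo n f d) (d (suc n))

  D-sumFrom1 : ∀ {k} n f → (∀ i → D k (f i)) → D k (sumFrom1 n f)
  D-sumFrom1 {k} zero f d = D-zero k
  D-sumFrom1 (suc n) f d = D-+ (D-sumFrom1 n f d) (d (suc n))

  clear-denominator : ∀ x → nat (ℚ.↧ₙ x) · x ≡ ι (ℚ.↥ x)
  clear-denominator x@record{} = ℚP.toℚᵘ-injective (ℚᵘP.≃-trans (ℚP.toℚᵘ-homo-* (nat (ℚ.↧ₙ x)) x)
    (ℚᵘP.≃-trans (ℚᵘP.*-cong (ι-toℚᵘ (+ ℚ.↧ₙ x)) ℚᵘP.≃-refl) (ℚᵘP.≃-trans
      (ℚᵘ.*≡* (trans (ℤP.*-identityʳ _) (trans (ℤP.*-comm (ℚ.↧ x) (ℚ.↥ x)) (cong (λ k → ℚ.↥ x ℤ.* (+ k)) (sym (ℕP.*-identityˡ (ℚ.↧ₙ x)))))))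
      (ℚᵘP.≃-sym (ι-toℚᵘ (ℚ.↥ x))))))

  DivPow⇒D : ∀ {k x} → DivPow p k x → D k x
  DivPow⇒D {k} {x} (p^k∣num , p∤den) with ℤD.∣ᵤ⇒∣ {+ (p ℕ.^ k)} {ℚ.↥ x} p^k∣num
  ... | ℤD.divides a e = mkD (ℚ.↧ₙ x) a p∤den (trans (clear-denominator x) (trans (cong ι e) (trans (ι-* a (+ (p ℕ.^ k))) (ℚP.*-comm (ι a) _))))

  p^-cancel : ∀ k b n → ¬ (p ∣ b) → p ℕ.^ k ∣ b ℕ.* n → p ℕ.^ k ∣ n
  p^-cancel zero b n p∤b _ = divides n (sym (ℕP.*-identityʳ n))
  p^-cancel (suc k) b n p∤b div with euclidsLemma b n p-prime (∣-trans (m∣m*n (p ℕ.^ k)) div)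
  ... | inj₁ p∣b = ⊥-elim (p∤b p∣b)
  ... | inj₂ (divides m refl) = subst (p ℕ.^ suc k ∣_) (ℕP.*-comm p m)
        (*-monoʳ-∣ p (p^-cancel k b m p∤b (*-cancelˡ-∣ p (subst (p ℕ.^ suc k ∣_)
          (trans (sym (ℕP.*-assoc b m p)) (ℕP.*-comm (b ℕ.* m) p)) div))))

  -- Clearing denominators gives b · num = p^k · |a| · den up to sign. As p ∤ b, p^k divides num; as
  -- num and den are coprime, den divides b and is prime to p as well.
  D⇒DivPow : ∀ {k x} → D k x → DivPow p k x
  D⇒DivPow {k} {x@(ℚ.mkℚ _ _ coprime-x)} (mkD b a p∤b e) =
      p^-cancel k b ∣num∣ p∤b (divides (ℤ.∣ a ∣ ℕ.* den) (trans natural (trans (ℕP.*-assoc (p ℕ.^ k) ℤ.∣ a ∣ den) (ℕP.*-comm (p ℕ.^ k) _))))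
    , λ p∣den → p∤b (∣-trans p∣den (coprime-divisor (Coprime.sym (Coprime.recompute coprime-x))
        (divides (p ℕ.^ k ℕ.* ℤ.∣ a ∣) (trans (ℕP.*-comm ∣num∣ b) natural))))
    where
    ∣num∣ den : ℕ
    ∣num∣ = ℤ.∣ ℚ.↥ x ∣
    den = ℚ.↧ₙ x
    integral : + b ℤ.* ℚ.↥ x ≡ + (p ℕ.^ k) ℤ.* a ℤ.* + den
    integral = ι-injective (begin
      ι (+ b ℤ.* ℚ.↥ x) ≡⟨ trans (ι-* (+ b) (ℚ.↥ x)) (cong (λ z → nat b · z) (sym (clear-denominator x))) ⟩
      nat b · (nat den · x) ≡⟨ solveℚ 3 (λ b d x → b ⟨·⟩ (d ⟨·⟩ x) ⟨=⟩ (b ⟨·⟩ x) ⟨·⟩ d) refl (nat b) (nat den) x ⟩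
      nat b · x · nat den ≡⟨ cong (_· nat den) e ⟩
      nat (p ℕ.^ k) · ι a · nat den ≡⟨ sym (trans (ι-* _ (+ den)) (cong (_· nat den) (ι-* (+ (p ℕ.^ k)) a))) ⟩
      ι (+ (p ℕ.^ k) ℤ.* a ℤ.* + den) ∎)
      where open ≡-Reasoning
    natural : b ℕ.* ∣num∣ ≡ p ℕ.^ k ℕ.* ℤ.∣ a ∣ ℕ.* den
    natural = trans (sym (ℤP.abs-* (+ b) (ℚ.↥ x))) (trans (cong ℤ.∣_∣ integral)
      (trans (ℤP.abs-* (+ (p ℕ.^ k) ℤ.* a) (+ den)) (cong (ℕ._* den) (ℤP.abs-* (+ (p ℕ.^ k)) a))))

-- p-integral power series and the Frobenius congruence

head-tail : ∀ f → f ≈ const (f 0) +ₛ X *ₛ tail f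
head-tail f .at zero = sym (trans (+ₛ-at _ _ 0) (trans (cong (λ z → f 0 + z) (X-*ₛ-zero (tail f))) (ℚP.+-identityʳ (f 0))))
head-tail f .at (suc n) = sym (trans (+ₛ-at _ _ (suc n)) (trans (cong (λ z → 0ℚ + z) (X-*ₛ-suc (tail f) n)) (ℚP.+-identityˡ (f (suc n)))))

X-^ₛ : ∀ n → X ^ₛ n ≈ qpow n
X-^ₛ zero = mk≈ λ { zero → refl ; (suc n) → refl }
X-^ₛ (suc n) = ≈-trans (*ₛ-congˡ (X-^ₛ n)) (mk≈ λ { zero → X-*ₛ-zero (qpow n) ; (suc m) → X-*ₛ-suc (qpow n) m })

module BinomialPS = Binomial PSR.commutativeSemiring
module ExpPS = SemiringExp PSR.semiring
module MultPS = SemiringMult PSR.semiring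
module SumPS = SemiringSum PSR.semiring

^-^ₛ : ∀ f n → f ExpPS.^ n ≈ f ^ₛ n
^-^ₛ f zero = ≈-refl
^-^ₛ f (suc n) = *ₛ-congˡ (^-^ₛ f n)

×-K : ∀ n f → n MultPS.× f ≈ K (+ n) *ₛ f
×-K zero f = ≈-sym (≈-trans (*ₛ-congʳ K-0) (PSR.zeroˡ f))
×-K (suc n) f = ≈-trans (+ₛ-congˡ (×-K n f)) (≈-trans (solve 2 (λ k f → f :+ k :* f := (# 1 :+ k) :* f) ≈-refl (K (+ n)) f) (*ₛ-congʳ (≈-sym (K-+ (+ 1) (+ n)))))

module PadicSeries (p′ : ℕ) (p-prime : Prime (suc p′)) where
  open Padic p′ p-prime

  DS : ℕ → PS → Set
  DS k f = ∀ n → D k (f n)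

  DS-resp : ∀ {k f g} → f ≈ g → DS k f → DS k g
  DS-resp e d n = D-resp (at e n) (d n)

  DS-+ : ∀ {k f g} → DS k f → DS k g → DS k (f +ₛ g)
  DS-+ {f = f} {g} d e n = D-resp (sym (+ₛ-at f g n)) (D-+ (d n) (e n))

  DS-- : ∀ {k f g} → DS k f → DS k g → DS k (f -ₛ g)
  DS-- {f = f} {g} d e n = D-resp (sym (-ₛ-at f g n)) (D-- (d n) (e n))

  DS-* : ∀ {j k f g} → DS j f → DS k g → DS (j ℕ.+ k) (f *ₛ g)
  DS-* {f = f} {g} d e n = D-resp (sym (*ₛ-at f g n)) (D-sumTo n _ (λ i → D-· (d i) (e (n ∸ i))))

  DS-≤ : ∀ {j k f} → j ≤ k → DS k f → DS j f
  DS-≤ j≤k d n = D-≤ j≤k (d n)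

  DS-const : ∀ {k c} → D k c → DS k (const c)
  DS-const d zero = d
  DS-const {k} d (suc n) = D-zero k

  DS-zero : ∀ k → DS k zeroS
  DS-zero k = DS-const (D-zero k)

  DS-one : DS 0 oneS
  DS-one = DS-const D-one

  DS-K : ∀ z → DS 0 (K z)
  DS-K z = DS-resp (≡⇒≈ (sym (K-def z))) (DS-const (D-ι z))

  DS-^ : ∀ {f} n → DS 0 f → DS 0 (f ^ₛ n)
  DS-^ zero d = DS-one
  DS-^ (suc n) d = DS-* d (DS-^ n d)

  DS-^-gain : ∀ {f} n → DS 1 f → DS n (f ^ₛ n)
  DS-^-gain zero d = DS-one
  DS-^-gain (suc n) d = DS-* d (DS-^-gain n d)

  DS-qpow : ∀ j → DS 0 (qpow j)
  DS-qpow j n with j ≡ᵇ n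
  ... | true = D-one
  ... | false = D-zero 0

  DS-inv1 : ∀ {f} → DS 0 f → DS 0 (inv1 f)
  DS-inv1 {f} d n = D-resp (sym (inv1-at f n)) (D-sumTo n _ (λ k → DS-^ k (DS-- DS-one d) n))

  DS-cancel : ∀ {k f} b → ¬ (p ∣ b) → DS k (K (+ b) *ₛ f) → DS k f
  DS-cancel {f = f} b p∤b d n = D-cancel b p∤b (D-resp (K-*ₛ (+ b) f n) (d n))

  DS-K-multiple : ∀ {n} f → p ∣ n → DS 0 f → DS 1 (K (+ n) *ₛ f)
  DS-K-multiple f (divides q refl) d n = D-resp (sym (K-*ₛ (+ (q ℕ.* p)) f n)) (D-· {1} {0} (D-resp
    (sym (trans (nat-* q p) (ℚP.*-comm (nat q) (nat p)))) (D-· {1} {0} (D-resp (cong nat (ℕP.*-identityʳ p)) (D-p^ 1)) (D-ι (+ q)))) (d n))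

  p∣!⇒p≤ : ∀ k → p ∣ k ! → p ≤ k
  p∣!⇒p≤ zero p∣1 = ⊥-elim (p∤< 1 (s≤s z≤n) 1<p p∣1)
  p∣!⇒p≤ (suc k) p∣ with euclidsLemma (suc k) (k !) p-prime p∣
  ... | inj₁ p∣k = ∣⇒≤ p∣k
  ... | inj₂ p∣k! = ℕP.m≤n⇒m≤1+n (p∣!⇒p≤ k p∣k!)

  -- p divides p! = (p C k) · k! · (p - k)!, and it divides neither factorial because k and p - k
  -- are smaller than p.
  p∣pCk : ∀ k → 1 ≤ k → k < p → p ∣ p C k
  p∣pCk k 1≤k k<p with euclidsLemma (p C k) (k ! ℕ.* (p ∸ k) !) p-prime (subst (p ∣_) (sym product) (m∣m*n (p′ !)))
    where
    instance _ = ℕP._!*_!≢0 k (p ∸ k)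
    product : (p C k) ℕ.* (k ! ℕ.* (p ∸ k) !) ≡ p !
    product = trans (cong (ℕ._* (k ! ℕ.* (p ∸ k) !)) (nCk≡n!/k![n-k]! (ℕP.<⇒≤ k<p))) (m/n*n≡m (k![n∸k]!∣n! (ℕP.<⇒≤ k<p)))
  ... | inj₁ p∣C = p∣C
  ... | inj₂ p∣ with euclidsLemma (k !) ((p ∸ k) !) p-prime p∣
  ... | inj₁ p∣k = ⊥-elim (ℕP.<-irrefl refl (ℕP.<-≤-trans k<p (p∣!⇒p≤ k p∣k)))
  ... | inj₂ p∣p-k = ⊥-elim (ℕP.<-irrefl refl (ℕP.<-≤-trans (ℕP.∸-monoʳ-< {p} {k} {0} 1≤k (ℕP.<⇒≤ k<p)) (p∣!⇒p≤ (p ∸ k) p∣p-k)))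

  DS-sum : ∀ {k} n (t : Fin n → PS) → (∀ i → DS k (t i)) → DS k (SumPS.sum t)
  DS-sum {k} zero t d = DS-zero k
  DS-sum (suc n) t d = DS-+ (d Fin.zero) (DS-sum n (λ i → t (Fin.suc i)) (λ i → d (Fin.suc i)))

  binomial-mod-p : ∀ f g → DS 0 f → DS 0 g → DS 1 ((f +ₛ g) ^ₛ p -ₛ (f ^ₛ p +ₛ g ^ₛ p))
  binomial-mod-p f g df dg = DS-resp (≈-sym expansion) (DS-sum p′ middle divisible)
    where
    term : Fin (suc p) → PS
    term = BinomialPS.binomialTerm f g p
    middle : Fin p′ → PS
    middle i = term (Fin.suc (inject₁ i))
    term-K : ∀ k → term k ≈ K (+ (p C toℕ k)) *ₛ (f ^ₛ toℕ k *ₛ g ^ₛ (p ∸ toℕ k))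
    term-K k = ≈-trans (×-K (p C toℕ k) _) (*ₛ-congˡ (*ₛ-cong (^-^ₛ f (toℕ k)) (^-^ₛ g (p ∸ toℕ k))))
    divisible : ∀ i → DS 1 (middle i)
    divisible i = DS-resp (≈-sym (term-K (Fin.suc (inject₁ i)))) (DS-K-multiple _
      (p∣pCk (suc (toℕ (inject₁ i))) (s≤s z≤n) (s≤s (subst (_< p′) (sym (FinP.toℕ-inject₁ i)) (FinP.toℕ<n i))))
      (DS-* (DS-^ (suc (toℕ (inject₁ i))) df) (DS-^ (p ∸ suc (toℕ (inject₁ i))) dg)))
    firstTerm : term Fin.zero ≈ g ^ₛ p
    firstTerm = ≈-trans (term-K Fin.zero) (≈-trans (*ₛ-congʳ K-1) (≈-trans (PSR.*-identityˡ _) (PSR.*-identityˡ _)))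
    lastTerm : term (Fin.suc (Fin.fromℕ p′)) ≈ f ^ₛ p
    lastTerm = ≈-trans (term-K (Fin.suc (Fin.fromℕ p′))) (≈-trans (≡⇒≈ (cong (λ k → K (+ (p C suc k)) *ₛ (f ^ₛ suc k *ₛ g ^ₛ (p ∸ suc k))) (FinP.toℕ-fromℕ p′)))
      (≈-trans (*ₛ-cong (≈-trans (≡⇒≈ (cong (K ∘ +_) (nCn≡1 p))) K-1) (≈-trans (*ₛ-congˡ (≡⇒≈ (cong (g ^ₛ_) (ℕP.n∸n≡0 p′)))) (PSR.*-identityʳ _))) (PSR.*-identityˡ _)))
    expansion : (f +ₛ g) ^ₛ p -ₛ (f ^ₛ p +ₛ g ^ₛ p) ≈ SumPS.sum middle
    expansion = ≈-trans (-ₛ-cong (≈-trans (≈-sym (^-^ₛ (f +ₛ g) p)) (≈-trans (BinomialPS.theorem p f g)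
        (+ₛ-cong firstTerm (≈-trans (SumPS.sum-init-last (λ i → term (Fin.suc i))) (+ₛ-congˡ lastTerm))))) ≈-refl)
      (solve 3 (λ f g m → (g :+ (m :+ f)) :- (f :+ g) := m) ≈-refl (f ^ₛ p) (g ^ₛ p) (SumPS.sum middle))

  Fermat : PS → Set
  Fermat f = DS 1 (f ^ₛ p -ₛ f)

  Fermat-resp : ∀ {f g} → f ≈ g → Fermat f → Fermat g
  Fermat-resp e = DS-resp (-ₛ-cong (^ₛ-cong p e) e)

  Fermat-zero : Fermat zeroS
  Fermat-zero = DS-resp (≈-sym (≈-trans (-ₛ-cong (PSR.zeroˡ (zeroS ^ₛ p′)) ≈-refl) (-ₛ-self zeroS))) (DS-zero 1)

  Fermat-one : Fermat oneS
  Fermat-one = DS-resp (≈-sym (≈-trans (-ₛ-cong (one-^ₛ p) ≈-refl) (-ₛ-self oneS))) (DS-zero 1)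

  Fermat-+ : ∀ {f g} → DS 0 f → DS 0 g → Fermat f → Fermat g → Fermat (f +ₛ g)
  Fermat-+ {f} {g} df dg d e = DS-resp (solve 5 (λ s f g x y → (s :- (x :+ y)) :+ ((x :- f) :+ (y :- g)) := s :- (f :+ g)) ≈-refl ((f +ₛ g) ^ₛ p) f g (f ^ₛ p) (g ^ₛ p))
    (DS-+ (binomial-mod-p f g df dg) (DS-+ d e))

  -- The binomial congruence is applied to f + (-f) = 0, which yields the sign of (-f)^p modulo p
  -- without regard to the parity of p.
  Fermat-neg : ∀ {f} → DS 0 f → Fermat f → Fermat (-ₛ f)
  Fermat-neg {f} df d = DS-resp (solve 4 (λ f s x y → (s :- (s :- (x :+ y))) :- (x :- f) := y :- (:- f)) ≈-refl f ((f +ₛ -ₛ f) ^ₛ p) (f ^ₛ p) ((-ₛ f) ^ₛ p))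
    (DS-- (DS-- (DS-resp (≈-sym (≈-trans (^ₛ-cong p (-ₛ-self f)) (PSR.zeroˡ (zeroS ^ₛ p′)))) (DS-zero 1))
      (binomial-mod-p f (-ₛ f) df (DS-resp (PSR.+-identityˡ (-ₛ f)) (DS-- (DS-zero 0) df)))) d)

  Fermat-nat : ∀ n → Fermat (K (+ n))
  Fermat-nat zero = Fermat-resp (≈-sym K-0) Fermat-zero
  Fermat-nat (suc n) = Fermat-resp (≈-sym (K-+ (+ 1) (+ n))) (Fermat-+ (DS-K (+ 1)) (DS-K (+ n)) (Fermat-resp (≈-sym K-1) Fermat-one) (Fermat-nat n))

  Fermat-int : ∀ z → Fermat (K z)
  Fermat-int (+ n) = Fermat-nat n
  Fermat-int (-[1+ n ]) = Fermat-resp (≈-sym (K-neg (+ suc n))) (Fermat-neg (DS-K (+ suc n)) (Fermat-nat (suc n)))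

  -- With b x = a for integers a and b, p ∤ b, one has b (x^p - x) = (a^p - a) - (b^p - b) x^p. The
  -- integer case settles the right side, and b is cancelled.
  Fermat-const : ∀ {x} → D 0 x → Fermat (const x)
  Fermat-const {x} d@(mkD b a p∤b e) = DS-cancel b p∤b (DS-resp
      (≈-trans (-ₛ-cong (-ₛ-cong (≈-trans (^ₛ-cong p (≈-sym scaled)) (^ₛ-distrib-*ₛ (K (+ b)) (const x) p)) (≈-sym scaled)) ≈-refl)
        (solve 4 (λ b c x y → (b :* x :- c :* y) :- (b :- c) :* x := c :* (x :- y)) ≈-refl (K (+ b) ^ₛ p) (K (+ b)) (const x ^ₛ p) (const x)))
      (DS-- (Fermat-int a) (DS-* (Fermat-nat b) (DS-^ p (DS-const d)))))
    where
    scaled : K (+ b) *ₛ const x ≈ K a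
    scaled = ≈-trans (*ₛ-congʳ (≡⇒≈ (K-def (+ b)))) (≈-trans (const-* (nat b) x) (≡⇒≈ (trans (cong const (trans e (one-· (ι a) ι-1))) (sym (K-def a)))))

  -- The substitution q ↦ q^p is the special case t = q^p of composition, so it inherits
  -- multiplicativity.
  module Sub = Compose (qpow p) refl

  subPow-step : ∀ f → subPow p f ≈ const (f 0) +ₛ qpow p *ₛ subPow p (tail f)
  subPow-step f .at zero = sym (trans (+ₛ-at _ _ 0) (trans (cong (λ z → f 0 + z) (qpow-*ₛ-< p (subPow p (tail f)) 0 (s≤s z≤n))) (ℚP.+-identityʳ (f 0))))
  subPow-step f .at (suc m) = trans (sumTo-first m (λ k → if k ℕ.* p ≡ᵇ suc m then f k else 0ℚ))
    (trans (ℚP.+-identityˡ _) (sym (trans (+ₛ-at _ _ (suc m)) (trans (ℚP.+-identityˡ _) rest))))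
    where
    rest : (qpow p *ₛ subPow p (tail f)) (suc m) ≡ sumTo m (λ k → if p ℕ.+ k ℕ.* p ≡ᵇ suc m then f (suc k) else 0ℚ)
    rest with p ℕP.≤? suc m
    ... | no p≰m = trans (qpow-*ₛ-< p _ (suc m) (ℕP.≰⇒> p≰m)) (sym (sumTo-0 m (λ k _ → absent k)))
      where
      absent : ∀ k → (if p ℕ.+ k ℕ.* p ≡ᵇ suc m then f (suc k) else 0ℚ) ≡ 0ℚ
      absent k with p ℕ.+ k ℕ.* p ≡ᵇ suc m in eq
      ... | false = refl
      ... | true = ⊥-elim (p≰m (subst (p ≤_) (ℕP.≡ᵇ⇒≡ _ _ (subst Bool.T (sym eq) _)) (ℕP.m≤m+n p (k ℕ.* p))))
    ... | yes p≤m with ℕP.m≤n⇒∃[o]m+o≡n p≤m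
    ... | k , refl = trans (qpow-*ₛ p (subPow p (tail f)) k) (trans (sym (sumTo-extend k p′ _ (λ i k<i → beyond i k<i)))
          (sumTo-cong (p′ ℕ.+ k) (λ i _ → cong (λ b → if b then f (suc i) else 0ℚ) (shift p (i ℕ.* p) k))))
      where
      shift : ∀ c a b → (a ≡ᵇ b) ≡ (c ℕ.+ a ≡ᵇ c ℕ.+ b)
      shift zero a b = refl
      shift (suc c) a b = shift c a b
      beyond : ∀ i → k < i → (if i ℕ.* p ≡ᵇ k then f (suc i) else 0ℚ) ≡ 0ℚ
      beyond i k<i with i ℕ.* p ≡ᵇ k in eq
      ... | false = refl
      ... | true = ⊥-elim (ℕP.<-irrefl (sym (ℕP.≡ᵇ⇒≡ (i ℕ.* p) k (subst Bool.T (sym eq) _))) (ℕP.<-≤-trans k<i (ℕP.m≤m*n i p)))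

  subPow-compose[] : ∀ n f → subPow p f ≈[ n ] Sub.compose f
  subPow-compose[] (suc n) f = ≈[]-trans {suc n} {subPow p f} {const (f 0) +ₛ qpow p *ₛ Sub.compose (tail f)}
    (≈[]-trans {suc n} {subPow p f} {const (f 0) +ₛ qpow p *ₛ subPow p (tail f)} (≈⇒≈[] (suc n) (subPow-step f))
      (+ₛ-cong[] (suc n) {const (f 0)} {const (f 0)} (λ _ _ → refl) (*ₛ-gain n {qpow p} {subPow p (tail f)} {Sub.compose (tail f)} refl (subPow-compose[] n (tail f)))))
    (≈⇒≈[] (suc n) (≈-sym (Sub.compose-step f)))

  subPow-compose : ∀ f → subPow p f ≈ Sub.compose f
  subPow-compose f = ≈[]⇒≈ (λ n → subPow-compose[] n f)

  -- Split f = f(0) + q · tail. Modulo p, f^p is f(0)^p + q^p tail^p; Fermat's congruence treats the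
  -- constant, and the tail enters with index n - p, whence strong induction on n over all f.
  frobenius : ∀ n f → DS 0 f → D 1 ((f ^ₛ p -ₛ Sub.compose f) n)
  frobenius = <-rec (λ n → ∀ f → DS 0 f → D 1 ((f ^ₛ p -ₛ Sub.compose f) n)) step
    where
    step : ∀ n → (∀ {m} → m < n → ∀ f → DS 0 f → D 1 ((f ^ₛ p -ₛ Sub.compose f) m)) → ∀ f → DS 0 f → D 1 ((f ^ₛ p -ₛ Sub.compose f) n)
    step n rec f df = D-resp (sym (trans (at decomposition n) (trans (+ₛ-at _ _ n) (cong (_+ (qpow p *ₛ R) n) (+ₛ-at _ _ n)))))
      (D-+ (D-+ (binomial-mod-p _ _ dc dX n) (Fermat-const (df 0) n)) shifted)
      where
      c g R : PS
      c = const (f 0)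
      g = X *ₛ tail f
      R = tail f ^ₛ p -ₛ Sub.compose (tail f)
      dc : DS 0 c
      dc = DS-const (df 0)
      dX : DS 0 g
      dX = DS-* (DS-qpow 1) (λ m → df (suc m))
      decomposition : f ^ₛ p -ₛ Sub.compose f ≈ ((c +ₛ g) ^ₛ p -ₛ (c ^ₛ p +ₛ g ^ₛ p)) +ₛ (c ^ₛ p -ₛ c) +ₛ qpow p *ₛ R
      decomposition = ≈-trans (-ₛ-cong (^ₛ-cong p (head-tail f)) (Sub.compose-step f)) (≈-trans
        (solve 5 (λ s c C G q → s :- (c :+ q) := (s :- (C :+ G)) :+ (C :- c) :+ (G :- q)) ≈-refl ((c +ₛ g) ^ₛ p) c (c ^ₛ p) (g ^ₛ p) (qpow p *ₛ Sub.compose (tail f)))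
        (+ₛ-congˡ (≈-trans (-ₛ-cong (≈-trans (^ₛ-distrib-*ₛ X (tail f) p) (*ₛ-congʳ (X-^ₛ p))) ≈-refl)
          (solve 3 (λ q a b → q :* a :- q :* b := q :* (a :- b)) ≈-refl (qpow p) (tail f ^ₛ p) (Sub.compose (tail f))))))
      shifted : D 1 ((qpow p *ₛ R) n)
      shifted with p ℕP.≤? n
      ... | no p≰n = D-resp (sym (qpow-*ₛ-< p R n (ℕP.≰⇒> p≰n))) (D-zero 1)
      ... | yes p≤n with ℕP.m≤n⇒∃[o]m+o≡n p≤n
      ... | k , refl = D-resp (sym (qpow-*ₛ p R k)) (rec (ℕP.m<n+m k (s≤s z≤n)) (tail f) (λ m → df (suc m)))

  -- A factor in q^p passes through Λ_p: each coefficient peeled off g shifts the index p n by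
  -- exactly p.
  Λ-compose : ∀ f n g → (f *ₛ Sub.compose g) (p ℕ.* n) ≡ (Λ p f *ₛ g) n
  Λ-compose f n g = trans (at split (p ℕ.* n)) (trans (+ₛ-at _ _ (p ℕ.* n)) (trans (cong (_+ (qpow p *ₛ (f *ₛ c)) (p ℕ.* n)) (const-*ₛ (g 0) f (p ℕ.* n)))
      (trans (rest n) (at (PSR.*-comm g (Λ p f)) n))))
    where
    c : PS
    c = Sub.compose (tail g)
    split : f *ₛ Sub.compose g ≈ const (g 0) *ₛ f +ₛ qpow p *ₛ (f *ₛ c)
    split = ≈-trans (*ₛ-congˡ (Sub.compose-step g)) (solve 4 (λ f a q c → f :* (a :+ q :* c) := a :* f :+ q :* (f :* c)) ≈-refl f (const (g 0)) (qpow p) c)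
    rest : ∀ n → g 0 · f (p ℕ.* n) + (qpow p *ₛ (f *ₛ c)) (p ℕ.* n) ≡ (g *ₛ Λ p f) n
    rest zero = trans (cong (λ z → g 0 · f (p ℕ.* 0) + z) (trans (cong (qpow p *ₛ (f *ₛ c)) (ℕP.*-zeroʳ p)) (qpow-*ₛ-< p (f *ₛ c) 0 (s≤s z≤n))))
      (trans (ℚP.+-identityʳ _) (sym (*ₛ-at-0 g (Λ p f))))
    rest (suc m) = trans (cong (λ z → g 0 · f (p ℕ.* suc m) + z) (trans (cong (qpow p *ₛ (f *ₛ c)) (ℕP.*-suc p m))
        (trans (qpow-*ₛ p (f *ₛ c) (p ℕ.* m)) (trans (Λ-compose f m (tail g)) (at (PSR.*-comm (Λ p f) (tail g)) m)))))
      (sym (*ₛ-at-suc g (Λ p f) m))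

-- The congruence for powers of H

res-%3 : ∀ n → n % 3 ≡ 1 → res n ≡ r1
res-%3 n e = trans (cong res (trans (m≡m%n+[m/n]*n n 3) (cong (ℕ._+ (n ℕ./ 3) ℕ.* 3) e))) (cong succ₃ (res-*3 (n ℕ./ 3)))

res-*-one : ∀ p e → res p ≡ r1 → res (e ℕ.* p) ≡ res e
res-*-one p zero r = refl
res-*-one p (suc e) r = trans (res-+ p (e ℕ.* p)) (cong₂ _⊞_ r (res-*-one p e r))

module Supercongruence (p′ : ℕ) (p-prime : Prime (suc p′)) (7≤p : 7 ≤ suc p′) (p%3≡1 : suc p′ % 3 ≡ 1)
  (hypothesis : ∀ ℓ → 1 ≤ ℓ → ℓ ≤ 3 → CongPS (suc p′) 4 (Λ (suc p′) (Cmix ⊛ pow (Up (suc p′)) ℓ)) (λ _ → 0ℚ)) where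
  open Padic p′ p-prime
  open PadicSeries p′ p-prime

  DS-cyclo : ∀ j → DS 0 (cyclo j)
  DS-cyclo j = DS-- DS-one (DS-qpow (suc j))

  DS-etaProd : ∀ j → DS 0 (etaProd j)
  DS-etaProd zero = DS-one
  DS-etaProd (suc j) = DS-resp (≈-sym (etaProd-suc j)) (DS-* (DS-etaProd j)
    (DS-* (DS-^ 12 (DS-cyclo (pred3 j))) (DS-^ 12 (DS-inv1 (DS-cyclo j)))))

  DS-u : DS 0 uS
  DS-u zero = D-zero 0
  DS-u (suc n) = DS-etaProd n n

  DS-1+27u : DS 0 1+27u
  DS-1+27u = DS-+ (DS-K (+ 1)) (DS-* (DS-K (+ 27)) DS-u)

  DS-T : DS 0 tOverQ
  DS-T n = DS-resp (≈-sym tS-inv1) (DS-* DS-u (DS-inv1 (DS-* DS-1+27u DS-1+27u))) (suc n)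

  DS-H : DS 0 Hmix
  DS-H = DS-inv1 DS-T

  C-term : ∀ {k} z (r : Z3) d → D k (nat d · nat d · nat d · nat d) → D k (ι z · (ι (χ₃ᶻ r) · nat d · nat d · nat d · nat d))
  C-term {k} z r d e = D-resp (solveℚ 3 (λ z c d → z ⟨·⟩ c ⟨·⟩ (d ⟨·⟩ d ⟨·⟩ d ⟨·⟩ d) ⟨=⟩ z ⟨·⟩ (c ⟨·⟩ d ⟨·⟩ d ⟨·⟩ d ⟨·⟩ d)) refl (ι z) (ι (χ₃ᶻ r)) (nat d))
    (D-· {0} {k} (D-· {0} {0} (D-ι z) (D-ι (χ₃ᶻ r))) e)

  D-Ccoeff : ∀ {k} d e → D k (nat d · nat d · nat d · nat d) → D k (Ccoeff d e)
  D-Ccoeff d e h = D-resp (sym (expand d e)) (D-+ (C-term (+ 3) (res d) d h) (C-term (neg 27) (res e) d h))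

  D-Ccoeff-0 : ∀ d e → D 0 (Ccoeff d e)
  D-Ccoeff-0 d e = D-Ccoeff d e (D-· (D-· (D-· (D-ι (+ d)) (D-ι (+ d))) (D-ι (+ d))) (D-ι (+ d)))

  D-Ccoeff-4 : ∀ d e → p ∣ d → D 4 (Ccoeff d e)
  D-Ccoeff-4 d e (divides q refl) = D-Ccoeff d e (D-· (D-· (D-· D-d D-d) D-d) D-d)
    where
    D-d : D 1 (nat (q ℕ.* p))
    D-d = D-resp (sym (nat-* q p)) (D-· {0} {1} (D-ι (+ q)) (D-resp (cong nat (ℕP.*-identityʳ p)) (D-p^ 1)))

  D-Lam : ∀ {k} f → (∀ d e → D k (f d e)) → DS k (Lam f)
  D-Lam f h n = D-resp (sym (Lam-at f n)) (D-sumFrom1 n _ (λ d → D-sumFrom1 n _ (λ e → D-· {0} (D-ind (d ℕ.* e ≡ᵇ n)) (h d e))))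
    where
    D-ind : ∀ b → D 0 (ind b)
    D-ind true = D-one
    D-ind false = D-zero 0

  DS-C : DS 0 Cmix
  DS-C = DS-resp (≈-sym Cmix-Lam) (DS-+ DS-one (D-Lam Ccoeff D-Ccoeff-0))

  -- Only terms with p ∣ d are dropped, each a multiple of p⁴ through the factor d⁴. The remaining
  -- Lambert series is exactly, not merely modulo p⁴, invariant under n ↦ p n.
  primeToP : ℕ → ℕ → ℚ
  primeToP d e with p ∣? d
  ... | yes _ = 0ℚ
  ... | no _ = Ccoeff d e

  primeToP-multiple : ∀ d e → p ∣ d → primeToP d e ≡ 0ℚ
  primeToP-multiple d e p∣d with p ∣? d
  ... | yes _ = refl
  ... | no p∤d = ⊥-elim (p∤d p∣d)

  primeToP-close : ∀ d e → D 4 (Ccoeff d e - primeToP d e)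
  primeToP-close d e with p ∣? d
  ... | yes p∣d = D-resp (sym (ℚP.+-identityʳ (Ccoeff d e))) (D-Ccoeff-4 d e p∣d)
  ... | no _ = D-resp (sym (ℚP.+-inverseʳ (Ccoeff d e))) (D-zero 4)

  primeToP-scale : ∀ d e → primeToP d (e ℕ.* p) ≡ primeToP d e
  primeToP-scale d e with p ∣? d
  ... | yes _ = refl
  ... | no _ = trans (expand d (e ℕ.* p)) (trans (cong (λ r → ι (+ 3) · (ι (χ₃ᶻ (res d)) · nat d · nat d · nat d · nat d) + ι (neg 27) · (ι (χ₃ᶻ r) · nat d · nat d · nat d · nat d))
      (res-*-one p e (res-%3 p p%3≡1))) (sym (expand d e)))

  δ-scale : ∀ a b → δ (a ℕ.* p) (b ℕ.* p) ≡ δ a b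
  δ-scale a b with a ℕP.≟ b
  ... | yes refl = trans (δ-refl (a ℕ.* p)) (sym (δ-refl a))
  ... | no a≢b = trans (δ-≢ _ _ (a≢b ∘ ℕP.*-cancelʳ-≡ a b p)) (sym (δ-≢ a b a≢b))

  -- If d e = n p and p ∤ d, then p ∣ e. Replacing e by e p changes neither d nor χ₃(e), since p ≡ 1
  -- modulo 3.
  Lam-primeToP : ∀ n → Lam primeToP (n ℕ.* p) ≡ Lam primeToP n
  Lam-primeToP n = trans (Lam-multiplesʳ p′ (n ℕ.* p) primeToP unsupported)
    (trans (sum²-cong (n ℕ.* p) (λ d e _ _ → cong₂ _·_ (δ-scale (d ℕ.* e) n) (primeToP-scale d e)))
      (sym (Lam-bound primeToP (ℕP.m≤m*n n p))))
    where
    unsupported : ∀ d e → d ℕ.* e ≡ n ℕ.* p → ¬ (p ∣ e) → primeToP d e ≡ 0ℚ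
    unsupported d e de≡np p∤e with euclidsLemma d e p-prime (divides n de≡np)
    ... | inj₁ p∣d = primeToP-multiple d e p∣d
    ... | inj₂ p∣e = ⊥-elim (p∤e p∣e)

  close : DS 4 (Lam Ccoeff -ₛ Lam primeToP)
  close = DS-resp difference (D-Lam (λ d e → Ccoeff d e - primeToP d e) primeToP-close)
    where
    difference : Lam (λ d e → Ccoeff d e - primeToP d e) ≈ Lam Ccoeff -ₛ Lam primeToP
    difference = ≈-trans (solve 2 (λ x y → x := (x :+ y) :- y) ≈-refl (Lam (λ d e → Ccoeff d e - primeToP d e)) (Lam primeToP)) (-ₛ-cong (≈-trans (≈-sym (Lam-+ _ _))
      (Lam-cong (λ d e _ _ → solveℚ 2 (λ x y → (x ⟨-⟩ y) ⟨+⟩ y ⟨=⟩ x) refl (Ccoeff d e) (primeToP d e)))) ≈-refl)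

  ΛC : ∀ n → D 4 (Cmix (p ℕ.* n) - Cmix n)
  ΛC zero = D-resp (sym (trans (cong (λ k → Cmix k - 1ℚ) (ℕP.*-zeroʳ p)) refl)) (D-zero 4)
  ΛC (suc n) = D-resp (sym (trans (cong₂ _-_ (value (p ℕ.* suc n)) (value (suc n)))
      (trans (solveℚ 3 (λ o x y → (o ⟨+⟩ x) ⟨-⟩ (o ⟨+⟩ y) ⟨=⟩ x ⟨-⟩ y) refl (oneS (suc n)) (Lam Ccoeff (p ℕ.* suc n)) (Lam Ccoeff (suc n)))
      (trans (solveℚ 4 (λ x y z w → x ⟨-⟩ y ⟨=⟩ (x ⟨-⟩ z) ⟨-⟩ (y ⟨-⟩ w) ⟨+⟩ (z ⟨-⟩ w)) refl (Lam Ccoeff (p ℕ.* suc n)) (Lam Ccoeff (suc n)) (Lam primeToP (p ℕ.* suc n)) (Lam primeToP (suc n)))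
      (trans (cong₂ (λ a b → a - b + (Lam primeToP (p ℕ.* suc n) - Lam primeToP (suc n))) (sym (-ₛ-at _ _ (p ℕ.* suc n))) (sym (-ₛ-at _ _ (suc n))))
        (trans (cong (λ z → gap (p ℕ.* suc n) - gap (suc n) + (z - Lam primeToP (suc n))) (trans (cong (Lam primeToP) (ℕP.*-comm p (suc n))) (Lam-primeToP (suc n))))
          (trans (cong (λ z → gap (p ℕ.* suc n) - gap (suc n) + z) (ℚP.+-inverseʳ (Lam primeToP (suc n)))) (ℚP.+-identityʳ _))))))))
      (D-- (close (p ℕ.* suc n)) (close (suc n)))
    where
    gap : PS
    gap = Lam Ccoeff -ₛ Lam primeToP
    value : ∀ m → Cmix m ≡ oneS m + Lam Ccoeff m
    value m = trans (at Cmix-Lam m) (+ₛ-at oneS (Lam Ccoeff) m)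

  -- W is t^p/t(q^p), the powers of q having cancelled; x = W - 1 is divisible by p by the Frobenius
  -- congruence, Y is 1/W and U is log W.
  Sp W x Y U : PS
  Sp = subPow p tOverQ
  W = tOverQ ^ₛ p *ₛ inv1 Sp
  x = W -ₛ K (+ 1)
  Y = inv1 W
  U = Up p

  Sp-at-0 : Sp 0 ≡ 1ℚ
  Sp-at-0 = Tq-at-0

  DS-Sp : DS 0 Sp
  DS-Sp n = D-sumTo n _ term
    where
    term : ∀ k → D 0 (if k ℕ.* p ≡ᵇ n then tOverQ k else 0ℚ)
    term k with k ℕ.* p ≡ᵇ n
    ... | true = DS-T k
    ... | false = D-zero 0

  W-at-0 : W 0 ≡ 1ℚ
  W-at-0 = *ₛ-at-0-one (tOverQ ^ₛ p) (inv1 Sp) (^ₛ-at-0-one tOverQ p Tq-at-0) refl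

  x-at-0 : x 0 ≡ 0ℚ
  x-at-0 = trans (-ₛ-at W (K (+ 1)) 0) (trans (cong₂ _-_ W-at-0 (trans (K-at-0 (+ 1)) ι-1)) (ℚP.+-inverseʳ 1ℚ))

  DS-W : DS 0 W
  DS-W = DS-* (DS-^ p DS-T) (DS-inv1 DS-Sp)

  DS-Y : DS 0 Y
  DS-Y = DS-inv1 DS-W

  DS-x : DS 1 x
  DS-x = DS-resp (≈-trans (solve 3 (λ t s i → (t :- s) :* i := t :* i :- s :* i) ≈-refl (tOverQ ^ₛ p) Sp (inv1 Sp))
      (-ₛ-cong ≈-refl (≈-trans (*ₛ-inv1 Sp Sp-at-0) (≈-sym K-1))))
    (DS-* {1} {0} (DS-resp (-ₛ-cong ≈-refl (≈-sym (subPow-compose tOverQ))) (λ n → frobenius n tOverQ DS-T)) (DS-inv1 DS-Sp))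

  -- The logarithm modulo p⁴

  logTerm : ℕ → ℕ → ℚ
  logTerm n zero = 0ℚ
  logTerm n (suc j) = (if j % 2 ≡ᵇ 0 then 1ℚ else - 1ℚ) · (recip j · (x ^ₛ suc j) n)

  U-at : ∀ n → U n ≡ sumTo n (logTerm n)
  U-at n = sumTo-cong n (λ { zero _ → refl ; (suc j) _ → cong₂ (λ a b → (if j % 2 ≡ᵇ 0 then 1ℚ else - 1ℚ) · (a · b)) (sym (recip-def j))
    (at (≈-trans (pow-^ₛ _ (suc j)) (^ₛ-cong (suc j) (≈-trans (-ₛ≈⊖ _ oneS) (-ₛ-cong (⊛≈*ₛ (pow-^ₛ tOverQ p) ≈-refl) (≈-sym K-1))))) n) })

  logTerm-late : ∀ n j → 3 ≤ j → D 4 (logTerm n (suc j))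
  logTerm-late n j 3≤j = D-· {0} (sign (j % 2 ≡ᵇ 0)) (D-recip-4 7≤p j 3≤j (DS-^-gain (suc j) DS-x n))
    where
    sign : ∀ b → D 0 (if b then 1ℚ else - 1ℚ)
    sign true = D-one
    sign false = D-neg D-one

  logTerm-vanish : ∀ n k → n < k → logTerm n k ≡ 0ℚ
  logTerm-vanish n (suc j) n<k = trans (cong (λ z → s · (recip j · z)) (^ₛ-vanish x (suc j) n x-at-0 n<k))
    (trans (cong (λ z → s · z) (ℚP.*-zeroʳ (recip j))) (ℚP.*-zeroʳ s))
    where
    s : ℚ
    s = if j % 2 ≡ᵇ 0 then 1ℚ else - 1ℚ

  -- Six times x - x²/2 + x³/3; the factor 6 keeps the coefficients integral and is later cancelled,
  -- being prime to p.
  cubicLog : PS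
  cubicLog = K (+ 6) *ₛ x -ₛ K (+ 3) *ₛ (x *ₛ x) +ₛ K (+ 2) *ₛ (x *ₛ (x *ₛ x))

  six-logTerms : ∀ n → ι (+ 6) · sumTo 3 (logTerm n) ≡ cubicLog n
  six-logTerms n = begin
    ι (+ 6) · (0ℚ + 1ℚ · (recip 0 · (x ^ₛ 1) n) + (- 1ℚ) · (recip 1 · (x ^ₛ 2) n) + 1ℚ · (recip 2 · (x ^ₛ 3) n))
      ≡⟨ cong₂ (λ z o → ι (+ 6) · (z + o · (recip 0 · (x ^ₛ 1) n) + (- o) · (recip 1 · (x ^ₛ 2) n) + o · (recip 2 · (x ^ₛ 3) n))) (sym ι-0) (sym ι-1) ⟩
    ι (+ 6) · (ι (+ 0) + ι (+ 1) · (recip 0 · (x ^ₛ 1) n) + (- ι (+ 1)) · (recip 1 · (x ^ₛ 2) n) + ι (+ 1) · (recip 2 · (x ^ₛ 3) n))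
      ≡⟨ solveℚ 6 (λ a b c x y z → conℚ (+ 6) ⟨·⟩ (conℚ (+ 0) ⟨+⟩ conℚ (+ 1) ⟨·⟩ (a ⟨·⟩ x) ⟨+⟩ (⟨-⟩ conℚ (+ 1)) ⟨·⟩ (b ⟨·⟩ y) ⟨+⟩ conℚ (+ 1) ⟨·⟩ (c ⟨·⟩ z))
           ⟨=⟩ conℚ (+ 6) ⟨·⟩ (conℚ (+ 1) ⟨·⟩ a ⟨·⟩ x) ⟨-⟩ conℚ (+ 3) ⟨·⟩ (conℚ (+ 2) ⟨·⟩ b ⟨·⟩ y) ⟨+⟩ conℚ (+ 2) ⟨·⟩ (conℚ (+ 3) ⟨·⟩ c ⟨·⟩ z)) refl
           (recip 0) (recip 1) (recip 2) ((x ^ₛ 1) n) ((x ^ₛ 2) n) ((x ^ₛ 3) n) ⟩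
    ι (+ 6) · (nat 1 · recip 0 · (x ^ₛ 1) n) - ι (+ 3) · (nat 2 · recip 1 · (x ^ₛ 2) n) + ι (+ 2) · (nat 3 · recip 2 · (x ^ₛ 3) n)
      ≡⟨ cong₂ _+_ (cong₂ _-_ (cong (λ z → ι (+ 6) · z) (power 0 x (PSR.*-identityʳ x))) (cong (λ z → ι (+ 3) · z) (power 1 (x *ₛ x) (*ₛ-congˡ (PSR.*-identityʳ x)))))
           (cong (λ z → ι (+ 2) · z) (power 2 (x *ₛ (x *ₛ x)) (*ₛ-congˡ (*ₛ-congˡ (PSR.*-identityʳ x))))) ⟩
    ι (+ 6) · x n - ι (+ 3) · (x *ₛ x) n + ι (+ 2) · (x *ₛ (x *ₛ x)) n
      ≡⟨ sym (trans (+ₛ-at _ _ n) (cong₂ _+_ (trans (-ₛ-at _ _ n) (cong₂ _-_ (K-*ₛ (+ 6) x n) (K-*ₛ (+ 3) (x *ₛ x) n))) (K-*ₛ (+ 2) _ n))) ⟩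
    cubicLog n ∎
    where
    open ≡-Reasoning
    power : ∀ j f → x ^ₛ suc j ≈ f → nat (suc j) · recip j · (x ^ₛ suc j) n ≡ f n
    power j f e = trans (one-· _ (recip-inverse j)) (at e n)

  remainder : PS
  remainder = K (+ 6) *ₛ U -ₛ cubicLog

  DS-remainder : DS 4 remainder
  DS-remainder n = D-resp (sym (trans (-ₛ-at _ _ n) (cong₂ _-_ (trans (K-*ₛ (+ 6) U n) (cong (λ z → ι (+ 6) · z) long)) (sym (six-logTerms n)))))
      (D-resp (solveℚ 2 (λ a b → conℚ (+ 6) ⟨·⟩ (a ⟨-⟩ b) ⟨=⟩ conℚ (+ 6) ⟨·⟩ a ⟨-⟩ conℚ (+ 6) ⟨·⟩ b) refl (sumTo (n ℕ.+ 3) (logTerm n)) (sumTo 3 (logTerm n)))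
        (D-· {0} (D-ι (+ 6)) (late n)))
    where
    -- Padding the sum to n + 3 terms, the added ones being zero, makes the first three available
    -- even when n < 3.
    long : U n ≡ sumTo (n ℕ.+ 3) (logTerm n)
    long = trans (U-at n) (trans (sym (sumTo-extend n 3 (logTerm n) (logTerm-vanish n))) (cong (λ m → sumTo m (logTerm n)) (ℕP.+-comm 3 n)))
    late : ∀ m → D 4 (sumTo (m ℕ.+ 3) (logTerm n) - sumTo 3 (logTerm n))
    late zero = D-resp (sym (ℚP.+-inverseʳ (sumTo 3 (logTerm n)))) (D-zero 4)
    late (suc m) = D-resp (solveℚ 3 (λ a b c → (a ⟨-⟩ b) ⟨+⟩ c ⟨=⟩ (a ⟨+⟩ c) ⟨-⟩ b) refl (sumTo (m ℕ.+ 3) (logTerm n)) (sumTo 3 (logTerm n)) (logTerm n (suc (m ℕ.+ 3))))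
      (D-+ (late m) (logTerm-late n (m ℕ.+ 3) (ℕP.m≤n+m 3 m)))

  -- The condition Λ_p(C f) ≡ 0 modulo p⁴ is linear in f but not stable under multiplication. The
  -- arguments below therefore exhibit each target as a linear combination of annihilated series and
  -- multiples of p⁴.
  Annihilated : PS → Set
  Annihilated f = ∀ n → D 4 ((Cmix *ₛ f) (p ℕ.* n))

  A-resp : ∀ {f g} → f ≈ g → Annihilated f → Annihilated g
  A-resp e a n = D-resp (at (*ₛ-congˡ e) (p ℕ.* n)) (a n)

  A-- : ∀ {f g} → Annihilated f → Annihilated g → Annihilated (f -ₛ g)
  A-- {f} {g} a b n = D-resp (trans (sym (-ₛ-at _ _ (p ℕ.* n))) (at (solve 3 (λ c f g → c :* f :- c :* g := c :* (f :- g)) ≈-refl Cmix f g) (p ℕ.* n))) (D-- (a n) (b n))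

  A-K : ∀ z {f} → Annihilated f → Annihilated (K z *ₛ f)
  A-K z {f} a n = D-resp (trans (sym (K-*ₛ z (Cmix *ₛ f) (p ℕ.* n))) (at (solve 3 (λ k c f → k :* (c :* f) := c :* (k :* f)) ≈-refl (K z) Cmix f) (p ℕ.* n)))
    (D-· {0} (D-ι z) (a n))

  A-DS : ∀ {f} → DS 4 f → Annihilated f
  A-DS d n = DS-* {0} {4} DS-C d (p ℕ.* n)

  p∤6 : ¬ (p ∣ 6)
  p∤6 = p∤< 6 (s≤s z≤n) 7≤p

  A-cancel : ∀ {f} → Annihilated (K (+ 6) *ₛ f) → Annihilated f
  A-cancel {f} a n = D-cancel 6 p∤6 (D-resp (trans (at (solve 3 (λ k c f → c :* (k :* f) := k :* (c :* f)) ≈-refl (K (+ 6)) Cmix f) (p ℕ.* n)) (K-*ₛ (+ 6) (Cmix *ₛ f) (p ℕ.* n))) (a n))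

  A-U : ∀ ℓ → 1 ≤ ℓ → ℓ ≤ 3 → Annihilated (U ^ₛ ℓ)
  A-U ℓ 1≤ℓ ℓ≤3 n = D-resp (trans (ℚP.+-identityʳ _) (at (⊛≈*ₛ {Cmix} ≈-refl (pow-^ₛ U ℓ)) (p ℕ.* n))) (DivPow⇒D (hypothesis ℓ 1≤ℓ ℓ≤3 n))

  x⁴ : PS
  x⁴ = x *ₛ x *ₛ x *ₛ x

  A-x⁴ : ∀ {f} → DS 0 f → Annihilated (x⁴ *ₛ f)
  A-x⁴ d = A-DS (DS-* {4} {0} (DS-* {3} {1} (DS-* {2} {1} (DS-* {1} {1} DS-x DS-x) DS-x) DS-x) d)

  A-remainder : ∀ {f} → DS 0 f → Annihilated (remainder *ₛ f)
  A-remainder d = A-DS (DS-* {4} {0} DS-remainder d)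

  v : PS
  v = K (+ 2) *ₛ x -ₛ K (+ 3)

  DS-x0 : DS 0 x
  DS-x0 = DS-≤ z≤n DS-x

  DS-v : DS 0 v
  DS-v = DS-- (DS-* (DS-K (+ 2)) DS-x0) (DS-K (+ 3))

  DS-r0 : DS 0 remainder
  DS-r0 = DS-≤ z≤n DS-remainder

  DS-cubicLog : DS 0 cubicLog
  DS-cubicLog = DS-+ (DS-- (DS-* (DS-K (+ 6)) DS-x0) (DS-* (DS-K (+ 3)) (DS-* DS-x0 DS-x0))) (DS-* (DS-K (+ 2)) (DS-* DS-x0 (DS-* DS-x0 DS-x0)))

  6U : K (+ 6) *ₛ U ≈ cubicLog +ₛ remainder
  6U = solve 2 (λ u y → # 6 :* u := y :+ (# 6 :* u :- y)) ≈-refl U cubicLog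

  -- 6 U = x (6 + x v) up to the remainder; its powers isolate x³, then x², then x.
  A-x³ : Annihilated (x *ₛ (x *ₛ x))
  A-x³ = A-cancel (A-cancel (A-cancel (A-resp identity (A-- (A-- (A-K (+ 216) (A-U 3 (s≤s z≤n) ℕP.≤-refl)) (A-remainder DS-g)) (A-x⁴ DS-h)))))
    where
    g h : PS
    g = K (+ 3) *ₛ (cubicLog *ₛ cubicLog) +ₛ K (+ 3) *ₛ (cubicLog *ₛ remainder) +ₛ remainder *ₛ remainder
    h = K (+ 108) *ₛ v +ₛ K (+ 18) *ₛ (x *ₛ (v *ₛ v)) +ₛ x *ₛ x *ₛ (v *ₛ (v *ₛ v))
    DS-g : DS 0 g
    DS-g = DS-+ (DS-+ (DS-* (DS-K (+ 3)) (DS-* DS-cubicLog DS-cubicLog)) (DS-* (DS-K (+ 3)) (DS-* DS-cubicLog DS-r0))) (DS-* DS-r0 DS-r0)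
    DS-h : DS 0 h
    DS-h = DS-+ (DS-+ (DS-* (DS-K (+ 108)) DS-v) (DS-* (DS-K (+ 18)) (DS-* DS-x0 (DS-* DS-v DS-v)))) (DS-* (DS-* DS-x0 DS-x0) (DS-* DS-v (DS-* DS-v DS-v)))
    identity : K (+ 216) *ₛ U ^ₛ 3 -ₛ remainder *ₛ g -ₛ x⁴ *ₛ h ≈ K (+ 6) *ₛ (K (+ 6) *ₛ (K (+ 6) *ₛ (x *ₛ (x *ₛ x))))
    identity = ≈-trans (-ₛ-cong (-ₛ-cong (≈-trans (*ₛ-congˡ (*ₛ-congˡ (*ₛ-congˡ (PSR.*-identityʳ U))))
        (≈-trans (solve 1 (λ u → # 216 :* (u :* (u :* u)) := (# 6 :* u) :* ((# 6 :* u) :* (# 6 :* u))) ≈-refl U) (*ₛ-cong 6U (*ₛ-cong 6U 6U)))) ≈-refl) ≈-refl)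
      (solve 2 (λ x r → let y = # 6 :* x :- # 3 :* (x :* x) :+ # 2 :* (x :* (x :* x)) ; v = # 2 :* x :- # 3 in
        (y :+ r) :* ((y :+ r) :* (y :+ r)) :- r :* (# 3 :* (y :* y) :+ # 3 :* (y :* r) :+ r :* r)
          :- x :* x :* x :* x :* (# 108 :* v :+ # 18 :* (x :* (v :* v)) :+ x :* x :* (v :* (v :* v)))
        := # 6 :* (# 6 :* (# 6 :* (x :* (x :* x))))) ≈-refl x remainder)

  A-x² : Annihilated (x *ₛ x)
  A-x² = A-cancel (A-cancel (A-resp identity (A-- (A-- (A-- (A-K (+ 36) (A-U 2 (s≤s z≤n) (s≤s (s≤s z≤n)))) (A-remainder DS-g)) (A-x⁴ DS-h)) (A-K (neg 36) A-x³))))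
    where
    g h : PS
    g = K (+ 2) *ₛ cubicLog +ₛ remainder
    -- The square of 6 x + x² v is 36 x² + 12 x³ v + x⁴ v², and 12 x³ v = 24 x⁴ - 36 x³; this
    -- explains the 24 and the correction -36 x³.
    h = K (+ 24) +ₛ v *ₛ v
    DS-g : DS 0 g
    DS-g = DS-+ (DS-* (DS-K (+ 2)) DS-cubicLog) DS-r0
    DS-h : DS 0 h
    DS-h = DS-+ (DS-K (+ 24)) (DS-* DS-v DS-v)
    identity : K (+ 36) *ₛ U ^ₛ 2 -ₛ remainder *ₛ g -ₛ x⁴ *ₛ h -ₛ K (neg 36) *ₛ (x *ₛ (x *ₛ x)) ≈ K (+ 6) *ₛ (K (+ 6) *ₛ (x *ₛ x))
    identity = ≈-trans (-ₛ-cong (-ₛ-cong (-ₛ-cong (≈-trans (*ₛ-congˡ (*ₛ-congˡ (PSR.*-identityʳ U)))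
        (≈-trans (solve 1 (λ u → # 36 :* (u :* u) := (# 6 :* u) :* (# 6 :* u)) ≈-refl U) (*ₛ-cong 6U 6U))) ≈-refl) ≈-refl) ≈-refl)
      (solve 2 (λ x r → let y = # 6 :* x :- # 3 :* (x :* x) :+ # 2 :* (x :* (x :* x)) ; v = # 2 :* x :- # 3 in
        (y :+ r) :* (y :+ r) :- r :* (# 2 :* y :+ r) :- x :* x :* x :* x :* (# 24 :+ v :* v) :- con (neg 36) :* (x :* (x :* x))
        := # 6 :* (# 6 :* (x :* x))) ≈-refl x remainder)

  A-x : Annihilated x
  A-x = A-cancel (A-resp identity (A-- (A-- (A-- (A-K (+ 6) (A-U 1 ℕP.≤-refl (s≤s z≤n))) (A-DS DS-remainder)) (A-K (neg 3) A-x²)) (A-K (+ 2) A-x³)))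
    where
    identity : K (+ 6) *ₛ U ^ₛ 1 -ₛ remainder -ₛ K (neg 3) *ₛ (x *ₛ x) -ₛ K (+ 2) *ₛ (x *ₛ (x *ₛ x)) ≈ K (+ 6) *ₛ x
    identity = ≈-trans (-ₛ-cong (-ₛ-cong (-ₛ-cong (≈-trans (*ₛ-congˡ (PSR.*-identityʳ U)) 6U) ≈-refl) ≈-refl) ≈-refl)
      (solve 2 (λ x r → # 6 :* x :- # 3 :* (x :* x) :+ # 2 :* (x :* (x :* x)) :+ r :- r :- con (neg 3) :* (x :* x) :- # 2 :* (x :* (x :* x))
        := # 6 :* x) ≈-refl x remainder)

  -- Negative powers of 1 + x

  WY : W *ₛ Y ≈ oneS
  WY = *ₛ-inv1 W W-at-0

  -- Multiply f Y^k by 1 = W Y = (1 + x) Y.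
  Y-step : ∀ f k → f *ₛ Y ^ₛ k -ₛ x *ₛ f *ₛ Y ^ₛ suc k ≈ f *ₛ Y ^ₛ suc k
  Y-step f k = ≈-trans (-ₛ-cong (*ₛ-congˡ (≈-trans (≈-sym (PSR.*-identityˡ (Y ^ₛ k))) (*ₛ-congʳ (≈-sym WY)))) ≈-refl)
    (solve 4 (λ f w y p → f :* (w :* y :* p) :- (w :- # 1) :* f :* (y :* p) := f :* (y :* p)) ≈-refl f W Y (Y ^ₛ k))

  -- By `Y-step`, one more power of Y is bought with one more factor x. Starting from x, the chain
  -- of purchases ends at x⁴, which is divisible by p⁴.
  A-step : ∀ f → Annihilated f → (∀ k → Annihilated (x *ₛ f *ₛ Y ^ₛ k)) → ∀ k → Annihilated (f *ₛ Y ^ₛ k)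
  A-step f a b zero = A-resp (≈-sym (PSR.*-identityʳ f)) a
  A-step f a b (suc k) = A-resp (Y-step f k) (A-- (A-step f a b k) (b (suc k)))

  A-xYᵏ : ∀ k → Annihilated (x *ₛ Y ^ₛ k)
  A-xYᵏ = A-step x A-x (A-step (x *ₛ x) A-x² (A-step (x *ₛ (x *ₛ x)) A-x³
    (λ k → A-resp (*ₛ-congʳ (solve 1 (λ x → x :* x :* x :* x := x :* (x :* (x :* x))) ≈-refl x)) (A-x⁴ (DS-^ k DS-Y)))))

  -- The recursion C Y^(m+1) = C Y^m - x C Y^(m+1) stands in for the binomial series of (1 +
  -- x)^(-m); its last term is annihilated, so only Λ_p(C) ≡ C remains.
  ΛCYᵐ : ∀ m n → D 4 ((Cmix *ₛ Y ^ₛ m) (p ℕ.* n) - Cmix n)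
  ΛCYᵐ zero n = D-resp (cong (_- Cmix n) (sym (at (PSR.*-identityʳ Cmix) (p ℕ.* n)))) (ΛC n)
  ΛCYᵐ (suc m) n = D-resp (trans (solveℚ 3 (λ a b c → (a ⟨-⟩ c) ⟨-⟩ b ⟨=⟩ (a ⟨-⟩ b) ⟨-⟩ c) refl ((Cmix *ₛ Y ^ₛ m) (p ℕ.* n)) ((Cmix *ₛ (x *ₛ Y ^ₛ suc m)) (p ℕ.* n)) (Cmix n))
      (cong (_- Cmix n) (trans (sym (-ₛ-at _ _ (p ℕ.* n))) (at step (p ℕ.* n)))))
    (D-- (ΛCYᵐ m n) (A-xYᵏ (suc m) n))
    where
    step : Cmix *ₛ Y ^ₛ m -ₛ Cmix *ₛ (x *ₛ Y ^ₛ suc m) ≈ Cmix *ₛ Y ^ₛ suc m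
    step = ≈-trans (solve 4 (λ c a x b → c :* a :- c :* (x :* b) := c :* a :- x :* c :* b) ≈-refl Cmix (Y ^ₛ m) x (Y ^ₛ suc m)) (Y-step Cmix m)

  compose-one : Sub.compose oneS ≈ oneS
  compose-one = ≈-trans (Sub.compose-step oneS) (≈-trans (+ₛ-congˡ (≈-trans (*ₛ-congˡ compose-zero) (PSR.zeroʳ (qpow p)))) (PSR.+-identityʳ oneS))
    where
    compose-zero : Sub.compose (tail oneS) ≈ zeroS
    compose-zero = ≈-trans (Sub.compose-cong (mk≈ λ n → trans (sym (zeroS-at n)) (sym (at (PSR.zeroˡ oneS) n))))
      (≈-trans (Sub.compose-const 0ℚ oneS) (PSR.zeroˡ _))

  compose-^ : ∀ f n → Sub.compose (f ^ₛ n) ≈ Sub.compose f ^ₛ n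
  compose-^ f zero = compose-one
  compose-^ f (suc n) = ≈-trans (Sub.compose-* f (f ^ₛ n)) (*ₛ-congˡ (compose-^ f n))

  inv-Sp : inv1 Sp ≈ Sub.compose Hmix
  inv-Sp = *ₛ-cancelˡ Sp Sp-at-0 (≈-trans (*ₛ-inv1 Sp Sp-at-0) (≈-sym (≈-trans (*ₛ-congʳ (subPow-compose tOverQ))
    (≈-trans (≈-sym (Sub.compose-* tOverQ Hmix)) (≈-trans (Sub.compose-cong (≈-trans (PSR.*-comm tOverQ Hmix) HT)) compose-one)))))

  Hᵖ : Hmix ^ₛ p ≈ Y *ₛ Sub.compose Hmix
  Hᵖ = *ₛ-cancelˡ (tOverQ ^ₛ p) (^ₛ-at-0-one tOverQ p Tq-at-0) (begin
    tOverQ ^ₛ p *ₛ Hmix ^ₛ p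
      ≈⟨ ≈-trans (≈-sym (^ₛ-distrib-*ₛ tOverQ Hmix p)) (≈-trans (^ₛ-cong p (≈-trans (PSR.*-comm tOverQ Hmix) HT)) (one-^ₛ p)) ⟩
    oneS
      ≈⟨ ≈-sym WY ⟩
    tOverQ ^ₛ p *ₛ inv1 Sp *ₛ Y
      ≈⟨ ≈-trans (*ₛ-congʳ (*ₛ-congˡ inv-Sp)) (solve 3 (λ t s y → t :* s :* y := t :* (y :* s)) ≈-refl (tOverQ ^ₛ p) (Sub.compose Hmix) Y) ⟩
    tOverQ ^ₛ p *ₛ (Y *ₛ Sub.compose Hmix) ∎)
    where open ≈-Reasoning

  Hᵖᵐ : ∀ m → Hmix ^ₛ (p ℕ.* m) ≈ Y ^ₛ m *ₛ Sub.compose (Hmix ^ₛ m)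
  Hᵖᵐ m = ≈-trans (^ₛ-* Hmix p m) (≈-trans (^ₛ-cong m Hᵖ) (≈-trans (^ₛ-distrib-*ₛ Y (Sub.compose Hmix) m) (*ₛ-congˡ (≈-sym (compose-^ Hmix m)))))

  -- In C H^(pm) = C Y^m · H(q^p)^m the last factor leaves Λ_p as H^m. Being p-integral, H^m
  -- preserves the congruence Λ_p(C Y^m) ≡ C.
  Λ-congruence : ∀ m n → CongQ p 4 (Λ p (Cmix ⊛ pow Hmix (p ℕ.* m)) n) ((Cmix ⊛ pow Hmix m) n)
  Λ-congruence m n = D⇒DivPow (D-resp (sym (trans (cong₂ _-_ left right) (trans (sym (-ₛ-at _ _ n)) (at distribute n))))
      (DS-* {4} {0} (λ k → D-resp (sym (-ₛ-at _ _ k)) (ΛCYᵐ m k)) (DS-^ m DS-H) n))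
    where
    left : (Cmix ⊛ pow Hmix (p ℕ.* m)) (p ℕ.* n) ≡ (Λ p (Cmix *ₛ Y ^ₛ m) *ₛ Hmix ^ₛ m) n
    left = trans (at (≈-trans (⊛≈*ₛ {Cmix} ≈-refl (pow-^ₛ Hmix (p ℕ.* m))) (≈-trans (*ₛ-congˡ (Hᵖᵐ m)) (≈-sym (PSR.*-assoc _ _ _)))) (p ℕ.* n))
      (Λ-compose (Cmix *ₛ Y ^ₛ m) n (Hmix ^ₛ m))
    right : (Cmix ⊛ pow Hmix m) n ≡ (Cmix *ₛ Hmix ^ₛ m) n
    right = at (⊛≈*ₛ {Cmix} ≈-refl (pow-^ₛ Hmix m)) n
    distribute : Λ p (Cmix *ₛ Y ^ₛ m) *ₛ Hmix ^ₛ m -ₛ Cmix *ₛ Hmix ^ₛ m ≈ (Λ p (Cmix *ₛ Y ^ₛ m) -ₛ Cmix) *ₛ Hmix ^ₛ m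
    distribute = solve 3 (λ l c h → l :* h :- c :* h := (l :- c) :* h) ≈-refl (Λ p (Cmix *ₛ Y ^ₛ m)) Cmix (Hmix ^ₛ m)

  Amix-congruence : ∀ m → CongQ p 4 (Amix (m ℕ.* p)) (Amix m)
  Amix-congruence m = subst (λ k → CongQ p 4 (Amix k) (Amix m)) (ℕP.*-comm p m)
    (subst (DivPow p 4) (sym (cong₂ _-_ (Amix-coefficient (p ℕ.* m)) (Amix-coefficient m))) (Λ-congruence m m))

open import Data.Nat using (_*_)

theorem3p8 : (p : ℕ) → Prime p → 7 ≤ p → p % 3 ≡ 1 →
    (∀ ℓ → 1 ≤ ℓ → ℓ ≤ 3 → CongPS p 4 (Λ p (Cmix ⊛ pow (Up p) ℓ)) (λ _ → 0ℚ)) →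
    (∀ m → 1 ≤ m → CongPS p 4 (Λ p (Cmix ⊛ pow Hmix (p * m))) (Cmix ⊛ pow Hmix m))
    × (∀ m → 1 ≤ m → CongQ p 4 (Amix (m * p)) (Amix m))
theorem3p8 (suc p′) p-prime 7≤p p%3≡1 hypothesis = (λ m _ → Λ-congruence m) , (λ m _ → Amix-congruence m)
  where open Supercongruence p′ p-prime 7≤p p%3≡1 hypothesis
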